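{- Let $J$ be the Jacobian of a genus $3$ hyperelliptic curve over $\mathbb{F}_q$, let $\ell$ be a prime not dividing $q$, and let $\pi$ be the $q$-Frobenius endomorphism acting $\mathbb{F}_\ell$-linearly on $J[\ell]\cong\mathbb{F}_\ell^6$. Let $p_1(x),\dots,p_n(x)\in\mathbb{F}_\ell[x]$ be distinct monic irreducible polynomials of degrees $d_1,\dots,d_n$, and suppose that in some basis of $J[\ell]$ the action of $\pi$ is given by the block diagonal matrix $$M=\operatorname{diag}\bigl(C[p_1^{e_{1,1}}],\dots,C[p_1^{e_{1,m_1}}],\dots,C[p_n^{e_{n,1}}],\dots,C[p_n^{e_{n,m_n}}]\bigr).$$ Choose $r\ge 1$ distinct blocks $C[p_{i_1}^{e_{i_1,j_1}}],\dots,C[p_{i_r}^{e_{i_r,j_r}}]$ of $M$ and levels $k_1,\dots,k_r$ with $1\le k_s\le e_{i_s,j_s}$. Consider the elements $D\in J[\ell]$ whose components in these $r$ blocks are nonzero, the component in the $s$-th chosen block being at level $k_s$ (i.e. having minimal polynomial exactly $p_{i_s}^{k_s}$), and whose components in all other blocks are zero. Then: (i) the minimal polynomial of each such element is $\operatorname{lcm}\bigl(p_{i_1}^{k_1}(x),\dots,p_{i_r}^{k_r}(x)\bigr)$; (ii) each such element is defined over an extension of $\mathbb{F}_q$ of degree $o\bigl(\operatorname{lcm}(p_{i_1}^{k_1}(x),\dots,p_{i_r}^{k_r}(x))\bigr)$; (iii) the total number of such elements is $\prod_{s=1}^{r}\ell^{d_{i_s}(k_s-1)}(\ell^{d_{i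_s}}-1)$.
   Context: The curve is $y^2=f(x)$ with $f\in\mathbb{F}_q[x]$ monic of degree $7$ with distinct roots, $q$ a power of an odd prime. $J[\ell]=\{D\in J(\overline{\mathbb{F}}_q):[\ell]D=0\}$. For a monic polynomial $p(x)=a_0+a_1x+\dots+a_{n-1}x^{n-1}+x^n$, $C[p]$ denotes its companion matrix: the $n\times n$ matrix with $1$'s on the superdiagonal, last row $(-a_0,-a_1,\dots,-a_{n-1})$ and zeros elsewhere. The minimal polynomial of an element $D$ (or of a component in a block) is the monic polynomial $g\in\mathbb{F}_\ell[x]$ of least degree with $g(\pi)D=0$, equivalently the minimal polynomial of $\pi$ restricted to $\operatorname{Span}_{\mathbb{F}_\ell}\{\pi^n(D):n\in\mathbb{N}\}$. For a polynomial $P\in\mathbb{F}_\ell[x]$ with $P(0)\neq0$, $o(P):=\min\{k\in\mathbb{N},\,k\ge1: x^k-1\equiv 0\pmod P\}$. The degree of the extension over which $D$ is defined is the least $k\geq 1$ with $D\in J(\mathbb{F}_{q^k})$. -}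

module Defs where

open import Algebra.Bundles using (CommutativeRing; RawSemiring; Semiring)
open import Algebra.Module.Bundles using (Module)
import Algebra.Definitions.RawMonoid as RawMonoidDefs
import Algebra.Definitions.RawSemiring as RawSemiringDefs
import Algebra.Module.Structures.Biased as Biased
open import Algebra.Morphism.Structures using (IsRingIsomorphism)
import Algebra.Properties.CommutativeSemiring.Binomial as Binomial
import Algebra.Properties.CommutativeSemiring.Exp as CommExp
import Algebra.Properties.CommutativeSemigroup as CommSemigroup
import Algebra.Properties.Ring as RingProperties
import Algebra.Properties.Semiring.Exp as Exp
import Algebra.Properties.Semiring.Mult as Mult
import Algebra.Properties.Semiring.Sum as Sum
open import Data.Empty using (⊥-elim)
open import Data.Fin.Base using (Fin; zero; suc; toℕ; fromℕ; inject₁)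
import Data.Fin.Properties as Fin
open import Data.Integer.Base as ℤ using (ℤ; +_; -[1+_]; 0ℤ; 1ℤ)
import Data.Integer.Divisibility.Signed as ℤDiv
import Data.Integer.Properties as ℤ
open import Data.Integer.Solver using (module +-*-Solver)
open import Data.List.Base as List using (List; []; _∷_; _++_)
open import Data.Nat.Base as ℕ using (ℕ; zero; suc; _≤_; _<_; z≤n; s≤s)
import Data.Nat.Combinatorics as ℕComb
import Data.Nat.Combinatorics.Specification as ℕCombSpec
import Data.Nat.DivMod as ℕDivMod
import Data.Nat.Divisibility as ℕDiv
open import Data.Nat.Primality as ℕPrime using (Prime)
import Data.Nat.Properties as ℕ
open import Data.Product.Base using (Σ; Σ-syntax; ∃; _×_; _,_; proj₁; proj₂; ∃-syntax)
open import Data.Product.Properties using (≡-dec)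
open import Data.Sum.Base using (_⊎_; inj₁; inj₂)
open import Data.Vec.Functional using (Vector)
open import Level using (Level; _⊔_; 0ℓ)
open import Relation.Binary.Bundles using (Setoid)
import Relation.Binary.Construct.On as On
open import Relation.Binary.Definitions using (Decidable)
open import Relation.Binary.PropositionalEquality as ≡ using (_≡_; _≢_)
import Relation.Binary.Reasoning.Setoid as SetoidReasoning
open import Relation.Nullary.Decidable using (Dec; yes; no; _×-dec_)
open import Relation.Nullary.Negation using (¬_)

private
  variable
    c ℓ a b : Level

module Polynomial (R : CommutativeRing c ℓ) where
  open CommutativeRing R

  -- Coefficient lists, constant term first.  Trailing zeros are allowed,
  -- so polynomials are compared coefficientwise by _≈ᴾ_.
  Poly : Set c
  Poly = List Carrier

  coeff : Poly → ℕ → Carrier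
  coeff []      _       = 0#
  coeff (x ∷ g) zero    = x
  coeff (x ∷ g) (suc i) = coeff g i

  infix 4 _≈ᴾ_
  _≈ᴾ_ : Poly → Poly → Set ℓ
  g ≈ᴾ h = ∀ i → coeff g i ≈ coeff h i

  infixl 6 _+ᴾ_
  _+ᴾ_ : Poly → Poly → Poly
  []      +ᴾ h       = h
  (x ∷ g) +ᴾ []      = x ∷ g
  (x ∷ g) +ᴾ (y ∷ h) = (x + y) ∷ (g +ᴾ h)

  infixl 7 _*ᴾ_
  _*ᴾ_ : Poly → Poly → Poly
  []      *ᴾ h = []
  (x ∷ g) *ᴾ h = List.map (x *_) h +ᴾ (0# ∷ (g *ᴾ h))

  polyRawSemiring : RawSemiring c ℓ
  polyRawSemiring = record
    { Carrier = Poly ; _≈_ = _≈ᴾ_ ; _+_ = _+ᴾ_ ; _*_ = _*ᴾ_ ; 0# = [] ; 1# = 1# ∷ [] }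

  open RawSemiringDefs polyRawSemiring public
    using (Irreducible)
    renaming (_∣_ to _∣ᴾ_; _^_ to _^ᴾ_; product to productᴾ)

  eval : Poly → Carrier → Carrier
  eval []      x = 0#
  eval (y ∷ g) x = y + x * eval g x

  X^ : ℕ → Poly
  X^ zero    = 1# ∷ []
  X^ (suc n) = 0# ∷ X^ n

  X^n-1 : ℕ → Poly
  X^n-1 n = X^ n +ᴾ (- 1# ∷ [])

  X-_ : Carrier → Poly
  X- x = - x ∷ 1# ∷ []

  MonicOfDegree : ℕ → Poly → Set ℓ
  MonicOfDegree n g = coeff g n ≈ 1# × (∀ i → n < i → coeff g i ≈ 0#)

  Monic : Poly → Set ℓ
  Monic g = ∃[ n ] MonicOfDegree n g

  record IsLcm {r : ℕ} (g : Vector Poly r) (L : Poly) : Set (c ⊔ ℓ) where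
    field
      monic    : Monic L
      multiple : ∀ s → g s ∣ᴾ L
      least    : ∀ h → (∀ s → g s ∣ᴾ h) → L ∣ᴾ h

  -- IsOrder P k says k = o(P).
  record IsOrder (P : Poly) (k : ℕ) : Set (c ⊔ ℓ) where
    field
      P[0]≉0   : coeff P 0 ≉ 0#
      positive : 1 ≤ k
      divides  : P ∣ᴾ X^n-1 k
      least    : ∀ j → 1 ≤ j → P ∣ᴾ X^n-1 j → k ≤ j

  companion : (P : Poly) {n : ℕ} → Fin n → Fin n → Carrier
  companion P {n} i j with suc (toℕ i) ℕ.<? n
  ... | no  _ = - coeff P (toℕ j)
  ... | yes _ with toℕ j ℕ.≟ suc (toℕ i)
  ...   | yes _ = 1#
  ...   | no  _ = 0#

-- mult i is the number m_i of blocks belonging to the i-th polynomial.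
record CompanionBlocks (R : CommutativeRing c ℓ) : Set (c ⊔ ℓ) where
  open CommutativeRing R
  open Polynomial R
  field
    n           : ℕ
    P           : Fin n → Poly
    d           : Fin n → ℕ
    monic       : ∀ i → MonicOfDegree (d i) (P i)
    irreducible : ∀ i → Irreducible (P i)
    distinct    : ∀ i j → P i ≈ᴾ P j → i ≡ j
    mult        : Fin n → ℕ
    e           : (i : Fin n) → Fin (mult i) → ℕ

  Block : Set
  Block = Σ[ i ∈ Fin n ] Fin (mult i)

  size : Block → ℕ
  size (i , j) = d i ℕ.* e i j

  -- Rows and columns of M are indexed by a block and a position in it.
  Index : Set
  Index = Σ[ β ∈ Block ] Fin (size β)

  M : Index → Index → Carrier
  M ((i , j) , s) (β' , t) with ≡-dec Fin._≟_ Fin._≟_ (i , j) β'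
  ... | yes ≡.refl = companion (P i ^ᴾ e i j) s t
  ... | no  _      = 0#

module LinearAlgebra {R : CommutativeRing c ℓ} (V : Module R a b)
                     (φ : Module.Carrierᴹ V → Module.Carrierᴹ V) where
  open CommutativeRing R
  open Polynomial R
  open Module V
  open RawMonoidDefs +ᴹ-rawMonoid using (sum)

  -- act g D = g(φ) D
  act : Poly → Carrierᴹ → Carrierᴹ
  act []      D = 0ᴹ
  act (x ∷ g) D = (x *ₗ D) +ᴹ φ (act g D)

  record IsMinimalPolynomial (D : Carrierᴹ) (g : Poly) : Set (c ⊔ ℓ ⊔ b) where
    field
      degree      : ℕ
      monic       : MonicOfDegree degree g
      annihilates : act g D ≈ᴹ 0ᴹ
      least       : ∀ n h → MonicOfDegree n h → act h D ≈ᴹ 0ᴹ → degree ≤ n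

  module _ (B : CompanionBlocks R) where
    open CompanionBlocks B

    Family : ∀ {x} → Set x → Set x
    Family A = (β : Block) → Fin (size β) → A

    blockCombination : Family Carrier → Family Carrierᴹ → Block → Carrierᴹ
    blockCombination x v β = sum (λ t → x β t *ₗ v β t)

    linearCombination : Family Carrier → Family Carrierᴹ → Carrierᴹ
    linearCombination x v =
      sum (λ i → sum (λ j → blockCombination x v (i , j)))

    record IsBasis (v : Family Carrierᴹ) : Set (c ⊔ ℓ ⊔ a ⊔ b) where
      field
        spans       : ∀ D → ∃[ x ] D ≈ᴹ linearCombination x v
        independent : ∀ x → linearCombination x v ≈ᴹ 0ᴹ → ∀ β t → x β t ≈ 0#

    -- The columns of M are the images of the basis vectors.
    IsMatrixOfφ : Family Carrierᴹ → Set b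
    IsMatrixOfφ v = ∀ β t →
      φ (v β t) ≈ᴹ linearCombination (λ β' s → M (β' , s) (β , t)) v

    component : {v : Family Carrierᴹ} → IsBasis v → Carrierᴹ → Block → Carrierᴹ
    component {v} basis D β = blockCombination (proj₁ (IsBasis.spans basis D)) v β

    record AtLevels {v : Family Carrierᴹ} (basis : IsBasis v)
                    {r : ℕ} (chosen : Fin r → Block) (k : Fin r → ℕ)
                    (D : Carrierᴹ) : Set (c ⊔ ℓ ⊔ b) where
      field
        nonzero   : ∀ s → component basis D (chosen s) ≉ᴹ 0ᴹ
        level     : ∀ s → IsMinimalPolynomial (component basis D (chosen s))
                                              (P (proj₁ (chosen s)) ^ᴾ k s)
        elsewhere : ∀ β → (∀ s → chosen s ≢ β) → component basis D β ≈ᴹ 0ᴹ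

    AtLevelsSetoid : {v : Family Carrierᴹ} → IsBasis v →
                     {r : ℕ} → (Fin r → Block) → (Fin r → ℕ) → Setoid _ _
    AtLevelsSetoid basis chosen k =
      On.setoid {B = Σ[ D ∈ Carrierᴹ ] AtLevels basis chosen k D} ≈ᴹ-setoid proj₁

record Congruent (l : ℕ) (x y : ℤ) : Set where
  constructor congruent
  field
    divisible : + l ℤDiv.∣ (x ℤ.- y)

module _ (l : ℕ) where
  private
    infix 4 _~_
    _~_ : ℤ → ℤ → Set
    _~_ = Congruent l

    ~-reflexive : ∀ {x y} → x ≡ y → x ~ y
    ~-reflexive {x} ≡.refl =
      congruent (ℤDiv.divides 0ℤ (≡.trans (ℤ.+-inverseʳ x) (≡.sym (ℤ.*-zeroˡ (+ l)))))

    ~-sym : ∀ {x y} → x ~ y → y ~ x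
    ~-sym {x} {y} (congruent e) = congruent (≡.subst (+ l ℤDiv.∣_) eq (ℤDiv.∣m⇒∣-m e))
      where
      open +-*-Solver
      eq : ℤ.- (x ℤ.- y) ≡ y ℤ.- x
      eq = solve 2 (λ x y → :- (x :- y) := y :- x) ≡.refl x y

    ~-trans : ∀ {x y z} → x ~ y → y ~ z → x ~ z
    ~-trans {x} {y} {z} (congruent e) (congruent e') =
      congruent (≡.subst (+ l ℤDiv.∣_) eq (ℤDiv.∣m∣n⇒∣m+n e e'))
      where
      open +-*-Solver
      eq : (x ℤ.- y) ℤ.+ (y ℤ.- z) ≡ x ℤ.- z
      eq = solve 3 (λ x y z → (x :- y) :+ (y :- z) := x :- z) ≡.refl x y z

    ~-+ : ∀ {x y u v} → x ~ y → u ~ v → x ℤ.+ u ~ y ℤ.+ v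
    ~-+ {x} {y} {u} {v} (congruent e) (congruent e') =
      congruent (≡.subst (+ l ℤDiv.∣_) eq (ℤDiv.∣m∣n⇒∣m+n e e'))
      where
      open +-*-Solver
      eq : (x ℤ.- y) ℤ.+ (u ℤ.- v) ≡ (x ℤ.+ u) ℤ.- (y ℤ.+ v)
      eq = solve 4 (λ x y u v → (x :- y) :+ (u :- v) := (x :+ u) :- (y :+ v))
                 ≡.refl x y u v

    ~-* : ∀ {x y u v} → x ~ y → u ~ v → x ℤ.* u ~ y ℤ.* v
    ~-* {x} {y} {u} {v} (congruent e) (congruent e') =
      congruent (≡.subst (+ l ℤDiv.∣_) eq
                  (ℤDiv.∣m∣n⇒∣m+n (ℤDiv.∣n⇒∣m*n x e') (ℤDiv.∣m⇒∣m*n v e)))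
      where
      open +-*-Solver
      eq : x ℤ.* (u ℤ.- v) ℤ.+ (x ℤ.- y) ℤ.* v ≡ x ℤ.* u ℤ.- y ℤ.* v
      eq = solve 4 (λ x y u v → x :* (u :- v) :+ (x :- y) :* v := x :* u :- y :* v)
                 ≡.refl x y u v

    ~-neg : ∀ {x y} → x ~ y → ℤ.- x ~ ℤ.- y
    ~-neg {x} {y} (congruent e) = congruent (≡.subst (+ l ℤDiv.∣_) eq (ℤDiv.∣m⇒∣-m e))
      where
      open +-*-Solver
      eq : ℤ.- (x ℤ.- y) ≡ ℤ.- x ℤ.- ℤ.- y
      eq = solve 2 (λ x y → :- (x :- y) := (:- x) :- (:- y)) ≡.refl x y

  ℤ/_ : CommutativeRing 0ℓ 0ℓ
  ℤ/_ = record
    { Carrier = ℤ ; _≈_ = Congruent l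
    ; _+_ = ℤ._+_ ; _*_ = ℤ._*_ ; -_ = ℤ.-_ ; 0# = 0ℤ ; 1# = 1ℤ
    ; isCommutativeRing = record
      { isRing = record
        { +-isAbelianGroup = record
          { isGroup = record
            { isMonoid = record
              { isSemigroup = record
                { isMagma = record
                  { isEquivalence = record
                    { refl = ~-reflexive ≡.refl ; sym = ~-sym ; trans = ~-trans }
                  ; ∙-cong = ~-+ }
                ; assoc = λ x y z → ~-reflexive (ℤ.+-assoc x y z) }
              ; identity = (λ x → ~-reflexive (ℤ.+-identityˡ x))
                         , (λ x → ~-reflexive (ℤ.+-identityʳ x)) }
            ; inverse = (λ x → ~-reflexive (ℤ.+-inverseˡ x))
                      , (λ x → ~-reflexive (ℤ.+-inverseʳ x))
            ; ⁻¹-cong = ~-neg }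
          ; comm = λ x y → ~-reflexive (ℤ.+-comm x y) }
        ; *-cong = ~-*
        ; *-assoc = λ x y z → ~-reflexive (ℤ.*-assoc x y z)
        ; *-identity = (λ x → ~-reflexive (ℤ.*-identityˡ x))
                     , (λ x → ~-reflexive (ℤ.*-identityʳ x))
        ; distrib = (λ x y z → ~-reflexive (ℤ.*-distribˡ-+ x y z))
                  , (λ x y z → ~-reflexive (ℤ.*-distribʳ-+ x y z)) }
      ; *-comm = λ x y → ~-reflexive (ℤ.*-comm x y) } }

record IsDiscreteField (K : CommutativeRing c ℓ) : Set (c ⊔ ℓ) where
  open CommutativeRing K
  infix 4 _≟_
  field
    _≟_     : Decidable _≈_
    1≉0     : 1# ≉ 0#
    inverse : ∀ x → x ≉ 0# → ∃[ y ] x * y ≈ 1#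

record IsAlgebraicClosureOf𝔽 (p : ℕ) (K : CommutativeRing c ℓ) : Set (c ⊔ ℓ) where
  open CommutativeRing K
  open Polynomial K
  open RawSemiringDefs (Semiring.rawSemiring semiring) using () renaming (_×_ to _×#_)
  field
    isDiscreteField     : IsDiscreteField K
    characteristic      : p ×# 1# ≈ 0#
    algebraicallyClosed : ∀ n g → MonicOfDegree (suc n) g → ∃[ x ] eval g x ≈ 0#
    -- A polynomial over the prime field is the image of a list of naturals.
    algebraic           : ∀ x → Σ[ g ∈ List ℕ ]
                            (¬ List.map (_×# 1#) g ≈ᴾ []) ×
                            eval (List.map (_×# 1#) g) x ≈ 0#
  open IsDiscreteField isDiscreteField public

-- All finite fields of characteristic p are taken inside an algebraic closure
-- K of 𝔽_p: 𝔽_Q is { x ∈ K : x^Q = x } for Q a power of p.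

module _ (K : CommutativeRing c ℓ) where
  open CommutativeRing K
  open Polynomial K
  open RawSemiringDefs (Semiring.rawSemiring semiring) using (_^_)

  _∈𝔽_ : Carrier → ℕ → Set ℓ
  x ∈𝔽 Q = x ^ Q ≈ x

  record HyperellipticCurve (q : ℕ) : Set (c ⊔ ℓ) where
    field
      f                 : Poly
      f-over-𝔽q         : ∀ i → coeff f i ∈𝔽 q
      f-monic-degree-7  : MonicOfDegree 7 f
      f-distinct-roots  : Σ[ r ∈ Vector Carrier 7 ]
                            (∀ i j → r i ≈ r j → i ≡ j) ×
                            f ≈ᴾ productᴾ (λ i → X- r i)

  record Gal (Q : ℕ) : Set (c ⊔ ℓ) where
    field
      σ                 : Carrier → Carrier
      isRingIsomorphism : IsRingIsomorphism rawRing rawRing σ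
      fixes             : ∀ x → x ∈𝔽 Q → σ x ≈ x

module Jacobian
  (p m : ℕ) (p-prime : Prime p)
  (K : CommutativeRing c ℓ) (isClosure : IsAlgebraicClosureOf𝔽 p K)
  (C : HyperellipticCurve K (p ℕ.^ m))
  where

  open CommutativeRing K hiding (zero)
  open Polynomial K using (coeff; eval; Poly; MonicOfDegree; X^)
  open RawSemiringDefs (Semiring.rawSemiring semiring) using (_^_) renaming (_×_ to _×#_)
  open IsAlgebraicClosureOf𝔽 isClosure
  open HyperellipticCurve C
  private
    module CS = CommSemigroup *-commutativeSemigroup
    module RP = RingProperties ring
    module E  = Exp semiring
    module CE = CommExp commutativeSemiring
    module ≈R = SetoidReasoning setoid

  q : ℕ
  q = p ℕ.^ m

  x*y≉0 : ∀ {x y} → x ≉ 0# → y ≉ 0# → x * y ≉ 0#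
  x*y≉0 {x} {y} x≉0 y≉0 xy≈0 with inverse x x≉0
  ... | (z , xz≈1) = y≉0 (begin
    y           ≈⟨ *-identityˡ y ⟨
    1# * y      ≈⟨ *-congʳ (trans (*-comm z x) xz≈1) ⟨
    z * x * y   ≈⟨ *-assoc z x y ⟩
    z * (x * y) ≈⟨ *-congˡ xy≈0 ⟩
    z * 0#      ≈⟨ zeroʳ z ⟩
    0#          ∎)
    where open ≈R

  record Point : Set (c ⊔ ℓ) where
    constructor point
    field
      x y     : Carrier
      onCurve : y * y ≈ eval f x
  open Point public

  infix 4 _≈ₚ_ _≟ₚ_
  _≈ₚ_ : Point → Point → Set ℓ
  P ≈ₚ Q = x P ≈ x Q × y P ≈ y Q

  _≟ₚ_ : Decidable _≈ₚ_
  P ≟ₚ Q = (x P ≟ x Q) ×-dec (y P ≟ y Q)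

  ≈ₚ-sym : ∀ {P Q} → P ≈ₚ Q → Q ≈ₚ P
  ≈ₚ-sym (e , e') = sym e , sym e'

  ≈ₚ-trans : ∀ {P Q R} → P ≈ₚ Q → Q ≈ₚ R → P ≈ₚ R
  ≈ₚ-trans (e , e') (g , g') = trans e g , trans e' g'

  -- Elements of K[x,y].  As K is algebraically closed, two of them have the
  -- same class in the coordinate ring iff they agree at every affine point.
  data Function : Set c where
    const   : Carrier → Function
    X Y     : Function
    _⊕_ _⊗_ : Function → Function → Function

  infix 9 _⟨_⟩
  _⟨_⟩ : Function → Point → Carrier
  const k ⟨ P ⟩ = k
  X       ⟨ P ⟩ = x P
  Y       ⟨ P ⟩ = y P
  (G ⊕ H) ⟨ P ⟩ = G ⟨ P ⟩ + H ⟨ P ⟩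
  (G ⊗ H) ⟨ P ⟩ = G ⟨ P ⟩ * H ⟨ P ⟩

  uniformizer : Point → Function
  uniformizer P with y P ≟ 0#
  ... | yes _ = Y
  ... | no  _ = X ⊕ const (- x P)

  -- ord_P G = n: G is tⁿ times a unit of the local ring at P.  No n satisfies
  -- this for G = 0, the coordinate ring being a domain.
  record Order (P : Point) (G : Function) (n : ℕ) : Set (c ⊔ ℓ) where
    field
      u v   : Function
      u≉0   : u ⟨ P ⟩ ≉ 0#
      v≉0   : v ⟨ P ⟩ ≉ 0#
      local : ∀ Q → u ⟨ Q ⟩ * G ⟨ Q ⟩ ≈ uniformizer P ⟨ Q ⟩ ^ n * v ⟨ Q ⟩

  -- w P = ord_P (G / H) at all affine P.
  record Principal (w : Point → ℤ) : Set (c ⊔ ℓ) where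
    field
      G H : Function
      div : ∀ P → ∃[ i ] ∃[ j ] Order P G i × Order P H j × w P ≡ + i ℤ.- + j

  order-1 : ∀ P → Order P (const 1#) 0
  order-1 P = record
    { u = const 1# ; v = const 1# ; u≉0 = 1≉0 ; v≉0 = 1≉0 ; local = λ _ → refl }

  order-⊗ : ∀ {P G H i j} → Order P G i → Order P H j → Order P (G ⊗ H) (i ℕ.+ j)
  order-⊗ {P} {G} {H} {i} {j} o o' = record
    { u = O.u ⊗ O'.u ; v = O.v ⊗ O'.v
    ; u≉0 = x*y≉0 O.u≉0 O'.u≉0 ; v≉0 = x*y≉0 O.v≉0 O'.v≉0
    ; local = λ Q → let t = uniformizer P ⟨ Q ⟩ in begin
        O.u ⟨ Q ⟩ * O'.u ⟨ Q ⟩ * (G ⟨ Q ⟩ * H ⟨ Q ⟩)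
          ≈⟨ CS.interchange (O.u ⟨ Q ⟩) (O'.u ⟨ Q ⟩) (G ⟨ Q ⟩) (H ⟨ Q ⟩) ⟩
        O.u ⟨ Q ⟩ * G ⟨ Q ⟩ * (O'.u ⟨ Q ⟩ * H ⟨ Q ⟩)
          ≈⟨ *-cong (O.local Q) (O'.local Q) ⟩
        t ^ i * O.v ⟨ Q ⟩ * (t ^ j * O'.v ⟨ Q ⟩)
          ≈⟨ CS.interchange (t ^ i) (O.v ⟨ Q ⟩) (t ^ j) (O'.v ⟨ Q ⟩) ⟩
        t ^ i * t ^ j * (O.v ⟨ Q ⟩ * O'.v ⟨ Q ⟩)
          ≈⟨ *-congʳ (E.^-homo-* t i j) ⟨
        t ^ (i ℕ.+ j) * (O.v ⟨ Q ⟩ * O'.v ⟨ Q ⟩) ∎ }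
    where
    open ≈R
    module O  = Order o
    module O' = Order o'

  principal-0 : ∀ {w} → (∀ P → w P ≡ 0ℤ) → Principal w
  principal-0 w≡0 = record
    { G = const 1# ; H = const 1#
    ; div = λ P → 0 , 0 , order-1 P , order-1 P , w≡0 P }

  principal-neg : ∀ {w} → Principal w → Principal (λ P → ℤ.- w P)
  principal-neg pr = record
    { G = Pr.H ; H = Pr.G
    ; div = λ P → let (i , j , o , o' , eq) = Pr.div P in
        j , i , o' , o ,
        ≡.trans (≡.cong ℤ.-_ eq)
          (solve 2 (λ i j → :- (i :- j) := j :- i) ≡.refl (+ i) (+ j)) }
    where
    open +-*-Solver
    module Pr = Principal pr

  principal-+ : ∀ {w w'} → Principal w → Principal w' →
                Principal (λ P → w P ℤ.+ w' P)
  principal-+ pr pr' = record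
    { G = Pr.G ⊗ Pr'.G ; H = Pr.H ⊗ Pr'.H
    ; div = λ P → let (i  , j  , oG  , oH  , eq)  = Pr.div P
                      (i' , j' , oG' , oH' , eq') = Pr'.div P in
        i ℕ.+ i' , j ℕ.+ j' , order-⊗ oG oG' , order-⊗ oH oH' ,
        ≡.trans (≡.cong₂ ℤ._+_ eq eq')
          (solve 4 (λ i j i' j' → (i :- j) :+ (i' :- j') := (i :+ i') :- (j :+ j'))
            ≡.refl (+ i) (+ j) (+ i') (+ j')) }
    where
    open +-*-Solver
    module Pr  = Principal pr
    module Pr' = Principal pr'

  principal-resp : ∀ {w w'} → (∀ P → w P ≡ w' P) → Principal w → Principal w'
  principal-resp e pr = record
    { G = Pr.G ; H = Pr.H
    ; div = λ P → let (i , j , oG , oH , eq) = Pr.div P in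
        i , j , oG , oH , ≡.trans (≡.sym (e P)) eq }
    where module Pr = Principal pr

  principal-scaleℕ : ∀ {w} n → Principal w → Principal (λ P → + n ℤ.* w P)
  principal-scaleℕ {w} zero    pr = principal-0 (λ P → ℤ.*-zeroˡ (w P))
  principal-scaleℕ {w} (suc n) pr =
    principal-resp (λ P → ≡.sym (ℤ.suc-* (+ n) (w P)))
      (principal-+ pr (principal-scaleℕ n pr))

  principal-scale : ∀ {w} n → Principal w → Principal (λ P → n ℤ.* w P)
  principal-scale (+ n) pr = principal-scaleℕ n pr
  principal-scale {w} -[1+ n ] pr =
    principal-resp (λ P → ℤ.neg-distribˡ-* (+ suc n) (w P))
      (principal-neg (principal-scaleℕ (suc n) pr))

  -- A list of pairs (n , P) stands for the degree 0 divisor Σ n (P - ∞).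
  -- There is a single point ∞ at infinity (deg f is odd), so every degree 0
  -- divisor has this form; a principal divisor has degree 0, hence is also
  -- determined by its affine part.

  Divisor : Set (c ⊔ ℓ)
  Divisor = List (ℤ × Point)

  ifDec : ∀ {x} {A : Set x} → Dec A → ℤ → ℤ
  ifDec (yes _) n = n
  ifDec (no  _) n = 0ℤ

  ifDec-cong : ∀ {x y} {A : Set x} {B : Set y} (A? : Dec A) (B? : Dec B) {n : ℤ} →
               (A → B) → (B → A) → ifDec A? n ≡ ifDec B? n
  ifDec-cong (yes a) (yes b) f g = ≡.refl
  ifDec-cong (yes a) (no ¬b) f g = ⊥-elim (¬b (f a))
  ifDec-cong (no ¬a) (yes b) f g = ⊥-elim (¬a (g b))
  ifDec-cong (no ¬a) (no ¬b) f g = ≡.refl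

  ifDec-* : ∀ {x} {A : Set x} (A? : Dec A) k n → ifDec A? (k ℤ.* n) ≡ k ℤ.* ifDec A? n
  ifDec-* (yes _) k n = ≡.refl
  ifDec-* (no  _) k n = ≡.sym (ℤ.*-zeroʳ k)

  multiplicity : Divisor → Point → ℤ
  multiplicity []            P = 0ℤ
  multiplicity ((n , Q) ∷ D) P = ifDec (Q ≟ₚ P) n ℤ.+ multiplicity D P

  infix 4 _∼_
  record _∼_ (D E : Divisor) : Set (c ⊔ ℓ) where
    constructor linEquiv
    field
      principal : Principal (λ P → multiplicity D P ℤ.- multiplicity E P)

  infixr 7 _·_
  _·_ : ℤ → Divisor → Divisor
  k · D = List.map (λ (n , P) → k ℤ.* n , P) D

  mult-++ : ∀ D E P → multiplicity (D ++ E) P ≡ multiplicity D P ℤ.+ multiplicity E P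
  mult-++ []            E P = ≡.sym (ℤ.+-identityˡ _)
  mult-++ ((n , Q) ∷ D) E P =
    ≡.trans (≡.cong (λ z → ifDec (Q ≟ₚ P) n ℤ.+ z) (mult-++ D E P))
            (≡.sym (ℤ.+-assoc (ifDec (Q ≟ₚ P) n) _ _))

  mult-· : ∀ k D P → multiplicity (k · D) P ≡ k ℤ.* multiplicity D P
  mult-· k []            P = ≡.sym (ℤ.*-zeroʳ k)
  mult-· k ((n , Q) ∷ D) P =
    ≡.trans (≡.cong₂ ℤ._+_ (ifDec-* (Q ≟ₚ P) k n) (mult-· k D P))
            (≡.sym (ℤ.*-distribˡ-+ k (ifDec (Q ≟ₚ P) n) (multiplicity D P)))

  ∼-from-≡ : ∀ {D E} → (∀ P → multiplicity D P ≡ multiplicity E P) → D ∼ E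
  ∼-from-≡ {D} {E} e = linEquiv (principal-0 (λ P →
    ≡.trans (≡.cong (ℤ._- multiplicity E P) (e P)) (ℤ.+-inverseʳ (multiplicity E P))))

  ∼-refl : ∀ {D} → D ∼ D
  ∼-refl = ∼-from-≡ (λ _ → ≡.refl)

  ∼-sym : ∀ {D E} → D ∼ E → E ∼ D
  ∼-sym {D} {E} (linEquiv pr) = linEquiv (principal-resp
    (λ P → solve 2 (λ d e → :- (d :- e) := e :- d) ≡.refl (multiplicity D P) (multiplicity E P))
    (principal-neg pr))
    where open +-*-Solver

  ∼-trans : ∀ {D E F} → D ∼ E → E ∼ F → D ∼ F
  ∼-trans {D} {E} {F} (linEquiv pr) (linEquiv pr') = linEquiv (principal-resp
    (λ P → solve 3 (λ d e f → (d :- e) :+ (e :- f) := d :- f) ≡.refl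
             (multiplicity D P) (multiplicity E P) (multiplicity F P))
    (principal-+ pr pr'))
    where open +-*-Solver

  ++-cong : ∀ {D D' E E'} → D ∼ D' → E ∼ E' → D ++ E ∼ D' ++ E'
  ++-cong {D} {D'} {E} {E'} (linEquiv pr) (linEquiv pr') = linEquiv (principal-resp
    (λ P → ≡.trans
      (solve 4 (λ d d' e e' → (d :- d') :+ (e :- e') := (d :+ e) :- (d' :+ e')) ≡.refl
        (multiplicity D P) (multiplicity D' P) (multiplicity E P) (multiplicity E' P))
      (≡.sym (≡.cong₂ ℤ._-_ (mult-++ D E P) (mult-++ D' E' P))))
    (principal-+ pr pr'))
    where open +-*-Solver

  ·-congˡ : ∀ k {D D'} → D ∼ D' → k · D ∼ k · D'
  ·-congˡ k {D} {D'} (linEquiv pr) = linEquiv (principal-resp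
    (λ P → ≡.trans
      (solve 3 (λ k d d' → k :* (d :- d') := k :* d :- k :* d') ≡.refl
        k (multiplicity D P) (multiplicity D' P))
      (≡.sym (≡.cong₂ ℤ._-_ (mult-· k D P) (mult-· k D' P))))
    (principal-scale k pr))
    where open +-*-Solver

  ·-distribˡ : ∀ k D E → k · (D ++ E) ∼ k · D ++ k · E
  ·-distribˡ k D E = ∼-from-≡ (λ P → begin
    multiplicity (k · (D ++ E)) P                        ≡⟨ mult-· k (D ++ E) P ⟩
    k ℤ.* multiplicity (D ++ E) P                        ≡⟨ ≡.cong (k ℤ.*_) (mult-++ D E P) ⟩
    k ℤ.* (multiplicity D P ℤ.+ multiplicity E P)        ≡⟨ ℤ.*-distribˡ-+ k _ _ ⟩
    k ℤ.* multiplicity D P ℤ.+ k ℤ.* multiplicity E P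
      ≡⟨ ≡.cong₂ ℤ._+_ (mult-· k D P) (mult-· k E P) ⟨
    multiplicity (k · D) P ℤ.+ multiplicity (k · E) P    ≡⟨ mult-++ (k · D) (k · E) P ⟨
    multiplicity (k · D ++ k · E) P                      ∎)
    where open ≡.≡-Reasoning

  ·-distribʳ : ∀ D j k → (j ℤ.+ k) · D ∼ j · D ++ k · D
  ·-distribʳ D j k = ∼-from-≡ (λ P → begin
    multiplicity ((j ℤ.+ k) · D) P                       ≡⟨ mult-· (j ℤ.+ k) D P ⟩
    (j ℤ.+ k) ℤ.* multiplicity D P                       ≡⟨ ℤ.*-distribʳ-+ (multiplicity D P) j k ⟩
    j ℤ.* multiplicity D P ℤ.+ k ℤ.* multiplicity D P
      ≡⟨ ≡.cong₂ ℤ._+_ (mult-· j D P) (mult-· k D P) ⟨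
    multiplicity (j · D) P ℤ.+ multiplicity (k · D) P    ≡⟨ mult-++ (j · D) (k · D) P ⟨
    multiplicity (j · D ++ k · D) P                      ∎)
    where open ≡.≡-Reasoning

  ·-assoc : ∀ j k D → (j ℤ.* k) · D ∼ j · k · D
  ·-assoc j k D = ∼-from-≡ (λ P → begin
    multiplicity ((j ℤ.* k) · D) P   ≡⟨ mult-· (j ℤ.* k) D P ⟩
    j ℤ.* k ℤ.* multiplicity D P     ≡⟨ ℤ.*-assoc j k _ ⟩
    j ℤ.* (k ℤ.* multiplicity D P)   ≡⟨ ≡.cong (j ℤ.*_) (mult-· k D P) ⟨
    j ℤ.* multiplicity (k · D) P     ≡⟨ mult-· j (k · D) P ⟨
    multiplicity (j · k · D) P       ∎)
    where open ≡.≡-Reasoning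

  ·-comm : ∀ j k D → j · k · D ∼ k · j · D
  ·-comm j k D = ∼-trans (∼-sym (·-assoc j k D))
    (≡.subst (λ i → i · D ∼ k · j · D) (ℤ.*-comm k j) (·-assoc k j D))

  ·-zeroˡ : ∀ D → 0ℤ · D ∼ []
  ·-zeroˡ D = ∼-from-≡ (λ P → ≡.trans (mult-· 0ℤ D P) (ℤ.*-zeroˡ (multiplicity D P)))

  ·-identityˡ : ∀ D → 1ℤ · D ∼ D
  ·-identityˡ D = ∼-from-≡ (λ P → ≡.trans (mult-· 1ℤ D P) (ℤ.*-identityˡ _))

  ++-comm : ∀ D E → D ++ E ∼ E ++ D
  ++-comm D E = ∼-from-≡ (λ P → ≡.trans (mult-++ D E P)
    (≡.trans (ℤ.+-comm (multiplicity D P) _) (≡.sym (mult-++ E D P))))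

  ++-assoc : ∀ D E F → (D ++ E) ++ F ∼ D ++ (E ++ F)
  ++-assoc []      E F = ∼-refl
  ++-assoc (n ∷ D) E F = ++-cong {n ∷ []} ∼-refl (++-assoc D E F)

  ++-identityʳ : ∀ D → D ++ [] ∼ D
  ++-identityʳ D = ++-comm D []

  ++-inverseʳ : ∀ D → D ++ (ℤ.-1ℤ · D) ∼ []
  ++-inverseʳ D = ∼-from-≡ (λ P → ≡.trans (mult-++ D (ℤ.-1ℤ · D) P)
    (≡.trans (≡.cong (λ z → multiplicity D P ℤ.+ z)
               (≡.trans (mult-· ℤ.-1ℤ D P) (ℤ.-1*i≡-i _)))
             (ℤ.+-inverseʳ (multiplicity D P))))

  J[_] : ℕ → Set (c ⊔ ℓ)
  J[ l ] = Σ[ D ∈ Divisor ] (+ l) · D ∼ []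

  J[_]-module : (l : ℕ) → Module (ℤ/ l) (c ⊔ ℓ) (c ⊔ ℓ)
  J[ l ]-module = record
    { Carrierᴹ = J[ l ]
    ; _≈ᴹ_ = _≈ⱼ_
    ; _+ᴹ_ = add
    ; _*ₗ_ = scale
    ; _*ᵣ_ = λ D k → scale k D
    ; 0ᴹ = [] , ∼-refl
    ; -ᴹ_ = scale ℤ.-1ℤ
    ; isModule = Biased.IsModuleFromLeft.isModule {commutativeRing = ℤ/ l} (record
      { isLeftModule = record
        { isLeftSemimodule = record
          { +ᴹ-isCommutativeMonoid = record
            { isMonoid = record
              { isSemigroup = record
                { isMagma = record
                  { isEquivalence = record { refl = ∼-refl ; sym = ∼-sym ; trans = ∼-trans }
                  ; ∙-cong = ++-cong }
                ; assoc = λ (D , _) (E , _) (F , _) → ++-assoc D E F }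
              ; identity = (λ _ → ∼-refl) , (λ (D , _) → ++-identityʳ D) }
            ; comm = λ (D , _) (E , _) → ++-comm D E }
          ; isPreleftSemimodule = record
            { *ₗ-cong = λ {_} {_} {D} {E} → scale-cong {D = D} {E}
            ; *ₗ-zeroˡ = λ (D , _) → ·-zeroˡ D
            ; *ₗ-distribʳ = λ (D , _) j k → ·-distribʳ D j k
            ; *ₗ-identityˡ = λ (D , _) → ·-identityˡ D
            ; *ₗ-assoc = λ j k (D , _) → ·-assoc j k D
            ; *ₗ-zeroʳ = λ _ → ∼-refl
            ; *ₗ-distribˡ = λ k (D , _) (E , _) → ·-distribˡ k D E } }
        ; -ᴹ‿cong = ·-congˡ ℤ.-1ℤ
        ; -ᴹ‿inverse = (λ (D , _) → ∼-trans (++-comm (ℤ.-1ℤ · D) D) (++-inverseʳ D))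
                     , (λ (D , _) → ++-inverseʳ D) } }) }
    where
    _≈ⱼ_ : J[ l ] → J[ l ] → Set (c ⊔ ℓ)
    (D , _) ≈ⱼ (E , _) = D ∼ E

    add : J[ l ] → J[ l ] → J[ l ]
    add (D , tD) (E , tE) =
      D ++ E , ∼-trans (·-distribˡ (+ l) D E) (++-cong tD tE)

    scale : ℤ → J[ l ] → J[ l ]
    scale k (D , tD) = k · D , ∼-trans (·-comm (+ l) k D) (·-congˡ k tD)

    scale-cong : ∀ {j k} {D E : J[ l ]} → Congruent l j k → proj₁ D ∼ proj₁ E →
                 j · proj₁ D ∼ k · proj₁ E
    scale-cong {j} {k} {D , tD} {E , _} (congruent (ℤDiv.divides i j-k≡il)) D∼E =
      ∼-trans (≡.subst (λ z → z · D ∼ (i ℤ.* + l) · D ++ k · D) eq (·-distribʳ D (i ℤ.* + l) k))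
        (∼-trans (++-cong (∼-trans (·-assoc i (+ l) D) (·-congˡ i tD)) (∼-refl {k · D}))
          (·-congˡ k D∼E))
      where
      open +-*-Solver
      eq : i ℤ.* + l ℤ.+ k ≡ j
      eq = ≡.trans (≡.cong (ℤ._+ k) (≡.sym j-k≡il))
             (solve 2 (λ j k → (j :- k) :+ k := j) ≡.refl j k)

  module Action (k : ℕ) (τ : Gal K (q ℕ.^ k)) where
    open Gal τ
    open IsRingIsomorphism isRingIsomorphism

    ∈𝔽q⇒∈𝔽qᵏ : ∀ {z} j → z ^ q ≈ z → z ^ (q ℕ.^ j) ≈ z
    ∈𝔽q⇒∈𝔽qᵏ {z} zero    e = *-identityʳ z
    ∈𝔽q⇒∈𝔽qᵏ {z} (suc j) e = begin
      z ^ (q ℕ.* q ℕ.^ j)  ≈⟨ E.^-assocʳ z q (q ℕ.^ j) ⟨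
      (z ^ q) ^ (q ℕ.^ j)  ≈⟨ E.^-congˡ (q ℕ.^ j) e ⟩
      z ^ (q ℕ.^ j)        ≈⟨ ∈𝔽q⇒∈𝔽qᵏ j e ⟩
      z                    ∎
      where open ≈R

    σ-eval : ∀ (g : Poly) z → (∀ i → σ (coeff g i) ≈ coeff g i) →
             σ (eval g z) ≈ eval g (σ z)
    σ-eval []      z _ = 0#-homo
    σ-eval (w ∷ g) z e = begin
      σ (w + z * eval g z)       ≈⟨ +-homo w _ ⟩
      σ w + σ (z * eval g z)     ≈⟨ +-cong (e 0) (*-homo z _) ⟩
      w + σ z * σ (eval g z)     ≈⟨ +-congˡ (*-congˡ (σ-eval g z (λ i → e (suc i)))) ⟩
      w + σ z * eval g (σ z)     ∎
      where open ≈R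

    σ-f : ∀ z → σ (eval f z) ≈ eval f (σ z)
    σ-f z = σ-eval f z (λ i → fixes _ (∈𝔽q⇒∈𝔽qᵏ k (f-over-𝔽q i)))

    onPoint : Point → Point
    onPoint (point x y e) = point (σ x) (σ y)
      (trans (sym (*-homo y y)) (trans (⟦⟧-cong e) (σ-f x)))

    onDivisor : Divisor → Divisor
    onDivisor = List.map (λ (n , P) → n , onPoint P)

    onFunction : Function → Function
    onFunction (const k) = const (σ k)
    onFunction X         = X
    onFunction Y         = Y
    onFunction (G ⊕ H)   = onFunction G ⊕ onFunction H
    onFunction (G ⊗ H)   = onFunction G ⊗ onFunction H

    onFunction-⟨⟩ : ∀ G P → onFunction G ⟨ onPoint P ⟩ ≈ σ (G ⟨ P ⟩)
    onFunction-⟨⟩ (const k) P = refl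
    onFunction-⟨⟩ X         P = refl
    onFunction-⟨⟩ Y         P = refl
    onFunction-⟨⟩ (G ⊕ H)   P =
      trans (+-cong (onFunction-⟨⟩ G P) (onFunction-⟨⟩ H P)) (sym (+-homo _ _))
    onFunction-⟨⟩ (G ⊗ H)   P =
      trans (*-cong (onFunction-⟨⟩ G P) (onFunction-⟨⟩ H P)) (sym (*-homo _ _))

    ⟨⟩-cong : ∀ G {P Q} → P ≈ₚ Q → G ⟨ P ⟩ ≈ G ⟨ Q ⟩
    ⟨⟩-cong (const k) e        = refl
    ⟨⟩-cong X         (ex , _) = ex
    ⟨⟩-cong Y         (_ , ey) = ey
    ⟨⟩-cong (G ⊕ H)   e        = +-cong (⟨⟩-cong G e) (⟨⟩-cong H e)
    ⟨⟩-cong (G ⊗ H)   e        = *-cong (⟨⟩-cong G e) (⟨⟩-cong H e)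

    σ≉0 : ∀ {z} → z ≉ 0# → σ z ≉ 0#
    σ≉0 z≉0 σz≈0 = z≉0 (injective (trans σz≈0 (sym 0#-homo)))

    σ-^ : ∀ z n → σ (z ^ n) ≈ σ z ^ n
    σ-^ z zero    = 1#-homo
    σ-^ z (suc n) = trans (*-homo z (z ^ n)) (*-congˡ (σ-^ z n))

    preimage : ∀ P → Σ[ P' ∈ Point ] onPoint P' ≈ₚ P
    preimage (point x y e) with surjective x | surjective y
    ... | (x' , ex) | (y' , ey) =
      point x' y' (injective (begin
        σ (y' * y')   ≈⟨ *-homo y' y' ⟩
        σ y' * σ y'   ≈⟨ *-cong (ey refl) (ey refl) ⟩
        y * y         ≈⟨ e ⟩
        eval f x      ≈⟨ eval-cong f (ex refl) ⟨
        eval f (σ x') ≈⟨ σ-f x' ⟨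
        σ (eval f x') ∎)) ,
      ex refl , ey refl
      where
      open ≈R
      eval-cong : ∀ g {z w} → z ≈ w → eval g z ≈ eval g w
      eval-cong []      _  = refl
      eval-cong (_ ∷ g) zw = +-congˡ (*-cong zw (eval-cong g zw))

    uniformizer-σ : ∀ P' {P} Q' → onPoint P' ≈ₚ P →
      σ (uniformizer P' ⟨ Q' ⟩) ≈ uniformizer P ⟨ onPoint Q' ⟩
    uniformizer-σ P' {P} Q' (ex , ey) with y P' ≟ 0# | y P ≟ 0#
    ... | yes _   | yes _   = refl
    ... | yes y≈0 | no y≉0  =
      ⊥-elim (y≉0 (trans (sym ey) (trans (⟦⟧-cong y≈0) 0#-homo)))
    ... | no y≉0  | yes y≈0 = ⊥-elim (σ≉0 y≉0 (trans ey y≈0))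
    ... | no _    | no _    =
      trans (+-homo _ _) (+-congˡ (trans (-‿homo _) (-‿cong ex)))

    order-σ : ∀ {P' P G n} → onPoint P' ≈ₚ P → Order P' G n → Order P (onFunction G) n
    order-σ {P'} {P} {G} {n} eP o = record
      { u = onFunction O.u ; v = onFunction O.v
      ; u≉0 = λ e → σ≉0 O.u≉0 (trans (at O.u) e)
      ; v≉0 = λ e → σ≉0 O.v≉0 (trans (at O.v) e)
      ; local = λ Q → let (Q' , eQ) = preimage Q
                          val : ∀ H → onFunction H ⟨ Q ⟩ ≈ σ (H ⟨ Q' ⟩)
                          val H = trans (⟨⟩-cong (onFunction H) (≈ₚ-sym {onPoint Q'} {Q} eQ))
                                        (onFunction-⟨⟩ H Q')
                          t = uniformizer P' ⟨ Q' ⟩ in begin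
          onFunction O.u ⟨ Q ⟩ * onFunction G ⟨ Q ⟩  ≈⟨ *-cong (val O.u) (val G) ⟩
          σ (O.u ⟨ Q' ⟩) * σ (G ⟨ Q' ⟩)              ≈⟨ *-homo _ _ ⟨
          σ (O.u ⟨ Q' ⟩ * G ⟨ Q' ⟩)                  ≈⟨ ⟦⟧-cong (O.local Q') ⟩
          σ (t ^ n * O.v ⟨ Q' ⟩)                     ≈⟨ *-homo _ _ ⟩
          σ (t ^ n) * σ (O.v ⟨ Q' ⟩)                 ≈⟨ *-cong (σ-^ t n) (sym (val O.v)) ⟩
          σ t ^ n * onFunction O.v ⟨ Q ⟩
            ≈⟨ *-congʳ (E.^-congˡ n (trans (uniformizer-σ P' {P} Q' eP)
                                           (⟨⟩-cong (uniformizer P) {onPoint Q'} {Q} eQ))) ⟩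
          uniformizer P ⟨ Q ⟩ ^ n * onFunction O.v ⟨ Q ⟩ ∎ }
      where
      open ≈R
      module O = Order o
      at : ∀ H → σ (H ⟨ P' ⟩) ≈ onFunction H ⟨ P ⟩
      at H = trans (sym (onFunction-⟨⟩ H P')) (⟨⟩-cong (onFunction H) {onPoint P'} {P} eP)

    mult-σ : ∀ D {P' P} → onPoint P' ≈ₚ P → multiplicity D P' ≡ multiplicity (onDivisor D) P
    mult-σ []            eP = ≡.refl
    mult-σ ((n , Q) ∷ D) {P'} {P} eP = ≡.cong₂ ℤ._+_
      (ifDec-cong (Q ≟ₚ P') (onPoint Q ≟ₚ P)
        (λ (e , e') → ≈ₚ-trans {onPoint Q} {onPoint P'} {P} (⟦⟧-cong e , ⟦⟧-cong e') eP)
        (λ e → let (g , g') = ≈ₚ-trans {onPoint Q} {P} {onPoint P'} e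
                                       (≈ₚ-sym {onPoint P'} {P} eP)
               in injective g , injective g'))
      (mult-σ D {P'} {P} eP)

    onDivisor-cong : ∀ {D E} → D ∼ E → onDivisor D ∼ onDivisor E
    onDivisor-cong {D} {E} (linEquiv pr) = linEquiv (record
      { G = onFunction Pr.G ; H = onFunction Pr.H
      ; div = λ P → let (P' , eP) = preimage P
                        (i , j , oG , oH , eq) = Pr.div P' in
          i , j , order-σ {P = P} eP oG , order-σ {P = P} eP oH ,
          ≡.trans (≡.sym (≡.cong₂ ℤ._-_ (mult-σ D {P = P} eP) (mult-σ E {P = P} eP))) eq })
      where module Pr = Principal pr

    onDivisor-· : ∀ n D → n · onDivisor D ≡ onDivisor (n · D)
    onDivisor-· n []      = ≡.refl
    onDivisor-· n (_ ∷ D) = ≡.cong (_ ∷_) (onDivisor-· n D)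

    onJ[_] : (l : ℕ) → J[ l ] → J[ l ]
    onJ[ l ] (D , tD) =
      onDivisor D , ≡.subst (_∼ []) (≡.sym (onDivisor-· (+ l) D)) (onDivisor-cong tD)

  -- D ∈ J(𝔽_{q^k}): the class of D is invariant under Gal(K / 𝔽_{q^k}).
  DefinedOver : (k : ℕ) → Divisor → Set (c ⊔ ℓ)
  DefinedOver k D = ∀ (τ : Gal K (q ℕ.^ k)) → Action.onDivisor k τ D ∼ D

  record IsDegreeOfDefinition (D : Divisor) (k : ℕ) : Set (c ⊔ ℓ) where
    field
      positive : 1 ≤ k
      defined  : DefinedOver k D
      least    : ∀ j → 1 ≤ j → DefinedOver j D → k ≤ j

  char-∣ : ∀ {n} z → p ℕDiv.∣ n → n ×# z ≈ 0#
  char-∣ {n} z (ℕDiv.divides d ≡.refl) = begin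
    (d ℕ.* p) ×# z                ≈⟨ Mult.×-congʳ semiring (d ℕ.* p) (*-identityˡ z) ⟨
    (d ℕ.* p) ×# (1# * z)         ≈⟨ Mult.×-assoc-* semiring (d ℕ.* p) 1# z ⟨
    (d ℕ.* p) ×# 1# * z           ≈⟨ *-congʳ (Mult.×1-homo-* semiring d p) ⟩
    (d ×# 1#) * (p ×# 1#) * z     ≈⟨ *-congʳ (*-congˡ characteristic) ⟩
    (d ×# 1#) * 0# * z            ≈⟨ *-congʳ (zeroʳ _) ⟩
    0# * z                        ≈⟨ zeroˡ z ⟩
    0#                            ∎
    where open ≈R

  p∤j! : ∀ j → j < p → ¬ p ℕDiv.∣ j ℕ.!
  p∤j! zero    _   p∣1 with ℕDiv.∣1⇒≡1 p∣1
  ... | ≡.refl = ℕPrime.¬prime[1] p-prime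
  p∤j! (suc j) j<p p∣j! with ℕPrime.euclidsLemma (suc j) (j ℕ.!) p-prime p∣j!
  ... | inj₁ p∣1+j = ℕ.<⇒≱ j<p (ℕDiv.∣⇒≤ p∣1+j)
  ... | inj₂ p∣j!  = p∤j! j (ℕ.<-trans (ℕ.n<1+n j) j<p) p∣j!

  p∣pCj : ∀ j → 0 < j → j < p → p ℕDiv.∣ (p ℕComb.C j)
  p∣pCj j 0<j j<p = conclude (ℕPrime.euclidsLemma (p ℕComb.C j) (j ℕ.! ℕ.* (p ℕ.∸ j) ℕ.!) p-prime p∣)
    where
    instance
      nz : ℕ.NonZero (j ℕ.! ℕ.* (p ℕ.∸ j) ℕ.!)
      nz = ℕ._!*_!≢0 j (p ℕ.∸ j)
    C*≡p! : (p ℕComb.C j) ℕ.* (j ℕ.! ℕ.* (p ℕ.∸ j) ℕ.!) ≡ p ℕ.!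
    C*≡p! = ≡.trans
      (≡.cong (ℕ._* (j ℕ.! ℕ.* (p ℕ.∸ j) ℕ.!)) (ℕCombSpec.nCk≡n!/k![n-k]! (ℕ.<⇒≤ j<p)))
      (ℕDivMod.m/n*n≡m (ℕComb.k![n∸k]!∣n! (ℕ.<⇒≤ j<p)))
    n∣n! : ∀ n → 0 < n → n ℕDiv.∣ n ℕ.!
    n∣n! (suc n) _ = ℕDiv.m∣m*n (n ℕ.!)
    p∣ : p ℕDiv.∣ (p ℕComb.C j) ℕ.* (j ℕ.! ℕ.* (p ℕ.∸ j) ℕ.!)
    p∣ = ≡.subst (p ℕDiv.∣_) (≡.sym C*≡p!) (n∣n! p (ℕ.<-trans 0<j j<p))
    p∤ : ¬ p ℕDiv.∣ j ℕ.! ℕ.* (p ℕ.∸ j) ℕ.!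
    p∤ h with ℕPrime.euclidsLemma (j ℕ.!) ((p ℕ.∸ j) ℕ.!) p-prime h
    ... | inj₁ h₁ = p∤j! j j<p h₁
    ... | inj₂ h₂ = p∤j! (p ℕ.∸ j) (ℕ.∸-monoʳ-< 0<j (ℕ.<⇒≤ j<p)) h₂
    conclude : _ ⊎ _ → _
    conclude (inj₁ h) = h
    conclude (inj₂ h) = ⊥-elim (p∤ h)

  ^p-+ : ∀ z w → (z + w) ^ p ≈ z ^ p + w ^ p
  ^p-+ z w = helper p ≡.refl
    where
    open ≈R
    open Sum semiring using (sum; sum-cong-≋; sum-replicate-zero; sum-init-last)
    helper : ∀ n → n ≡ p → (z + w) ^ n ≈ z ^ n + w ^ n
    helper zero    0≡p = ⊥-elim (ℕPrime.¬prime[0] (≡.subst Prime (≡.sym 0≡p) p-prime))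
    helper (suc n) ≡.refl = begin
      (z + w) ^ suc n                      ≈⟨ Bin.theorem (suc n) z w ⟩
      term zero + sum (λ i → term (suc i)) ≈⟨ +-congˡ (sum-init-last (λ i → term (suc i))) ⟩
      term zero + (sum (λ i → term (suc (inject₁ i))) + term (fromℕ (suc n)))
        ≈⟨ +-cong first (+-cong middle last) ⟩
      w ^ suc n + (0# + z ^ suc n)         ≈⟨ +-congˡ (+-identityˡ _) ⟩
      w ^ suc n + z ^ suc n                ≈⟨ +-comm _ _ ⟩
      z ^ suc n + w ^ suc n                ∎
      where
      module Bin = Binomial commutativeSemiring
      term : Fin (suc (suc n)) → Carrier
      term = Bin.binomialTerm z w (suc n)
      first : term zero ≈ w ^ suc n
      first = trans (+-identityʳ _) (*-identityˡ _)
      middle : sum (λ i → term (suc (inject₁ i))) ≈ 0#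
      middle = trans (sum-cong-≋ (λ i → char-∣ _
          (p∣pCj (suc (toℕ (inject₁ i))) (s≤s z≤n)
            (s≤s (≡.subst (_< n) (≡.sym (Fin.toℕ-inject₁ i)) (Fin.toℕ<n i))))))
        (sum-replicate-zero n)
      last : term (fromℕ (suc n)) ≈ z ^ suc n
      last rewrite Fin.toℕ-fromℕ n | ℕComb.nCn≡1 (suc n) | ℕ.n∸n≡0 n =
        trans (+-identityʳ _) (*-identityʳ _)

  ^pʲ-+ : ∀ j z w → (z + w) ^ (p ℕ.^ j) ≈ z ^ (p ℕ.^ j) + w ^ (p ℕ.^ j)
  ^pʲ-+ zero    z w = trans (*-identityʳ _)
                        (sym (+-cong (*-identityʳ _) (*-identityʳ _)))
  ^pʲ-+ (suc j) z w = begin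
    (z + w) ^ (p ℕ.* p ℕ.^ j)                    ≈⟨ E.^-assocʳ (z + w) p _ ⟨
    ((z + w) ^ p) ^ (p ℕ.^ j)                    ≈⟨ E.^-congˡ (p ℕ.^ j) (^p-+ z w) ⟩
    (z ^ p + w ^ p) ^ (p ℕ.^ j)                  ≈⟨ ^pʲ-+ j _ _ ⟩
    (z ^ p) ^ (p ℕ.^ j) + (w ^ p) ^ (p ℕ.^ j)
      ≈⟨ +-cong (E.^-assocʳ z p _) (E.^-assocʳ w p _) ⟩
    z ^ (p ℕ.* p ℕ.^ j) + w ^ (p ℕ.* p ℕ.^ j)    ∎
    where open ≈R

  0<q : 0 < q
  0<q = ℕ.m^n>0 p {{ℕPrime.prime⇒nonZero p-prime}} m

  0^ : ∀ n → 0 < n → 0# ^ n ≈ 0#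
  0^ (suc n) _ = zeroˡ _

  1^ : ∀ n → 1# ^ n ≈ 1#
  1^ zero    = refl
  1^ (suc n) = trans (*-identityˡ _) (1^ n)

  ^≈0 : ∀ n z → z ^ n ≈ 0# → z ≈ 0#
  ^≈0 zero    z e = ⊥-elim (1≉0 e)
  ^≈0 (suc n) z e with z ≟ 0#
  ... | yes z≈0 = z≈0
  ... | no  z≉0 with z ^ n ≟ 0#
  ...   | yes e' = ^≈0 n z e'
  ...   | no  e' = ⊥-elim (x*y≉0 z≉0 e' e)

  ^q-neg : ∀ z → (- z) ^ q ≈ - (z ^ q)
  ^q-neg z = RP.+-inverseʳ-unique (z ^ q) ((- z) ^ q) (begin
    z ^ q + (- z) ^ q ≈⟨ ^pʲ-+ m z (- z) ⟨
    (z + - z) ^ q     ≈⟨ E.^-congˡ q (-‿inverseʳ z) ⟩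
    0# ^ q            ≈⟨ 0^ q 0<q ⟩
    0#                ∎)
    where open ≈R

  ^q-injective : ∀ {z w} → z ^ q ≈ w ^ q → z ≈ w
  ^q-injective {z} {w} e = RP.x∙y⁻¹≈ε⇒x≈y z w (^≈0 q (z - w) (begin
    (z + - w) ^ q     ≈⟨ ^pʲ-+ m z (- w) ⟩
    z ^ q + (- w) ^ q ≈⟨ +-cong e (^q-neg w) ⟩
    w ^ q - w ^ q     ≈⟨ -‿inverseʳ _ ⟩
    0#                ∎))
    where open ≈R

  root : ∀ n → 0 < n → ∀ z → ∃[ w ] w ^ n ≈ z
  root (suc n) _ z = let (w , e) = algebraicallyClosed n (- z ∷ X^ n) (monicX^ n) in
    w , (begin
      w * w ^ n              ≈⟨ *-congˡ (evalX^ n w) ⟨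
      w * eval (X^ n) w      ≈⟨ +-identityˡ _ ⟨
      0# + w * eval (X^ n) w ≈⟨ +-congʳ (-‿inverseʳ z) ⟨
      z + - z + w * eval (X^ n) w   ≈⟨ +-assoc _ _ _ ⟩
      z + (- z + w * eval (X^ n) w) ≈⟨ +-congˡ e ⟩
      z + 0#                 ≈⟨ +-identityʳ z ⟩
      z                      ∎)
    where
    open ≈R
    monicX^ : ∀ n {y} → MonicOfDegree (suc n) (y ∷ X^ n)
    monicX^ zero    = refl , λ { (suc zero) (s≤s ()) ; (suc (suc i)) _ → refl }
    monicX^ (suc n) = proj₁ (monicX^ n {0#}) ,
      λ { (suc i) (s≤s n<i) → proj₂ (monicX^ n {0#}) i n<i }
    evalX^ : ∀ n w → eval (X^ n) w ≈ w ^ n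
    evalX^ zero    w = trans (+-congˡ (zeroʳ w)) (+-identityʳ 1#)
    evalX^ (suc n) w = trans (+-identityˡ _) (*-congˡ (evalX^ n w))

  frobenius : Gal K (q ℕ.^ 1)
  frobenius = record
    { σ = _^ q
    ; isRingIsomorphism = record
      { isRingMonomorphism = record
        { isRingHomomorphism = record
          { isSemiringHomomorphism = record
            { isNearSemiringHomomorphism = record
              { +-isMonoidHomomorphism = record
                { isMagmaHomomorphism = record
                  { isRelHomomorphism = record { cong = E.^-congˡ q }
                  ; homo = ^pʲ-+ m }
                ; ε-homo = 0^ q 0<q }
              ; *-homo = λ z w → CE.^-distrib-* z w q }
            ; 1#-homo = 1^ q }
          ; -‿homo = ^q-neg }
        ; injective = ^q-injective }
      ; surjective = λ z → let (w , e) = root q 0<q z in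
          w , λ v≈w → trans (E.^-congˡ q v≈w) e }
    ; fixes = λ z → ≡.subst (λ n → z ^ n ≈ z) (ℕ.*-identityʳ q) }

  π[_] : (l : ℕ) → J[ l ] → J[ l ]
  π[_] = Action.onJ[_] 1 frobenius

{-# OPTIONS --safe #-}

-- A companion block of p^e makes its span a copy of F[x]/(p^e), x acting as π and
-- the last basis vector being cyclic.  So the elements of level k in it are the
-- classes of p^(e-k) u with u prime to p modulo p^k, which are counted by writing
-- u = p u₁ + u₀ with u₀ ≠ 0.  A polynomial kills D iff it kills every component,
-- iff it is divisible by every p_s^k_s; hence the minimal polynomial is the lcm L,
-- and π^j D = D iff L divides x^j - 1.
--
-- Two facts come from the curve.  The coordinates of the points of D lie in a finite
-- field, so some π^N fixes D: this gives L(0) ≠ 0 and an exponent N with L | x^N - 1.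
-- And an automorphism of K over 𝔽_{q^j} acts on finitely many elements as one power
-- of z ↦ z^(q^j), so invariance under all of Gal(K/𝔽_{q^j}) is invariance under π^j.

module Submission where

open import Defs
open import Algebra.Bundles using (CommutativeMonoid; CommutativeRing; Semiring)
import Algebra.Definitions.RawMagma as RawMagmaDefs
open import Algebra.Definitions.RawSemiring using (product)
import Algebra.Definitions.RawSemiring as RawSemiringDefs
open import Algebra.Module.Bundles using (Module)
open import Algebra.Module.Morphism.Structures using (module LeftSemimoduleMorphisms)
import Algebra.Morphism.Construct.Composition as Composition
import Algebra.Morphism.Construct.Identity as Identity
open import Algebra.Morphism.Structures using (IsRingHomomorphism; IsRingIsomorphism)
import Algebra.Properties.CommutativeMonoid.Sum as MonoidSum
import Algebra.Properties.CommutativeSemigroup as CommSemigroup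
import Algebra.Properties.Group as GroupProperties
import Algebra.Properties.Ring as RingProperties
import Algebra.Properties.Semiring.Exp as Exp
import Algebra.Solver.Ring.NaturalCoefficients.Default as SemiringSolver
open import Data.Empty using (⊥-elim)
open import Data.Fin.Base as Fin using (Fin; zero; suc; toℕ; fromℕ; fromℕ<; inject₁; combine; remQuot; punchIn; punchOut)
open import Data.Fin.Induction using (>-weakInduction)
import Data.Fin.Properties as Fin
open import Data.Integer.Base as ℤ using (ℤ; +_; 0ℤ; 1ℤ)
import Data.Integer.Divisibility.Signed as ℤDiv
import Data.Integer.DivMod as ℤDivMod
import Data.Integer.Properties as ℤ
open import Data.Integer.Solver using (module +-*-Solver)
open import Data.List.Base as List using (List; []; _∷_)
import Data.List.Properties as List
open import Data.List.Relation.Binary.Pointwise.Base using (Pointwise; []; _∷_)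
open import Data.Nat.Base as ℕ using (ℕ; zero; suc; _≤_; _<_; z≤n; s≤s; +-*-rawSemiring)
import Data.Nat.Coprimality as ℕCoprime
import Data.Nat.Divisibility as ℕDiv
import Data.Nat.GCD as ℕGCD
open import Data.Nat.Induction using (<-rec)
open import Data.Nat.Primality as ℕPrime using (Prime)
import Data.Nat.Properties as ℕ
open import Data.Product.Base using (_×_; _,_; proj₁; proj₂; ∃-syntax; ∃₂; uncurry)
open import Data.Product.Properties using (≡-dec)
open import Data.Sum.Base as Sum using (_⊎_; inj₁; inj₂)
open import Data.Vec.Functional using (Vector)
open import Function.Base using (_∘_)
open import Function.Bundles using (Inverse)
open import Level using (_⊔_)
open import Relation.Binary.Bundles using (Setoid)
open import Relation.Binary.Definitions using (DecidableEquality; tri<; tri≈; tri>)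
open import Relation.Binary.PropositionalEquality as ≡ using (_≡_; _≢_)
import Relation.Binary.Reasoning.Setoid as SetoidReasoning
open import Relation.Nullary.Decidable using (Dec; yes; no; map′; _×-dec_; ¬?; decidable-stable)
open import Relation.Nullary.Negation using (¬_; contradiction)

-- Three obstacles shape the proof. Equality in `J[ l ]` is linear equivalence, which is nowhere
-- decided here; so annihilators of `D` are never searched for. Every ideal whose generator is
-- computed is given by divisibility in `F_l[x]`, where membership is decidable and a degree bound
-- leaves finitely many candidates. Secondly, `spans` merely picks coordinates of `D`, so a
-- component is well defined only because independence, read modulo each `p^e`, forces it. Thirdly,
-- `π^j D = D` is an equality of classes and does not put the coordinates of `D` into the field with
-- `q^j` elements. To see an automorphism as one power of Frobenius on all coordinates at once, they
-- are made the coefficients of a single polynomial in `K[T]`; treating them one by one would give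
-- unrelated exponents.

-- The commutative ring `R[x]` of coefficient lists, and evaluation.

module PolynomialRing {c ℓ} (R : CommutativeRing c ℓ) where
  open CommutativeRing R hiding (zero)
  open Polynomial R
  open RingProperties ring using (-0#≈0#)
  private
    module ≈R = SetoidReasoning setoid
  open SemiringSolver commutativeSemiring using (solve; _:=_; _:+_; _:*_; con)

  infix 4 _≋_
  -- _≈ᴾ_ made injective, so that Agda infers the polynomials from an equality.
  record _≋_ (g h : Poly) : Set ℓ where
    constructor coefficientwise
    field at : g ≈ᴾ h
  open _≋_ public

  ≋-refl : ∀ {g} → g ≋ g
  ≋-refl = coefficientwise λ _ → refl

  ≋-sym : ∀ {g h} → g ≋ h → h ≋ g
  ≋-sym (coefficientwise e) = coefficientwise λ i → sym (e i)

  ≋-trans : ∀ {g h k} → g ≋ h → h ≋ k → g ≋ k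
  ≋-trans (coefficientwise e) (coefficientwise e') = coefficientwise λ i → trans (e i) (e' i)

  infixr 7 _·_
  _·_ : Carrier → Poly → Poly
  x · g = List.map (x *_) g

  negate : Poly → Poly
  negate = List.map (λ x → - x)

  coeff-+ : ∀ g h i → coeff (g +ᴾ h) i ≈ coeff g i + coeff h i
  coeff-+ []      h       i       = sym (+-identityˡ _)
  coeff-+ (x ∷ g) []      i       = sym (+-identityʳ _)
  coeff-+ (x ∷ g) (y ∷ h) zero    = refl
  coeff-+ (x ∷ g) (y ∷ h) (suc i) = coeff-+ g h i

  coeff-· : ∀ x g i → coeff (x · g) i ≈ x * coeff g i
  coeff-· x []      i       = sym (zeroʳ x)
  coeff-· x (y ∷ g) zero    = refl
  coeff-· x (y ∷ g) (suc i) = coeff-· x g i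

  coeff-negate : ∀ g i → coeff (negate g) i ≈ - coeff g i
  coeff-negate []      i       = sym -0#≈0#
  coeff-negate (y ∷ g) zero    = refl
  coeff-negate (y ∷ g) (suc i) = coeff-negate g i

  ∷-cong : ∀ {x y g h} → x ≈ y → g ≋ h → x ∷ g ≋ y ∷ h
  ∷-cong e (coefficientwise e') = coefficientwise λ { zero → e ; (suc i) → e' i }

  ∷-injective : ∀ {x y g h} → x ∷ g ≋ y ∷ h → x ≈ y × g ≋ h
  ∷-injective (coefficientwise e) = e 0 , coefficientwise λ i → e (suc i)

  ∷-zero : ∀ {x g} → x ≈ 0# → g ≋ [] → x ∷ g ≋ []
  ∷-zero e (coefficientwise e') = coefficientwise λ { zero → e ; (suc i) → e' i }

  ∷-zero⁻¹ : ∀ {x g} → x ∷ g ≋ [] → x ≈ 0# × g ≋ []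
  ∷-zero⁻¹ (coefficientwise e) = e 0 , coefficientwise λ i → e (suc i)

  +ᴾ-cong : ∀ {g g' h h'} → g ≋ g' → h ≋ h' → g +ᴾ h ≋ g' +ᴾ h'
  +ᴾ-cong {g} {g'} {h} {h'} (coefficientwise e) (coefficientwise e') = coefficientwise λ i →
    trans (coeff-+ g h i) (trans (+-cong (e i) (e' i)) (sym (coeff-+ g' h' i)))

  ·-cong : ∀ {x y g h} → x ≈ y → g ≋ h → x · g ≋ y · h
  ·-cong {x} {y} {g} {h} e (coefficientwise e') = coefficientwise λ i →
    trans (coeff-· x g i) (trans (*-cong e (e' i)) (sym (coeff-· y h i)))

  negate-cong : ∀ {g h} → g ≋ h → negate g ≋ negate h
  negate-cong {g} {h} (coefficientwise e) = coefficientwise λ i →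
    trans (coeff-negate g i) (trans (-‿cong (e i)) (sym (coeff-negate h i)))

  +ᴾ-assoc : ∀ f g h → (f +ᴾ g) +ᴾ h ≋ f +ᴾ (g +ᴾ h)
  +ᴾ-assoc f g h = coefficientwise λ i → begin
    coeff ((f +ᴾ g) +ᴾ h) i             ≈⟨ coeff-+ (f +ᴾ g) h i ⟩
    coeff (f +ᴾ g) i + coeff h i        ≈⟨ +-congʳ (coeff-+ f g i) ⟩
    coeff f i + coeff g i + coeff h i   ≈⟨ +-assoc _ _ _ ⟩
    coeff f i + (coeff g i + coeff h i) ≈⟨ +-congˡ (coeff-+ g h i) ⟨
    coeff f i + coeff (g +ᴾ h) i        ≈⟨ coeff-+ f (g +ᴾ h) i ⟨
    coeff (f +ᴾ (g +ᴾ h)) i             ∎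
    where open ≈R

  +ᴾ-comm : ∀ g h → g +ᴾ h ≋ h +ᴾ g
  +ᴾ-comm g h = coefficientwise λ i →
    trans (coeff-+ g h i) (trans (+-comm _ _) (sym (coeff-+ h g i)))

  +ᴾ-identityʳ : ∀ g → g +ᴾ [] ≋ g
  +ᴾ-identityʳ g = +ᴾ-comm g []

  +ᴾ-inverseʳ : ∀ g → g +ᴾ negate g ≋ []
  +ᴾ-inverseʳ g = coefficientwise λ i →
    trans (coeff-+ g (negate g) i) (trans (+-congˡ (coeff-negate g i)) (-‿inverseʳ _))

  ·-distribˡ : ∀ x g h → x · (g +ᴾ h) ≋ x · g +ᴾ x · h
  ·-distribˡ x g h = coefficientwise λ i → begin
    coeff (x · (g +ᴾ h)) i              ≈⟨ coeff-· x (g +ᴾ h) i ⟩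
    x * coeff (g +ᴾ h) i                ≈⟨ *-congˡ (coeff-+ g h i) ⟩
    x * (coeff g i + coeff h i)         ≈⟨ distribˡ _ _ _ ⟩
    x * coeff g i + x * coeff h i       ≈⟨ +-cong (coeff-· x g i) (coeff-· x h i) ⟨
    coeff (x · g) i + coeff (x · h) i   ≈⟨ coeff-+ (x · g) (x · h) i ⟨
    coeff (x · g +ᴾ x · h) i            ∎
    where open ≈R

  ·-distribʳ : ∀ g x y → (x + y) · g ≋ x · g +ᴾ y · g
  ·-distribʳ g x y = coefficientwise λ i → begin
    coeff ((x + y) · g) i               ≈⟨ coeff-· (x + y) g i ⟩
    (x + y) * coeff g i                 ≈⟨ distribʳ _ _ _ ⟩
    x * coeff g i + y * coeff g i       ≈⟨ +-cong (coeff-· x g i) (coeff-· y g i) ⟨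
    coeff (x · g) i + coeff (y · g) i   ≈⟨ coeff-+ (x · g) (y · g) i ⟨
    coeff (x · g +ᴾ y · g) i            ∎
    where open ≈R

  ·-assoc : ∀ x y g → (x * y) · g ≋ x · (y · g)
  ·-assoc x y g = coefficientwise λ i → begin
    coeff ((x * y) · g) i   ≈⟨ coeff-· (x * y) g i ⟩
    x * y * coeff g i       ≈⟨ *-assoc _ _ _ ⟩
    x * (y * coeff g i)     ≈⟨ *-congˡ (coeff-· y g i) ⟨
    x * coeff (y · g) i     ≈⟨ coeff-· x (y · g) i ⟨
    coeff (x · (y · g)) i   ∎
    where open ≈R

  ·-zeroˡ : ∀ {x} g → x ≈ 0# → x · g ≋ []
  ·-zeroˡ g e = coefficientwise λ i →
    trans (coeff-· _ g i) (trans (*-congʳ e) (zeroˡ _))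

  ·-identityˡ : ∀ g → 1# · g ≋ g
  ·-identityˡ g = coefficientwise λ i → trans (coeff-· 1# g i) (*-identityˡ _)

  private
    interchange : ∀ f g h k → (f +ᴾ g) +ᴾ (h +ᴾ k) ≋ (f +ᴾ h) +ᴾ (g +ᴾ k)
    interchange f g h k = coefficientwise λ i → begin
      coeff ((f +ᴾ g) +ᴾ (h +ᴾ k)) i  ≈⟨ coeff-+ (f +ᴾ g) (h +ᴾ k) i ⟩
      coeff (f +ᴾ g) i + coeff (h +ᴾ k) i ≈⟨ +-cong (coeff-+ f g i) (coeff-+ h k i) ⟩
      coeff f i + coeff g i + (coeff h i + coeff k i)
        ≈⟨ arith (coeff f i) (coeff g i) (coeff h i) (coeff k i) ⟩
      coeff f i + coeff h i + (coeff g i + coeff k i)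
        ≈⟨ +-cong (coeff-+ f h i) (coeff-+ g k i) ⟨
      coeff (f +ᴾ h) i + coeff (g +ᴾ k) i ≈⟨ coeff-+ (f +ᴾ h) (g +ᴾ k) i ⟨
      coeff ((f +ᴾ h) +ᴾ (g +ᴾ k)) i ∎
      where
      open ≈R
      arith : ∀ a b c d → a + b + (c + d) ≈ a + c + (b + d)
      arith = solve 4 (λ a b c d → (a :+ b) :+ (c :+ d) := (a :+ c) :+ (b :+ d)) refl

  *ᴾ-congˡ : ∀ f {g h} → g ≋ h → f *ᴾ g ≋ f *ᴾ h
  *ᴾ-congˡ []      e = ≋-refl
  *ᴾ-congˡ (x ∷ f) e = +ᴾ-cong (·-cong refl e) (∷-cong refl (*ᴾ-congˡ f e))

  *ᴾ-zeroˡ : ∀ {f} h → f ≋ [] → f *ᴾ h ≋ []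
  *ᴾ-zeroˡ {[]}    h e = ≋-refl
  *ᴾ-zeroˡ {x ∷ f} h e = let (x≈0 , f≋[]) = ∷-zero⁻¹ e in
    ≋-trans (+ᴾ-cong (·-zeroˡ h x≈0) (∷-cong refl (*ᴾ-zeroˡ h f≋[]))) (∷-zero refl ≋-refl)

  *ᴾ-congʳ : ∀ {f g} h → f ≋ g → f *ᴾ h ≋ g *ᴾ h
  *ᴾ-congʳ {[]}    {g}     h e = ≋-sym (*ᴾ-zeroˡ h (≋-sym e))
  *ᴾ-congʳ {x ∷ f} {[]}    h e = *ᴾ-zeroˡ {x ∷ f} h e
  *ᴾ-congʳ {x ∷ f} {y ∷ g} h e = let (x≈y , f≋g) = ∷-injective e in
    +ᴾ-cong (·-cong x≈y ≋-refl) (∷-cong refl (*ᴾ-congʳ h f≋g))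

  *ᴾ-zeroʳ : ∀ f → f *ᴾ [] ≋ []
  *ᴾ-zeroʳ []      = ≋-refl
  *ᴾ-zeroʳ (x ∷ f) = ∷-zero refl (*ᴾ-zeroʳ f)

  *ᴾ-distribʳ : ∀ h f g → (f +ᴾ g) *ᴾ h ≋ f *ᴾ h +ᴾ g *ᴾ h
  *ᴾ-distribʳ h []      g       = ≋-refl
  *ᴾ-distribʳ h (x ∷ f) []      = ≋-sym (+ᴾ-identityʳ _)
  *ᴾ-distribʳ h (x ∷ f) (y ∷ g) = ≋-trans
    (+ᴾ-cong (·-distribʳ h x y)
      (∷-cong (sym (+-identityˡ 0#)) (*ᴾ-distribʳ h f g)))
    (interchange (x · h) (y · h) (0# ∷ f *ᴾ h) (0# ∷ g *ᴾ h))

  -- `_*ᴾ_` recurses on its left factor only. This is the same recursion on the right factor, from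
  -- which commutativity follows by induction.
  *ᴾ-comm-∷ : ∀ f y h → f *ᴾ (y ∷ h) ≋ y · f +ᴾ (0# ∷ f *ᴾ h)
  *ᴾ-comm-∷ []      y h = ≋-sym (∷-zero refl ≋-refl)
  *ᴾ-comm-∷ (x ∷ f) y h = ∷-cong (+-congʳ (*-comm x y))
    (≋-trans (+ᴾ-cong (≋-refl {x · h}) (*ᴾ-comm-∷ f y h))
    (≋-trans (≋-sym (+ᴾ-assoc (x · h) (y · f) (0# ∷ f *ᴾ h)))
    (≋-trans (+ᴾ-cong (+ᴾ-comm (x · h) (y · f)) ≋-refl)
             (+ᴾ-assoc (y · f) (x · h) (0# ∷ f *ᴾ h)))))

  *ᴾ-comm : ∀ f g → f *ᴾ g ≋ g *ᴾ f
  *ᴾ-comm f []      = *ᴾ-zeroʳ f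
  *ᴾ-comm f (y ∷ g) = ≋-trans (*ᴾ-comm-∷ f y g)
    (+ᴾ-cong (≋-refl {y · f}) (∷-cong refl (*ᴾ-comm f g)))

  ·-*ᴾ : ∀ x f g → (x · f) *ᴾ g ≋ x · (f *ᴾ g)
  ·-*ᴾ x []      g = ≋-refl
  ·-*ᴾ x (y ∷ f) g = ≋-trans
    (+ᴾ-cong (·-assoc x y g) (∷-cong (sym (zeroʳ x)) (·-*ᴾ x f g)))
    (≋-sym (·-distribˡ x (y · g) (0# ∷ f *ᴾ g)))

  shift-*ᴾ : ∀ f g → (0# ∷ f) *ᴾ g ≋ 0# ∷ f *ᴾ g
  shift-*ᴾ f g = +ᴾ-cong (·-zeroˡ g refl) ≋-refl

  *ᴾ-assoc : ∀ f g h → (f *ᴾ g) *ᴾ h ≋ f *ᴾ (g *ᴾ h)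
  *ᴾ-assoc []      g h = ≋-refl
  *ᴾ-assoc (x ∷ f) g h = ≋-trans (*ᴾ-distribʳ h (x · g) (0# ∷ f *ᴾ g))
    (+ᴾ-cong (·-*ᴾ x g h)
      (≋-trans (shift-*ᴾ (f *ᴾ g) h) (∷-cong refl (*ᴾ-assoc f g h))))

  *ᴾ-identityˡ : ∀ g → (1# ∷ []) *ᴾ g ≋ g
  *ᴾ-identityˡ g = ≋-trans (+ᴾ-cong (·-identityˡ g) (∷-zero refl ≋-refl)) (+ᴾ-identityʳ g)

  polynomialRing : CommutativeRing c ℓ
  polynomialRing = record
    { Carrier = Poly ; _≈_ = _≋_
    ; _+_ = _+ᴾ_ ; _*_ = _*ᴾ_ ; -_ = negate ; 0# = [] ; 1# = 1# ∷ []
    ; isCommutativeRing = record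
      { isRing = record
        { +-isAbelianGroup = record
          { isGroup = record
            { isMonoid = record
              { isSemigroup = record
                { isMagma = record
                  { isEquivalence = record { refl = ≋-refl ; sym = ≋-sym ; trans = ≋-trans }
                  ; ∙-cong = +ᴾ-cong }
                ; assoc = +ᴾ-assoc }
              ; identity = (λ _ → ≋-refl) , +ᴾ-identityʳ }
            ; inverse = (λ g → ≋-trans (+ᴾ-comm (negate g) g) (+ᴾ-inverseʳ g)) , +ᴾ-inverseʳ
            ; ⁻¹-cong = negate-cong }
          ; comm = +ᴾ-comm }
        ; *-cong = λ {f} {g} {h} {k} e e' → ≋-trans (*ᴾ-congʳ h e) (*ᴾ-congˡ g e')
        ; *-assoc = *ᴾ-assoc
        ; *-identity = *ᴾ-identityˡ
                     , λ g → ≋-trans (*ᴾ-comm g (1# ∷ [])) (*ᴾ-identityˡ g)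
        ; distrib = (λ f g h → ≋-trans (*ᴾ-comm f (g +ᴾ h)) (≋-trans (*ᴾ-distribʳ f g h)
                                 (+ᴾ-cong (*ᴾ-comm g f) (*ᴾ-comm h f))))
                  , *ᴾ-distribʳ }
      ; *-comm = *ᴾ-comm } }

  eval-zero : ∀ {g} x → g ≋ [] → eval g x ≈ 0#
  eval-zero {[]}    x e = refl
  eval-zero {y ∷ g} x e = let (y≈0 , g≋[]) = ∷-zero⁻¹ e in
    trans (+-cong y≈0 (trans (*-congˡ (eval-zero x g≋[])) (zeroʳ x))) (+-identityˡ 0#)

  eval-cong : ∀ {g h} x → g ≋ h → eval g x ≈ eval h x
  eval-cong {[]}    {h}     x e = sym (eval-zero x (≋-sym e))
  eval-cong {y ∷ g} {[]}    x e = eval-zero {y ∷ g} x e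
  eval-cong {y ∷ g} {z ∷ h} x e = let (y≈z , g≋h) = ∷-injective e in
    +-cong y≈z (*-congˡ (eval-cong x g≋h))

  eval-+ : ∀ g h x → eval (g +ᴾ h) x ≈ eval g x + eval h x
  eval-+ []      h       x = sym (+-identityˡ _)
  eval-+ (y ∷ g) []      x = sym (+-identityʳ _)
  eval-+ (y ∷ g) (z ∷ h) x = trans (+-congˡ (*-congˡ (eval-+ g h x)))
    (arith x y z (eval g x) (eval h x))
    where
    arith : ∀ x y z g h → (y + z) + x * (g + h) ≈ (y + x * g) + (z + x * h)
    arith = solve 5 (λ x y z g h → (y :+ z) :+ x :* (g :+ h) := (y :+ x :* g) :+ (z :+ x :* h)) refl

  eval-· : ∀ y g x → eval (y · g) x ≈ y * eval g x
  eval-· y []      x = sym (zeroʳ y)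
  eval-· y (z ∷ g) x = trans (+-congˡ (*-congˡ (eval-· y g x))) (arith x y z (eval g x))
    where
    arith : ∀ x y z g → y * z + x * (y * g) ≈ y * (z + x * g)
    arith = solve 4 (λ x y z g → y :* z :+ x :* (y :* g) := y :* (z :+ x :* g)) refl

  eval-* : ∀ g h x → eval (g *ᴾ h) x ≈ eval g x * eval h x
  eval-* []      h x = sym (zeroˡ _)
  eval-* (y ∷ g) h x = begin
    eval (y · h +ᴾ (0# ∷ g *ᴾ h)) x             ≈⟨ eval-+ (y · h) (0# ∷ g *ᴾ h) x ⟩
    eval (y · h) x + (0# + x * eval (g *ᴾ h) x)
      ≈⟨ +-cong (eval-· y h x) (+-congˡ (*-congˡ (eval-* g h x))) ⟩
    y * eval h x + (0# + x * (eval g x * eval h x)) ≈⟨ arith x y (eval g x) (eval h x) ⟩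
    (y + x * eval g x) * eval h x               ∎
    where
    open ≈R
    arith : ∀ x y g h → y * h + (0# + x * (g * h)) ≈ (y + x * g) * h
    arith = solve 4 (λ x y g h → y :* h :+ (con 0 :+ x :* (g :* h)) := (y :+ x :* g) :* h) refl

-- Ring homomorphisms applied to coefficients, used over `K` and again over `K[T]`.

module _ {c ℓ c' ℓ'} {R : CommutativeRing c ℓ} {S : CommutativeRing c' ℓ'}
  {f : CommutativeRing.Carrier R → CommutativeRing.Carrier S}
  (f-hom : IsRingHomomorphism (CommutativeRing.rawRing R) (CommutativeRing.rawRing S) f) where
  private
    module R = CommutativeRing R
    module S = CommutativeRing S
    module PR = Polynomial R
    module PS = Polynomial S
    module RR = PolynomialRing R
    module RS = PolynomialRing S
  open IsRingHomomorphism f-hom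

  coeff-map : ∀ g i → PS.coeff (List.map f g) i S.≈ f (PR.coeff g i)
  coeff-map []      i       = S.sym 0#-homo
  coeff-map (x ∷ g) zero    = S.refl
  coeff-map (x ∷ g) (suc i) = coeff-map g i

  map-cong : ∀ {g h} → g RR.≋ h → List.map f g RS.≋ List.map f h
  map-cong {g} {h} (RR.coefficientwise e) = RS.coefficientwise λ i →
    S.trans (coeff-map g i) (S.trans (⟦⟧-cong (e i)) (S.sym (coeff-map h i)))

  map-+ : ∀ g h → List.map f (g PR.+ᴾ h) RS.≋ List.map f g PS.+ᴾ List.map f h
  map-+ []      h       = RS.≋-refl
  map-+ (x ∷ g) []      = RS.≋-refl
  map-+ (x ∷ g) (y ∷ h) = RS.∷-cong (+-homo x y) (map-+ g h)

  map-· : ∀ x g → List.map f (x RR.· g) RS.≋ f x RS.· List.map f g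
  map-· x []      = RS.≋-refl
  map-· x (y ∷ g) = RS.∷-cong (*-homo x y) (map-· x g)

  map-* : ∀ g h → List.map f (g PR.*ᴾ h) RS.≋ List.map f g PS.*ᴾ List.map f h
  map-* []      h = RS.≋-refl
  map-* (x ∷ g) h = RS.≋-trans (map-+ (x RR.· h) (R.0# ∷ g PR.*ᴾ h))
    (RS.+ᴾ-cong (map-· x h) (RS.∷-cong 0#-homo (map-* g h)))

  map-negate : ∀ g → List.map f (RR.negate g) RS.≋ RS.negate (List.map f g)
  map-negate []      = RS.≋-refl
  map-negate (x ∷ g) = RS.∷-cong (-‿homo x) (map-negate g)

  map-isRingHomomorphism : IsRingHomomorphism (CommutativeRing.rawRing RR.polynomialRing)
                             (CommutativeRing.rawRing RS.polynomialRing) (List.map f)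
  map-isRingHomomorphism = record
    { isSemiringHomomorphism = record
      { isNearSemiringHomomorphism = record
        { +-isMonoidHomomorphism = record
          { isMagmaHomomorphism = record
            { isRelHomomorphism = record { cong = map-cong }
            ; homo = map-+ }
          ; ε-homo = RS.≋-refl }
        ; *-homo = map-* }
      ; 1#-homo = RS.∷-cong 1#-homo RS.≋-refl }
    ; -‿homo = map-negate }

  eval-map : ∀ g x → PS.eval (List.map f g) (f x) S.≈ f (PR.eval g x)
  eval-map []      x = S.sym 0#-homo
  eval-map (y ∷ g) x = S.sym (S.trans (+-homo y _) (S.+-congˡ
    (S.trans (*-homo x _) (S.*-congˡ (S.sym (eval-map g x))))))

-- Polynomials over a discrete field: division, divisibility and roots.

module FieldPolynomials {c ℓ} {R : CommutativeRing c ℓ} (isField : IsDiscreteField R) where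
  open CommutativeRing R hiding (zero)
  open IsDiscreteField isField
  open Polynomial R
  open PolynomialRing R
  module PR = CommutativeRing polynomialRing
  private
    module RP = RingProperties ring
    module PP = RingProperties PR.ring
    module ≈R = SetoidReasoning setoid
    module ≋R = SetoidReasoning PR.setoid
    module S = SemiringSolver commutativeSemiring
  open SemiringSolver PR.commutativeSemiring using (solve; _:=_; _:+_; _:*_) public

  x*y≈0 : ∀ {x y} → x * y ≈ 0# → x ≈ 0# ⊎ y ≈ 0#
  x*y≈0 {x} {y} e with x ≟ 0#
  ... | yes x≈0 = inj₁ x≈0
  ... | no  x≉0 = let (z , xz≈1) = inverse x x≉0 in inj₂ (begin
    y           ≈⟨ *-identityˡ y ⟨
    1# * y      ≈⟨ *-congʳ xz≈1 ⟨
    x * z * y   ≈⟨ *-congʳ (*-comm x z) ⟩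
    z * x * y   ≈⟨ *-assoc z x y ⟩
    z * (x * y) ≈⟨ *-congˡ e ⟩
    z * 0#      ≈⟨ zeroʳ z ⟩
    0#          ∎)
    where open ≈R

  zero? : ∀ g → Dec (g ≋ [])
  zero? []      = yes ≋-refl
  zero? (x ∷ g) = map′ (λ (e , e') → ∷-zero e e') ∷-zero⁻¹ ((x ≟ 0#) ×-dec zero? g)

  private
    tail-*ᴾ≋[] : ∀ {x} g h → x ≈ 0# → (x ∷ g) *ᴾ h ≋ [] → g *ᴾ h ≋ []
    tail-*ᴾ≋[] {x} g h x≈0 e = proj₂ (∷-zero⁻¹ {0#} {g *ᴾ h} (≋-trans
      (+ᴾ-cong (≋-sym (·-zeroˡ h x≈0)) (≋-refl {0# ∷ g *ᴾ h})) e))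

  -- Constant terms decide: a zero head is dropped together with a factor `x`, and two nonzero heads
  -- give the product a nonzero constant term.
  *ᴾ≋[] : ∀ g h → g *ᴾ h ≋ [] → g ≋ [] ⊎ h ≋ []
  *ᴾ≋[] []      h       e = inj₁ ≋-refl
  *ᴾ≋[] (x ∷ g) []      e = inj₂ ≋-refl
  *ᴾ≋[] (x ∷ g) (y ∷ h) e = step (*ᴾ≋[] g (y ∷ h)) (*ᴾ≋[] (x ∷ g) h) (x ≟ 0#) (y ≟ 0#)
    where
    step : (g *ᴾ (y ∷ h) ≋ [] → g ≋ [] ⊎ y ∷ h ≋ []) →
           ((x ∷ g) *ᴾ h ≋ [] → x ∷ g ≋ [] ⊎ h ≋ []) →
           Dec (x ≈ 0#) → Dec (y ≈ 0#) → x ∷ g ≋ [] ⊎ y ∷ h ≋ []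
    step rec-g rec-h (yes x≈0) _ = Sum.map₁ (∷-zero x≈0) (rec-g (tail-*ᴾ≋[] g (y ∷ h) x≈0 e))
    step rec-g rec-h (no _) (yes y≈0) = Sum.map₂ (∷-zero y≈0) (rec-h
      (≋-trans (*ᴾ-comm (x ∷ g) h)
        (tail-*ᴾ≋[] h (x ∷ g) y≈0 (≋-trans (*ᴾ-comm (y ∷ h) (x ∷ g)) e))))
    step rec-g rec-h (no x≉0) (no y≉0) = ⊥-elim (Sum.[ x≉0 , y≉0 ]
      (x*y≈0 (trans (sym (+-identityʳ _)) (proj₁ (∷-zero⁻¹ e)))))

  -- Degree bounds stand in for the degree, which a list with possible trailing zeros does not
  -- display.
  Below : ℕ → Poly → Set ℓ
  Below n g = ∀ i → n ≤ i → coeff g i ≈ 0#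

  below-cong : ∀ {n g h} → g ≋ h → Below n g → Below n h
  below-cong e b i n≤i = trans (sym (at e i)) (b i n≤i)

  below-weaken : ∀ {m n} g → m ≤ n → Below m g → Below n g
  below-weaken g m≤n b i n≤i = b i (ℕ.≤-trans m≤n n≤i)

  below-+ : ∀ {n} g h → Below n g → Below n h → Below n (g +ᴾ h)
  below-+ g h b b' i n≤i =
    trans (coeff-+ g h i) (trans (+-cong (b i n≤i) (b' i n≤i)) (+-identityˡ 0#))

  below-· : ∀ {n} x g → Below n g → Below n (x · g)
  below-· x g b i n≤i = trans (coeff-· x g i) (trans (*-congˡ (b i n≤i)) (zeroʳ x))

  below-negate : ∀ {n} g → Below n g → Below n (negate g)
  below-negate g b i n≤i = trans (coeff-negate g i) (trans (-‿cong (b i n≤i)) RP.-0#≈0#)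

  below-∷ : ∀ {n x} g → Below n g → Below (suc n) (x ∷ g)
  below-∷ g b (suc i) (s≤s n≤i) = b i n≤i

  below-0 : ∀ g → Below 0 g → g ≋ []
  below-0 g b = coefficientwise λ i → b i z≤n

  below-pred : ∀ {n} g → Below (suc n) g → coeff g n ≈ 0# → Below n g
  below-pred {n} g b e i n≤i with n ℕ.≟ i
  ... | yes ≡.refl = e
  ... | no  n≢i    = b i (ℕ.≤∧≢⇒< n≤i n≢i)

  monic-cong : ∀ {n g h} → g ≋ h → MonicOfDegree n g → MonicOfDegree n h
  monic-cong e (m , b) = trans (sym (at e _)) m , λ i n<i → trans (sym (at e i)) (b i n<i)

  monic-1 : MonicOfDegree 0 (1# ∷ [])
  monic-1 = refl , λ { (suc i) _ → refl }

  monic-∷ : ∀ {n x} g → MonicOfDegree n g → MonicOfDegree (suc n) (x ∷ g)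
  monic-∷ g (m , b) = m , λ { (suc i) (s≤s n<i) → b i n<i }

  monic-tail : ∀ {n x} g → MonicOfDegree (suc n) (x ∷ g) → MonicOfDegree n g
  monic-tail g (m , b) = m , λ i n<i → b (suc i) (s≤s n<i)

  monic-+ : ∀ {n} g h → Below n g → MonicOfDegree n h → MonicOfDegree n (g +ᴾ h)
  monic-+ {n} g h b (m , b') =
    trans (coeff-+ g h n) (trans (+-cong (b n ℕ.≤-refl) m) (+-identityˡ 1#)) ,
    below-+ g h (below-weaken g (ℕ.n≤1+n n) b) b'

  monic-* : ∀ {m n} g h → MonicOfDegree m g → MonicOfDegree n h → MonicOfDegree (m ℕ.+ n) (g *ᴾ h)
  monic-* []      h (0≈1 , _) _ = ⊥-elim (1≉0 (sym 0≈1))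
  monic-* {zero} {n} (x ∷ g) h (x≈1 , b) mh = monic-cong {h = (x ∷ g) *ᴾ h}
    (≋-trans (≋-sym (*ᴾ-identityˡ h)) (*ᴾ-congʳ {1# ∷ []} {x ∷ g} h
      (∷-cong (sym x≈1) (coefficientwise λ i → sym (b (suc i) (s≤s z≤n))))))
    mh
  monic-* {suc m} {n} (x ∷ g) h mg mh@(_ , b) = monic-+ (x · h) (0# ∷ g *ᴾ h)
    (below-weaken (x · h) (s≤s (ℕ.m≤n+m n m)) (below-· x h b)) (monic-∷ (g *ᴾ h) (monic-* g h (monic-tail {x = x} g mg) mh))

  monic-^ : ∀ {d} g → MonicOfDegree d g → ∀ k → MonicOfDegree (d ℕ.* k) (g ^ᴾ k)
  monic-^ {d} g mg zero    rewrite ℕ.*-zeroʳ d = monic-1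
  monic-^ {d} g mg (suc k) rewrite ℕ.*-suc d k = monic-* g (g ^ᴾ k) mg (monic-^ g mg k)

  monic≢[] : ∀ {n g} → MonicOfDegree n g → ¬ g ≋ []
  monic≢[] (m , _) e = 1≉0 (trans (sym m) (at e _))

  monic-below⇒< : ∀ {m n} x g → MonicOfDegree m (x · g) → Below n g → m < n
  monic-below⇒< {m} {n} x g (e , _) b with n ℕ.≤? m
  ... | yes n≤m = ⊥-elim (1≉0 (trans (sym e) (below-· x g b m n≤m)))
  ... | no  n≰m = ℕ.≰⇒> n≰m

  -- Decidable equality finds the last nonzero coefficient, whose inverse is the scalar. This is the
  -- substitute for a degree function.
  normalise : ∀ g → g ≋ [] ⊎ (∃[ x ] x ≉ 0# × ∃[ m ] MonicOfDegree m (x · g))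
  normalise []      = inj₁ ≋-refl
  normalise (y ∷ g) with normalise g
  ... | inj₂ (x , x≉0 , m , mg) = inj₂ (x , x≉0 , suc m , monic-∷ (x · g) mg)
  ... | inj₁ g≋[] with y ≟ 0#
  ...   | yes y≈0 = inj₁ (∷-zero y≈0 g≋[])
  ...   | no  y≉0 = let (x , yx≈1) = inverse y y≉0 in inj₂
    ( x
    , (λ x≈0 → 1≉0 (trans (sym yx≈1) (trans (*-congˡ x≈0) (zeroʳ y))))
    , 0
    , trans (*-comm x y) yx≈1
    , λ { (suc i) _ → at (·-cong (refl {x}) g≋[]) i } )

  -- From `f = q g + r` follows `x + X f = X q g + (x + X r)`. The last bracket has degree at most
  -- `n`, and subtracting `t g` removes its coefficient `t` there.
  divMod : ∀ {n} f g → MonicOfDegree n g → ∃[ q ] ∃[ r ] f ≋ q *ᴾ g +ᴾ r × Below n r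
  divMod     []      g mg = [] , [] , ≋-refl , λ _ _ → refl
  divMod {n} (x ∷ f) g mg@(g-lead , g-below) with divMod f g mg
  ... | (q , r , e , b) = (t ∷ q) , ((x ∷ r) +ᴾ negate (t · g)) , eq ,
    below-pred ((x ∷ r) +ᴾ negate (t · g)) (below-+ (x ∷ r) (negate (t · g)) (below-∷ r b)
                  (below-negate (t · g) (below-· t g g-below)))
      (trans (coeff-+ (x ∷ r) (negate (t · g)) n)
      (trans (+-congˡ (trans (coeff-negate (t · g) n) (-‿cong (trans (coeff-· t g n)
                (trans (*-congˡ g-lead) (*-identityʳ t))))))
      (-‿inverseʳ t)))
    where
    t : Carrier
    t = coeff (x ∷ r) n
    open ≋R
    eq : x ∷ f ≋ (t ∷ q) *ᴾ g +ᴾ ((x ∷ r) +ᴾ negate (t · g))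
    eq = begin
      x ∷ f                             ≈⟨ ∷-cong (sym (+-identityˡ x)) e ⟩
      (0# ∷ q *ᴾ g) +ᴾ (x ∷ r)          ≈⟨ PR.+-identityʳ _ ⟨
      ((0# ∷ q *ᴾ g) +ᴾ (x ∷ r)) +ᴾ []  ≈⟨ PR.+-congˡ {(0# ∷ q *ᴾ g) +ᴾ (x ∷ r)} (+ᴾ-inverseʳ (t · g)) ⟨
      ((0# ∷ q *ᴾ g) +ᴾ (x ∷ r)) +ᴾ (t · g +ᴾ negate (t · g))
        ≈⟨ solve 4 (λ a b c d → (a :+ b) :+ (c :+ d) := (c :+ a) :+ (b :+ d)) ≋-refl
             (0# ∷ q *ᴾ g) (x ∷ r) (t · g) (negate (t · g)) ⟩
      (t · g +ᴾ (0# ∷ q *ᴾ g)) +ᴾ ((x ∷ r) +ᴾ negate (t · g)) ∎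

  -- A nonzero `q` has a monic scalar multiple, whose product with `g` has degree at least `n`. The
  -- uniqueness of remainders and the comparison of degrees under divisibility rest on this.
  below-multiple : ∀ {n} q g → MonicOfDegree n g → Below n (q *ᴾ g) → q ≋ []
  below-multiple {n} q g mg b with normalise q
  ... | inj₁ q≋[] = q≋[]
  ... | inj₂ (x , x≉0 , m , mq) = ⊥-elim (ℕ.<-irrefl ≡.refl (ℕ.<-≤-trans
    (monic-below⇒< x (q *ᴾ g) (monic-cong (·-*ᴾ x q g) (monic-* (x · q) g mq mg)) b)
    (ℕ.m≤n+m n m)))

  cancelʳ : ∀ {n} g h k → MonicOfDegree n g → h *ᴾ g ≋ k *ᴾ g → h ≋ k
  cancelʳ g h k mg e with *ᴾ≋[] (h +ᴾ negate k) g (begin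
      (h +ᴾ negate k) *ᴾ g        ≈⟨ *ᴾ-distribʳ g h (negate k) ⟩
      h *ᴾ g +ᴾ negate k *ᴾ g     ≈⟨ PR.+-cong e (PR.sym (PP.-‿distribˡ-* k g)) ⟩
      k *ᴾ g +ᴾ negate (k *ᴾ g)   ≈⟨ +ᴾ-inverseʳ (k *ᴾ g) ⟩
      []                          ∎)
    where open ≋R
  ... | inj₁ h-k≋[] = PP.x∙y⁻¹≈ε⇒x≈y h k h-k≋[]
  ... | inj₂ g≋[]   = ⊥-elim (monic≢[] mg g≋[])

  divisor : ∀ {g h} q → q *ᴾ g ≋ h → g ∣ᴾ h
  divisor q e = q RawMagmaDefs., at e

  quotient : ∀ {g h} → g ∣ᴾ h → ∃[ q ] q *ᴾ g ≋ h
  quotient (q RawMagmaDefs., e) = q , coefficientwise e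

  ∣ᴾ-refl : ∀ {g} → g ∣ᴾ g
  ∣ᴾ-refl {g} = divisor (1# ∷ []) (*ᴾ-identityˡ g)

  ∣ᴾ-trans : ∀ {f g h} → f ∣ᴾ g → g ∣ᴾ h → f ∣ᴾ h
  ∣ᴾ-trans {f} f∣g g∣h = let (q , e) = quotient f∣g ; (q' , e') = quotient g∣h in
    divisor (q' *ᴾ q) (≋-trans (*ᴾ-assoc q' q f) (≋-trans (*ᴾ-congˡ q' e) e'))

  ∣ᴾ-respʳ : ∀ {f g h} → g ≋ h → f ∣ᴾ g → f ∣ᴾ h
  ∣ᴾ-respʳ g≋h f∣g = let (q , e) = quotient f∣g in divisor q (≋-trans e g≋h)

  ∣ᴾ-respˡ : ∀ {f g h} → f ≋ g → f ∣ᴾ h → g ∣ᴾ h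
  ∣ᴾ-respˡ f≋g f∣h = let (q , e) = quotient f∣h in
    divisor q (≋-trans (*ᴾ-congˡ q (≋-sym f≋g)) e)

  ∣ᴾ-*ˡ : ∀ {f g} h → f ∣ᴾ g → f ∣ᴾ h *ᴾ g
  ∣ᴾ-*ˡ h f∣g = ∣ᴾ-trans f∣g (divisor h ≋-refl)

  ∣ᴾ-*ʳ : ∀ {f g} h → f ∣ᴾ g → f ∣ᴾ g *ᴾ h
  ∣ᴾ-*ʳ {g = g} h f∣g = ∣ᴾ-respʳ (*ᴾ-comm h g) (∣ᴾ-*ˡ h f∣g)

  ∣ᴾ-+ : ∀ {f g h} → f ∣ᴾ g → f ∣ᴾ h → f ∣ᴾ g +ᴾ h
  ∣ᴾ-+ {f} f∣g f∣h = let (q , e) = quotient f∣g ; (q' , e') = quotient f∣h in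
    divisor (q +ᴾ q') (≋-trans (*ᴾ-distribʳ f q q') (+ᴾ-cong e e'))

  ∣ᴾ-* : ∀ {f g h k} → f ∣ᴾ g → h ∣ᴾ k → f *ᴾ h ∣ᴾ g *ᴾ k
  ∣ᴾ-* {f} {g} {h} {k} f∣g h∣k = let (q , e) = quotient f∣g ; (q' , e') = quotient h∣k in
    divisor (q *ᴾ q') (≋-trans
      (solve 4 (λ q q' f h → (q :* q') :* (f :* h) := (q :* f) :* (q' :* h)) ≋-refl q q' f h)
      (PR.*-cong e e'))

  ∣ᴾ-cancelʳ : ∀ {n f g} h → MonicOfDegree n h → f *ᴾ h ∣ᴾ g *ᴾ h → f ∣ᴾ g
  ∣ᴾ-cancelʳ {f = f} {g} h mh d = let (q , e) = quotient d in
    divisor q (cancelʳ h (q *ᴾ f) g mh (≋-trans (*ᴾ-assoc q f h) e))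

  ^ᴾ-+ : ∀ g j k → g ^ᴾ (j ℕ.+ k) ≋ g ^ᴾ j *ᴾ g ^ᴾ k
  ^ᴾ-+ g zero    k = ≋-sym (*ᴾ-identityˡ _)
  ^ᴾ-+ g (suc j) k = ≋-trans (*ᴾ-congˡ g (^ᴾ-+ g j k)) (≋-sym (*ᴾ-assoc g _ _))

  degree-∣ᴾ : ∀ {m n g h} → MonicOfDegree m g → MonicOfDegree n h → g ∣ᴾ h → m ≤ n
  degree-∣ᴾ {m} {n} {g} {h} mg mh g∣h with quotient g∣h
  ... | (q , e) with m ℕ.≤? n
  ...   | yes m≤n = m≤n
  ...   | no  m≰n = ⊥-elim (monic≢[] mh (≋-trans (≋-sym e) (*ᴾ-congʳ g
          (below-multiple q g mg (below-cong (≋-sym e) (below-weaken h (ℕ.≰⇒> m≰n) (proj₂ mh)))))))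

  ∣ᴾ-remainder : ∀ {n g} q r → MonicOfDegree n g → Below n r → g ∣ᴾ q *ᴾ g +ᴾ r → r ≋ []
  ∣ᴾ-remainder {n} {g} q r mg b d with quotient d
  ... | (q' , e) = ≋-trans (≋-sym eq) (*ᴾ-congʳ g (below-multiple (q' +ᴾ negate q) g mg
                     (below-cong (≋-sym eq) b)))
    where
    open ≋R
    eq : (q' +ᴾ negate q) *ᴾ g ≋ r
    eq = begin
      (q' +ᴾ negate q) *ᴾ g              ≈⟨ *ᴾ-distribʳ g q' (negate q) ⟩
      q' *ᴾ g +ᴾ negate q *ᴾ g           ≈⟨ PR.+-cong e (PR.sym (PP.-‿distribˡ-* q g)) ⟩
      (q *ᴾ g +ᴾ r) +ᴾ negate (q *ᴾ g)
        ≈⟨ solve 3 (λ a b c → (a :+ b) :+ c := (a :+ c) :+ b) ≋-refl (q *ᴾ g) r (negate (q *ᴾ g)) ⟩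
      (q *ᴾ g +ᴾ negate (q *ᴾ g)) +ᴾ r   ≈⟨ PR.+-congʳ (+ᴾ-inverseʳ (q *ᴾ g)) ⟩
      r                                  ∎

  _∣ᴾ?_ : ∀ {n g} → MonicOfDegree n g → ∀ h → Dec (g ∣ᴾ h)
  _∣ᴾ?_ {n} {g} mg h with divMod h g mg
  ... | (q , r , e , b) with zero? r
  ...   | yes r≋[] = yes (divisor q (≋-sym (≋-trans e (≋-trans (PR.+-congˡ r≋[]) (+ᴾ-identityʳ _)))))
  ...   | no  r≢[] = no λ d → r≢[] (∣ᴾ-remainder q r mg b (∣ᴾ-respʳ e d))

  private
    -- (g(x) - g(r)) / (x - r), where g = y ∷ h
    differenceQuotient : Carrier → Poly → Poly
    differenceQuotient r []      = []
    differenceQuotient r (z ∷ h) = eval (z ∷ h) r ∷ differenceQuotient r h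

    length-differenceQuotient : ∀ r h → List.length (differenceQuotient r h) ≡ List.length h
    length-differenceQuotient r []      = ≡.refl
    length-differenceQuotient r (z ∷ h) = ≡.cong suc (length-differenceQuotient r h)

    -- The factorisation with both sides moved so that no subtraction occurs.
    eval-differenceQuotient : ∀ r h x →
      x * eval h x + r * eval (differenceQuotient r h) x ≈
      r * eval h r + x * eval (differenceQuotient r h) x
    eval-differenceQuotient r []      x = trans (+-cong (zeroʳ x) refl)
      (trans (+-comm 0# _) (+-cong refl (sym (zeroʳ x))))
    eval-differenceQuotient r (z ∷ h) x = begin
      x * (z + x * a) + r * ((z + r * b) + x * t)
        ≈⟨ S.solve 6 (λ r x z a b t → x S.:* (z S.:+ x S.:* a) S.:+ r S.:* ((z S.:+ r S.:* b) S.:+ x S.:* t)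
             S.:= (x S.:* z S.:+ r S.:* (z S.:+ r S.:* b)) S.:+ x S.:* (x S.:* a S.:+ r S.:* t))
             refl r x z a b t ⟩
      (x * z + r * (z + r * b)) + x * (x * a + r * t)
        ≈⟨ +-congˡ (*-congˡ (eval-differenceQuotient r h x)) ⟩
      (x * z + r * (z + r * b)) + x * (r * b + x * t)
        ≈⟨ S.solve 5 (λ r x z b t → (x S.:* z S.:+ r S.:* (z S.:+ r S.:* b)) S.:+ x S.:* (r S.:* b S.:+ x S.:* t)
             S.:= r S.:* (z S.:+ r S.:* b) S.:+ x S.:* ((z S.:+ r S.:* b) S.:+ x S.:* t))
             refl r x z b t ⟩
      r * (z + r * b) + x * ((z + r * b) + x * t) ∎
      where
      open ≈R
      a b t : Carrier
      a = eval h x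
      b = eval h r
      t = eval (differenceQuotient r h) x

    differenceQuotient≋[] : ∀ r h → differenceQuotient r h ≋ [] → h ≋ []
    differenceQuotient≋[] r []      e = ≋-refl
    differenceQuotient≋[] r (z ∷ h) e =
      let (e₀ , e') = ∷-zero⁻¹ e
          h≋[]     = differenceQuotient≋[] r h e' in
      ∷-zero (trans (sym (trans (+-congˡ (trans (*-congˡ (eval-zero r h≋[])) (zeroʳ r)))
                                (+-identityʳ z))) e₀) h≋[]

  -- Dividing by `x - r₀` shortens the list by one, and the other roots, being different from `r₀`,
  -- are roots of the quotient. Bounding the length of the list avoids speaking of its degree.
  roots⇒zero : ∀ {n} (r : Fin n → Carrier) → (∀ i j → r i ≈ r j → i ≡ j) →
    ∀ g → List.length g ≤ n → (∀ i → eval g (r i) ≈ 0#) → g ≋ []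
  roots⇒zero         r r-inj []      _         _     = ≋-refl
  roots⇒zero {suc n} r r-inj (y ∷ h) (s≤s len) roots = ∷-zero
    (trans (sym (trans (+-congˡ (trans (*-congˡ (eval-zero r₀ h≋[])) (zeroʳ r₀))) (+-identityʳ y)))
           (roots zero))
    h≋[]
    where
    open ≈R
    r₀ : Carrier
    r₀ = r zero
    q : Poly
    q = differenceQuotient r₀ h
    q-root : ∀ i → eval q (r (suc i)) ≈ 0#
    q-root i with x*y≈0 {r (suc i) - r₀} (begin
        (x - r₀) * eval q x        ≈⟨ distribʳ _ _ _ ⟩
        x * eval q x + - r₀ * eval q x ≈⟨ +-congˡ (RP.-‿distribˡ-* r₀ _) ⟨
        x * eval q x - r₀ * eval q x
          -- Both `x` and `r₀` are roots of `y ∷ h`, so `x h(x) = r₀ h(r₀)`; cancelling these in the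
          -- factorisation leaves `x q(x) = r₀ q(x)`.
          ≈⟨ +-congʳ (RP.+-cancelˡ (x * eval h x) _ _ (trans
               (+-congʳ (RP.+-cancelˡ y _ _ (trans (roots (suc i)) (sym (roots zero)))))
               (sym (eval-differenceQuotient r₀ h x)))) ⟩
        r₀ * eval q x - r₀ * eval q x ≈⟨ -‿inverseʳ _ ⟩
        0# ∎)
      where
      x : Carrier
      x = r (suc i)
    ... | inj₁ x-r₀≈0 with () ← r-inj (suc i) zero (RP.x∙y⁻¹≈ε⇒x≈y _ _ x-r₀≈0)
    ... | inj₂ e      = e
    h≋[] : h ≋ []
    h≋[] = differenceQuotient≋[] r₀ h (roots⇒zero (r ∘ suc)
      (λ i j e → Fin.suc-injective (r-inj (suc i) (suc j) e)) q
      (≡.subst (_≤ n) (≡.sym (length-differenceQuotient r₀ h)) len) q-root)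

-- Polynomials over a finite field: search, principal ideals, primes, lcm and order.

least-witness : ∀ {p} {P : ℕ → Set p} → (∀ n → Dec (P n)) → ∀ n → P n →
  ∃[ m ] P m × (∀ j → P j → m ≤ j)
least-witness {P = P} P? = <-rec _ λ n rec pn → go n rec pn (ℕ.anyUpTo? P? n)
  where
  go : ∀ n → (∀ {k} → k < n → P k → ∃[ m ] P m × (∀ j → P j → m ≤ j)) → P n →
       Dec (∃[ k ] k < n × P k) → ∃[ m ] P m × (∀ j → P j → m ≤ j)
  go n rec pn (yes (k , k<n , pk)) = rec k<n pk
  go n rec pn (no ¬smaller)        = n , pn , λ j pj → ℕ.≮⇒≥ λ j<n → ¬smaller (j , j<n , pj)

record IsFiniteField {c ℓ} (R : CommutativeRing c ℓ) (l : ℕ) : Set (c ⊔ ℓ) where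
  open CommutativeRing R
  field
    isDiscreteField : IsDiscreteField R
    enum            : Fin l → Carrier
    index           : Carrier → Fin l
    enum-index      : ∀ x → enum (index x) ≈ x
    enum-injective  : ∀ {i j} → enum i ≈ enum j → i ≡ j

module FiniteFieldPolynomials {c ℓ} {R : CommutativeRing c ℓ} {l : ℕ}
  (isFiniteField : IsFiniteField R l) where
  open CommutativeRing R hiding (zero)
  open IsFiniteField isFiniteField
  open IsDiscreteField isDiscreteField
  open Polynomial R
  open PolynomialRing R
  open FieldPolynomials isDiscreteField
  private
    module PP = RingProperties PR.ring
    module ≋R = SetoidReasoning PR.setoid

  -- Digits in base `l` serve as coefficients, which numbers the polynomials of degree less than `n`
  -- by the numbers below `l ^ n`.
  decode : ∀ n → Fin (l ℕ.^ n) → Poly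
  decode zero    _ = []
  decode (suc n) i = enum (proj₁ (remQuot (l ℕ.^ n) i)) ∷ decode n (proj₂ (remQuot {l} (l ℕ.^ n) i))

  below-decode : ∀ n i → Below n (decode n i)
  below-decode zero    i = λ _ _ → refl
  below-decode (suc n) i = below-∷ (decode n (proj₂ (remQuot {l} (l ℕ.^ n) i))) (below-decode n _)

  decode-injective : ∀ n {i j} → decode n i ≋ decode n j → i ≡ j
  decode-injective zero    {zero} {zero} _ = ≡.refl
  decode-injective (suc n) {i} {j} e = let (e₀ , e') = ∷-injective e in begin
    i                                        ≡⟨ Fin.combine-remQuot {l} (l ℕ.^ n) i ⟨
    uncurry combine (remQuot {l} (l ℕ.^ n) i)
      ≡⟨ ≡.cong₂ combine (enum-injective e₀) (decode-injective n e') ⟩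
    uncurry combine (remQuot {l} (l ℕ.^ n) j) ≡⟨ Fin.combine-remQuot {l} (l ℕ.^ n) j ⟩
    j                                        ∎
    where open ≡.≡-Reasoning

  decode-surjective : ∀ n g → Below n g → ∃[ i ] decode n i ≋ g
  decode-surjective zero    g b = zero , ≋-sym (below-0 g b)
  decode-surjective (suc n) g b with decode-surjective n (List.drop 1 g) (below-drop g b)
    where
    below-drop : ∀ g → Below (suc n) g → Below n (List.drop 1 g)
    below-drop []      b i _   = refl
    below-drop (x ∷ g) b i n≤i = b (suc i) (s≤s n≤i)
  ... | (i , e) = combine (index (coeff g 0)) i , ≋-trans
    (∷-cong (trans (reflexive (≡.cong (enum ∘ proj₁) rq)) (enum-index _))
            (≋-trans (PR.reflexive (≡.cong (decode n ∘ proj₂) rq)) e))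
    (head-tail g)
    where
    rq : remQuot {l} (l ℕ.^ n) (combine (index (coeff g 0)) i) ≡ (index (coeff g 0) , i)
    rq = Fin.remQuot-combine (index (coeff g 0)) i
    head-tail : ∀ g → coeff g 0 ∷ List.drop 1 g ≋ g
    head-tail []      = ∷-zero refl ≋-refl
    head-tail (x ∷ g) = ≋-refl

  module Ideal {i} (I : Poly → Set i)
    (I-resp : ∀ {g h} → g ≋ h → I g → I h)
    (I-+ : ∀ {g h} → I g → I h → I (g +ᴾ h))
    (I-* : ∀ q {g} → I g → I (q *ᴾ g))
    (I? : ∀ g → Dec (I g)) where

    -- The usual member of least degree, found by search: there are finitely many polynomials of
    -- degree less than `n`, and a nonzero one in `I` is made monic and restarts the search. If
    -- there is none, the remainder of every member modulo `g` is zero.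
    generator : ∀ n g → MonicOfDegree n g → I g →
      ∃[ m ] ∃[ L ] MonicOfDegree m L × I L × (∀ h → I h → L ∣ᴾ h)
    generator = <-rec _ λ n rec g mg Ig → step n rec g mg Ig
      (Fin.any? λ i → I? (decode n i) ×-dec ¬? (zero? (decode n i)))
      where
      Generated : Set _
      Generated = ∃[ m ] ∃[ L ] MonicOfDegree m L × I L × (∀ h → I h → L ∣ᴾ h)
      step : ∀ n → (∀ {k} → k < n → ∀ g → MonicOfDegree k g → I g → Generated) →
        ∀ g → MonicOfDegree n g → I g →
        Dec (∃[ i ] I (decode n i) × ¬ decode n i ≋ []) → Generated
      step n rec g mg Ig (yes (i , Ii , i≢[])) with normalise (decode n i)
      ... | inj₁ i≋[] = contradiction i≋[] i≢[]
      ... | inj₂ (x , _ , m , mi) = rec (monic-below⇒< x (decode n i) mi (below-decode n i))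
        (x · decode n i) mi
        (I-resp (≋-trans (+ᴾ-cong (≋-refl {x · decode n i}) (∷-zero refl ≋-refl)) (+ᴾ-identityʳ _))
                (I-* (x ∷ []) Ii))
      step n rec g mg Ig (no ¬smaller) = n , g , mg , Ig , λ h Ih →
        let (q , r , e , b)  = divMod h g mg
            (i , i≋r)        = decode-surjective n r b
            Ir               = I-resp (remainder h q r e) (I-+ Ih (I-* (negate q) Ig))
            r≋[]             = ≋-trans (≋-sym i≋r) (decidable-stable (zero? (decode n i))
                                 λ i≢[] → ¬smaller (i , I-resp (≋-sym i≋r) Ir , i≢[]))
        in divisor q (≋-sym (≋-trans e (≋-trans (PR.+-congˡ r≋[]) (+ᴾ-identityʳ _))))
        where
        open ≋R
        remainder : ∀ h q r → h ≋ q *ᴾ g +ᴾ r → h +ᴾ negate q *ᴾ g ≋ r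
        remainder h q r e = begin
          h +ᴾ negate q *ᴾ g                ≈⟨ PR.+-cong e (PR.sym (PP.-‿distribˡ-* q g)) ⟩
          (q *ᴾ g +ᴾ r) +ᴾ negate (q *ᴾ g)
            ≈⟨ solve 3 (λ a b c → (a :+ b) :+ c := (a :+ c) :+ b) ≋-refl (q *ᴾ g) r (negate (q *ᴾ g)) ⟩
          (q *ᴾ g +ᴾ negate (q *ᴾ g)) +ᴾ r  ≈⟨ PR.+-congʳ (+ᴾ-inverseʳ (q *ᴾ g)) ⟩
          r                                 ∎

  -- The ideal of all `f` with `p ∣ f h` contains `p`, so its generator `L` divides `p` and is a
  -- unit or an associate of `p`. A unit gives `p ∣ h`. Otherwise `p ∣ L`, and if `p ∣ g h` then `g`
  -- lies in the ideal, so `L ∣ g`.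
  irreducible⇒prime : ∀ {d p} → MonicOfDegree d p → Irreducible p →
    ∀ g h → p ∣ᴾ g *ᴾ h → p ∣ᴾ g ⊎ p ∣ᴾ h
  irreducible⇒prime {d} {p} mp irr g h p∣gh
    with Ideal.generator (λ f → p ∣ᴾ f *ᴾ h)
           (λ f≋f' → ∣ᴾ-respʳ (*ᴾ-congʳ h f≋f'))
           (λ {f} {f'} i i' → ∣ᴾ-respʳ (≋-sym (*ᴾ-distribʳ h f f')) (∣ᴾ-+ i i'))
           (λ q {f} i → ∣ᴾ-respʳ (≋-sym (*ᴾ-assoc q f h)) (∣ᴾ-*ˡ q i))
           (λ f → mp ∣ᴾ? (f *ᴾ h))
           d p mp (∣ᴾ-*ʳ h ∣ᴾ-refl)
  ... | (_ , L , _ , IL , gen) with quotient (gen p (∣ᴾ-*ʳ h ∣ᴾ-refl))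
  ...   | (q , qL≋p) with RawSemiringDefs.Irreducible.split-∣1 irr (at (≋-sym qL≋p))
  ...     | inj₂ L∣1 = inj₂ (∣ᴾ-respʳ (*ᴾ-identityˡ h)
              (let (t , tL≋1) = quotient L∣1 in
               ∣ᴾ-respʳ (≋-trans (≋-sym (*ᴾ-assoc t L h)) (*ᴾ-congʳ h tL≋1)) (∣ᴾ-*ˡ t IL)))
  ...     | inj₁ q∣1 = inj₁ (∣ᴾ-trans
              (let (t , tq≋1) = quotient q∣1 in
               divisor t (≋-trans (*ᴾ-congˡ t (≋-sym qL≋p))
                 (≋-trans (≋-sym (*ᴾ-assoc t q L)) (≋-trans (*ᴾ-congʳ L tq≋1) (*ᴾ-identityˡ L)))))
              (gen g p∣gh))

  -- Induction on `k`: primality gives `p ∣ h`, and one factor `p` cancels from both sides.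
  prime-power-∣ : ∀ {d p} → MonicOfDegree d p → Irreducible p →
    ∀ {u} → ¬ p ∣ᴾ u → ∀ k h → p ^ᴾ k ∣ᴾ h *ᴾ u → p ^ᴾ k ∣ᴾ h
  prime-power-∣         mp irr     p∤u zero    h _ = divisor h (PR.*-identityʳ h)
  prime-power-∣ {p = p} mp irr {u} p∤u (suc k) h d
    with irreducible⇒prime mp irr h u (∣ᴾ-trans (divisor (p ^ᴾ k) (*ᴾ-comm (p ^ᴾ k) p)) d)
  ... | inj₂ p∣u = contradiction p∣u p∤u
  ... | inj₁ p∣h = let (t , tp≋h) = quotient p∣h in
    ∣ᴾ-respˡ (*ᴾ-comm (p ^ᴾ k) p) (∣ᴾ-respʳ tp≋h (∣ᴾ-* (prime-power-∣ mp irr p∤u k t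
      (∣ᴾ-cancelʳ p mp (∣ᴾ-respˡ (*ᴾ-comm p (p ^ᴾ k)) (∣ᴾ-respʳ
        (≋-trans (*ᴾ-congʳ u (≋-sym tp≋h))
          (solve 3 (λ t p u → (t :* p) :* u := (t :* u) :* p) ≋-refl t p u)) d)))) (∣ᴾ-refl {p})))

  -- The product will do; it serves only as the first member in the search made by `lcm`.
  common-multiple : ∀ {r} (g : Fin r → Poly) → (∀ s → Monic (g s)) →
    ∃[ h ] Monic h × (∀ s → g s ∣ᴾ h)
  common-multiple {zero}  g mg = 1# ∷ [] , (0 , monic-1) , λ ()
  common-multiple {suc r} g mg = let (h , (n , mh) , d) = common-multiple (g ∘ suc) (mg ∘ suc) in
    g zero *ᴾ h , (_ , monic-* (g zero) h (proj₂ (mg zero)) mh) ,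
    λ { zero → ∣ᴾ-*ʳ h ∣ᴾ-refl ; (suc s) → ∣ᴾ-*ˡ (g zero) (d s) }

  lcm : ∀ {r} (g : Fin r → Poly) → (∀ s → Monic (g s)) → ∃[ L ] IsLcm g L
  lcm g mg =
    let (h , (n , mh) , d) = common-multiple g mg
        (_ , L , mL , IL , gen) = Ideal.generator (λ f → ∀ s → g s ∣ᴾ f)
          (λ e i s → ∣ᴾ-respʳ e (i s))
          (λ i i' s → ∣ᴾ-+ (i s) (i' s))
          (λ q i s → ∣ᴾ-*ˡ q (i s))
          (λ f → Fin.all? λ s → proj₂ (mg s) ∣ᴾ? f)
          n h mh d
    in L , record { monic = _ , mL ; multiple = IL ; least = gen }

  coeff-*-0 : ∀ g h → coeff (g *ᴾ h) 0 ≈ coeff g 0 * coeff h 0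
  coeff-*-0 []      h = sym (zeroˡ _)
  coeff-*-0 (x ∷ g) h = trans (coeff-+ (x · h) (0# ∷ g *ᴾ h) 0)
    (trans (+-identityʳ _) (coeff-· x h 0))

  -- One positive exponent `N` suffices: it bounds the search for the least one, and since `x^N - 1`
  -- has constant term `-1`, its divisor `L` cannot vanish at `0`.
  order : ∀ {L} → Monic L → ∀ N → 1 ≤ N → L ∣ᴾ X^n-1 N → ∃[ o ] IsOrder L o
  order {L} (_ , mL) (suc N) 1≤N d =
    let (o , (1≤o , L∣) , least) = least-witness (λ n → (1 ℕ.≤? n) ×-dec (mL ∣ᴾ? X^n-1 n))
                                     (suc N) (1≤N , d)
    in o , record
      { P[0]≉0 = λ e → let (q , qL≋) = quotient d in 1≉0 (begin
          1#              ≈⟨ RP.-‿involutive 1# ⟨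
          - (- 1#)        ≈⟨ -‿cong (+-identityˡ (- 1#)) ⟨
          - (0# + - 1#)   ≈⟨ -‿cong (at qL≋ 0) ⟨
          - coeff (q *ᴾ L) 0 ≈⟨ -‿cong (trans (coeff-*-0 q L) (trans (*-congˡ e) (zeroʳ _))) ⟩
          - 0#            ≈⟨ RP.-0#≈0# ⟩
          0#              ∎)
      ; positive = 1≤o ; divides = L∣ ; least = λ j 1≤j L∣j → least j (1≤j , L∣j) }
    where
    module RP = RingProperties ring
    open SetoidReasoning setoid

-- A linear map as an action of `R[x]`, and the cyclic module of a companion block.

module _ {c ℓ} (M : CommutativeMonoid c ℓ) where
  open CommutativeMonoid M
  open MonoidSum M using (sum; sum-cong-≋; sum-replicate-zero)

  sum-zero : ∀ {n} (f : Vector Carrier n) → (∀ i → f i ≈ ε) → sum f ≈ ε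
  sum-zero {n} f e = trans (sum-cong-≋ e) (sum-replicate-zero n)

  sum-single : ∀ {n} (f : Vector Carrier n) i → (∀ j → j ≢ i → f j ≈ ε) → sum f ≈ f i
  sum-single f zero    e = trans (∙-congˡ (sum-zero (f ∘ suc) λ j → e (suc j) λ ())) (identityʳ _)
  sum-single f (suc i) e = trans (∙-cong (e zero λ ())
    (sum-single (f ∘ suc) i λ j j≢i → e (suc j) (j≢i ∘ Fin.suc-injective))) (identityˡ _)

IsLinear : ∀ {c ℓ a b} {R : CommutativeRing c ℓ} (V : Module R a b) →
  (Module.Carrierᴹ V → Module.Carrierᴹ V) → Set _
IsLinear V = LeftSemimoduleMorphisms.IsLeftSemimoduleHomomorphism
  (Module.rawLeftSemimodule V) (Module.rawLeftSemimodule V)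

module LinearMap {c ℓ a b} {R : CommutativeRing c ℓ} (V : Module R a b)
  (φ : Module.Carrierᴹ V → Module.Carrierᴹ V)
  (φ-linear : IsLinear V φ) where
  open CommutativeRing R hiding (zero)
  open Polynomial R
  open PolynomialRing R
  open Module V
  open LinearAlgebra V φ
  open LeftSemimoduleMorphisms.IsLeftSemimoduleHomomorphism φ-linear
    renaming (⟦⟧-cong to φ-cong; +ᴹ-homo to φ-+; 0ᴹ-homo to φ-0; *ₗ-homo to φ-*ₗ)
  open MonoidSum +ᴹ-commutativeMonoid using (sum; sum-cong-≋; ∑-distrib-+)
  private
    module ≈M = SetoidReasoning ≈ᴹ-setoid
    module CS = CommSemigroup (CommutativeMonoid.commutativeSemigroup +ᴹ-commutativeMonoid)

  act-congʳ : ∀ g {D E} → D ≈ᴹ E → act g D ≈ᴹ act g E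
  act-congʳ []      e = ≈ᴹ-refl
  act-congʳ (x ∷ g) e = +ᴹ-cong (*ₗ-congˡ e) (φ-cong (act-congʳ g e))

  act-zero : ∀ {g} D → g ≋ [] → act g D ≈ᴹ 0ᴹ
  act-zero {[]}    D e = ≈ᴹ-refl
  act-zero {x ∷ g} D e = let (x≈0 , g≋[]) = ∷-zero⁻¹ e in
    ≈ᴹ-trans (+ᴹ-cong (≈ᴹ-trans (*ₗ-congʳ x≈0) (*ₗ-zeroˡ D))
                      (≈ᴹ-trans (φ-cong (act-zero D g≋[])) φ-0))
             (+ᴹ-identityˡ 0ᴹ)

  act-cong : ∀ {g h} D → g ≋ h → act g D ≈ᴹ act h D
  act-cong {[]}    {h}     D e = ≈ᴹ-sym (act-zero D (≋-sym e))
  act-cong {x ∷ g} {[]}    D e = act-zero {x ∷ g} D e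
  act-cong {x ∷ g} {y ∷ h} D e = let (x≈y , g≋h) = ∷-injective e in
    +ᴹ-cong (*ₗ-congʳ x≈y) (φ-cong (act-cong D g≋h))

  act-+ : ∀ g h D → act (g +ᴾ h) D ≈ᴹ act g D +ᴹ act h D
  act-+ []      h       D = ≈ᴹ-sym (+ᴹ-identityˡ _)
  act-+ (x ∷ g) []      D = ≈ᴹ-sym (+ᴹ-identityʳ _)
  act-+ (x ∷ g) (y ∷ h) D = ≈ᴹ-trans
    (+ᴹ-cong (*ₗ-distribʳ D x y) (≈ᴹ-trans (φ-cong (act-+ g h D)) (φ-+ _ _)))
    (CS.interchange _ _ _ _)

  act-· : ∀ x g D → act (x · g) D ≈ᴹ x *ₗ act g D
  act-· x []      D = ≈ᴹ-sym (*ₗ-zeroʳ x)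
  act-· x (y ∷ g) D = ≈ᴹ-trans
    (+ᴹ-cong (*ₗ-assoc x y D) (≈ᴹ-trans (φ-cong (act-· x g D)) (φ-*ₗ x _)))
    (≈ᴹ-sym (*ₗ-distribˡ x _ _))

  act-* : ∀ g h D → act (g *ᴾ h) D ≈ᴹ act g (act h D)
  act-* []      h D = ≈ᴹ-refl
  act-* (x ∷ g) h D = ≈ᴹ-trans (act-+ (x · h) (0# ∷ g *ᴾ h) D)
    (+ᴹ-cong (act-· x h D)
      (≈ᴹ-trans (+ᴹ-cong (*ₗ-zeroˡ D) (φ-cong (act-* g h D))) (+ᴹ-identityˡ _)))

  act-1 : ∀ D → act (1# ∷ []) D ≈ᴹ D
  act-1 D = ≈ᴹ-trans (+ᴹ-cong (*ₗ-identityˡ D) φ-0) (+ᴹ-identityʳ D)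

  act-0ᴹ : ∀ g → act g 0ᴹ ≈ᴹ 0ᴹ
  act-0ᴹ []      = ≈ᴹ-refl
  act-0ᴹ (x ∷ g) = ≈ᴹ-trans (+ᴹ-cong (*ₗ-zeroʳ x) (≈ᴹ-trans (φ-cong (act-0ᴹ g)) φ-0))
                            (+ᴹ-identityˡ 0ᴹ)

  act-+ᴹ : ∀ g D E → act g (D +ᴹ E) ≈ᴹ act g D +ᴹ act g E
  act-+ᴹ []      D E = ≈ᴹ-sym (+ᴹ-identityˡ 0ᴹ)
  act-+ᴹ (x ∷ g) D E = ≈ᴹ-trans
    (+ᴹ-cong (*ₗ-distribˡ x D E) (≈ᴹ-trans (φ-cong (act-+ᴹ g D E)) (φ-+ _ _)))
    (CS.interchange _ _ _ _)

  act-sum : ∀ g {n} (f : Vector Carrierᴹ n) → act g (sum f) ≈ᴹ sum (act g ∘ f)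
  act-sum g {zero}  f = act-0ᴹ g
  act-sum g {suc n} f = ≈ᴹ-trans (act-+ᴹ g _ _) (+ᴹ-congˡ (act-sum g (f ∘ suc)))

  act-negate : ∀ g D → act g D +ᴹ act (negate g) D ≈ᴹ 0ᴹ
  act-negate g D = ≈ᴹ-trans (≈ᴹ-sym (act-+ g (negate g) D)) (act-zero D (+ᴾ-inverseʳ g))

  φ^ : ℕ → Carrierᴹ → Carrierᴹ
  φ^ zero    D = D
  φ^ (suc n) D = φ (φ^ n D)

  φ^-cong : ∀ n {D E} → D ≈ᴹ E → φ^ n D ≈ᴹ φ^ n E
  φ^-cong zero    e = e
  φ^-cong (suc n) e = φ-cong (φ^-cong n e)

  φ^-+ : ∀ m n D → φ^ (m ℕ.+ n) D ≡ φ^ m (φ^ n D)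
  φ^-+ zero    n D = ≡.refl
  φ^-+ (suc m) n D = ≡.cong φ (φ^-+ m n D)

  φ^-fixed-* : ∀ k {n D} → φ^ n D ≈ᴹ D → φ^ (k ℕ.* n) D ≈ᴹ D
  φ^-fixed-* zero            e = ≈ᴹ-refl
  φ^-fixed-* (suc k) {n} {D} e = ≈ᴹ-trans (≈ᴹ-reflexive (φ^-+ n (k ℕ.* n) D))
    (≈ᴹ-trans (φ^-cong n (φ^-fixed-* k e)) e)

  act-X^ : ∀ n D → act (X^ n) D ≈ᴹ φ^ n D
  act-X^ zero    D = act-1 D
  act-X^ (suc n) D = ≈ᴹ-trans (+ᴹ-cong (*ₗ-zeroˡ D) (φ-cong (act-X^ n D))) (+ᴹ-identityˡ _)

  act-X^n-1 : ∀ n D → act (X^n-1 n) D +ᴹ D ≈ᴹ φ^ n D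
  act-X^n-1 n D = begin
    act (X^n-1 n) D +ᴹ D                        ≈⟨ +ᴹ-cong (act-+ (X^ n) (- 1# ∷ []) D) (≈ᴹ-sym (act-1 D)) ⟩
    act (X^ n) D +ᴹ act (- 1# ∷ []) D +ᴹ act (1# ∷ []) D ≈⟨ +ᴹ-assoc _ _ _ ⟩
    act (X^ n) D +ᴹ (act (- 1# ∷ []) D +ᴹ act (1# ∷ []) D)
      ≈⟨ +ᴹ-cong (act-X^ n D) (≈ᴹ-trans (+ᴹ-comm _ _) (act-negate (1# ∷ []) D)) ⟩
    φ^ n D +ᴹ 0ᴹ                                ≈⟨ +ᴹ-identityʳ _ ⟩
    φ^ n D                                      ∎
    where open ≈M

  fixed⇒annihilated : ∀ n {D} → φ^ n D ≈ᴹ D → act (X^n-1 n) D ≈ᴹ 0ᴹ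
  fixed⇒annihilated n {D} e = GroupProperties.identityˡ-unique +ᴹ-group _ D
    (≈ᴹ-trans (act-X^n-1 n D) e)

  annihilated⇒fixed : ∀ n {D} → act (X^n-1 n) D ≈ᴹ 0ᴹ → φ^ n D ≈ᴹ D
  annihilated⇒fixed n {D} e = ≈ᴹ-trans (≈ᴹ-sym (act-X^n-1 n D))
    (≈ᴹ-trans (+ᴹ-congʳ e) (+ᴹ-identityˡ D))

  annihilates-multiple : ∀ g {D} → act g D ≈ᴹ 0ᴹ → ∀ {h} → g ∣ᴾ h → act h D ≈ᴹ 0ᴹ
  annihilates-multiple g {D} e {h} (q RawMagmaDefs., eq) = ≈ᴹ-trans
    (act-cong {h} {q *ᴾ g} D (≋-sym (coefficientwise eq)))
    (≈ᴹ-trans (act-* q g D) (≈ᴹ-trans (act-congʳ q e) (act-0ᴹ q)))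

  -- The product of the individual periods is a common period.
  torsion-family : (∀ D → ∃[ N ] 1 ≤ N × φ^ N D ≈ᴹ D) →
    ∀ {r} (D : Vector Carrierᴹ r) → ∃[ N ] 1 ≤ N × (∀ s → φ^ N (D s) ≈ᴹ D s)
  torsion-family torsion {zero}  D = 1 , s≤s z≤n , λ ()
  torsion-family torsion {suc r} D =
    let (N , 1≤N , e) = torsion (D zero) ; (N' , 1≤N' , e') = torsion-family torsion (D ∘ suc) in
    N' ℕ.* N , ℕ.*-mono-≤ 1≤N' 1≤N , λ where
      zero    → φ^-fixed-* N' e
      (suc s) → ≡.subst (λ n → φ^ n (D (suc s)) ≈ᴹ D (suc s)) (ℕ.*-comm N N') (φ^-fixed-* N (e' s))

  combination : ∀ {n} → Vector Carrier n → Vector Carrierᴹ n → Carrierᴹ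
  combination x u = sum (λ t → x t *ₗ u t)

  combination-zero : ∀ {n} {x : Vector Carrier n} u → (∀ t → x t ≈ 0#) → combination x u ≈ᴹ 0ᴹ
  combination-zero u e = sum-zero +ᴹ-commutativeMonoid _ λ t →
    ≈ᴹ-trans (*ₗ-congʳ (e t)) (*ₗ-zeroˡ _)

  coeff-drop : ∀ k g i → coeff (List.drop k g) i ≈ coeff g (k ℕ.+ i)
  coeff-drop zero    g       i = refl
  coeff-drop (suc k) []      i = refl
  coeff-drop (suc k) (x ∷ g) i = coeff-drop k g i

  -- `List.drop k g` is the polynomial part of `g / x^k`, so this is one step of Horner's scheme.
  drop-∷ : ∀ k g → coeff g k ∷ List.drop (suc k) g ≋ List.drop k g
  drop-∷ zero    []      = ∷-zero refl ≋-refl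
  drop-∷ zero    (x ∷ g) = ≋-refl
  drop-∷ (suc k) []      = ∷-zero refl ≋-refl
  drop-∷ (suc k) (x ∷ g) = drop-∷ k g

  -- The 1's of a companion matrix are on its superdiagonal and its columns are
  -- the images of the basis, so φ lowers the index and the last vector is cyclic.
  cyclicVector : ∀ {n} → Vector Carrierᴹ n → Carrierᴹ
  cyclicVector {zero}  u = 0ᴹ
  cyclicVector {suc n} u = u (fromℕ n)

  module Companion (A : Poly) where
    private
      companion-last : ∀ {n} t → companion A (fromℕ n) t ≡ - coeff A (toℕ t)
      companion-last {n} t with suc (toℕ (fromℕ n)) ℕ.<? suc n
      ... | no  _   = ≡.refl
      ... | yes s<n = ⊥-elim (ℕ.<-irrefl (≡.cong suc (Fin.toℕ-fromℕ n)) s<n)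

      companion-init-suc : ∀ {n} (i : Fin n) → companion A (inject₁ i) (suc i) ≡ 1#
      companion-init-suc {n} i with suc (toℕ (inject₁ i)) ℕ.<? suc n
      ... | no  ≮ = ⊥-elim (≮ (s≤s (≡.subst (_< n) (≡.sym (Fin.toℕ-inject₁ i)) (Fin.toℕ<n i))))
      ... | yes _ with toℕ (suc i) ℕ.≟ suc (toℕ (inject₁ i))
      ...   | yes _ = ≡.refl
      ...   | no  ≢ = ⊥-elim (≢ (≡.cong suc (≡.sym (Fin.toℕ-inject₁ i))))

      companion-init-≢ : ∀ {n} (i : Fin n) t → t ≢ suc i → companion A (inject₁ i) t ≡ 0#
      companion-init-≢ {n} i t t≢ with suc (toℕ (inject₁ i)) ℕ.<? suc n
      ... | no  ≮ = ⊥-elim (≮ (s≤s (≡.subst (_< n) (≡.sym (Fin.toℕ-inject₁ i)) (Fin.toℕ<n i))))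
      ... | yes _ with toℕ t ℕ.≟ suc (toℕ (inject₁ i))
      ...   | yes e = ⊥-elim (t≢ (Fin.toℕ-injective (≡.trans e (≡.cong suc (Fin.toℕ-inject₁ i)))))
      ...   | no  _ = ≡.refl

    CompanionBasis : ∀ {n} → Vector Carrierᴹ n → Set b
    CompanionBasis u = ∀ t → φ (u t) ≈ᴹ combination (λ s → companion A s t) u

    private
      -- The last row of the companion matrix contributes `- a_t` times the cyclic vector. Moved to
      -- the other side, it leaves the rows that hold a single `1`.
      φ-split : ∀ {n} (u : Vector Carrierᴹ (suc n)) → CompanionBasis u → ∀ t →
        coeff A (toℕ t) *ₗ cyclicVector u +ᴹ φ (u t) ≈ᴹ
        sum (λ i → companion A (inject₁ i) t *ₗ u (inject₁ i))
      φ-split {n} u cb t = begin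
        α *ₗ w +ᴹ φ (u t)                ≈⟨ +ᴹ-congˡ (cb t) ⟩
        α *ₗ w +ᴹ combination (λ s → companion A s t) u
          ≈⟨ +ᴹ-congˡ (sum-init-last (λ s → companion A s t *ₗ u s)) ⟩
        α *ₗ w +ᴹ (S +ᴹ companion A (fromℕ n) t *ₗ w) ≈⟨ +ᴹ-congˡ (+ᴹ-comm _ _) ⟩
        α *ₗ w +ᴹ (companion A (fromℕ n) t *ₗ w +ᴹ S) ≈⟨ +ᴹ-assoc _ _ _ ⟨
        α *ₗ w +ᴹ companion A (fromℕ n) t *ₗ w +ᴹ S
          ≈⟨ +ᴹ-congʳ (+ᴹ-congˡ (*ₗ-congʳ (reflexive (companion-last t)))) ⟩
        α *ₗ w +ᴹ (- α) *ₗ w +ᴹ S        ≈⟨ +ᴹ-congʳ (*ₗ-distribʳ w α (- α)) ⟨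
        (α - α) *ₗ w +ᴹ S                ≈⟨ +ᴹ-congʳ (≈ᴹ-trans (*ₗ-congʳ (-‿inverseʳ α)) (*ₗ-zeroˡ w)) ⟩
        0ᴹ +ᴹ S                          ≈⟨ +ᴹ-identityˡ S ⟩
        S                                ∎
        where
        open ≈M
        open MonoidSum +ᴹ-commutativeMonoid using (sum-init-last)
        α : Carrier
        α = coeff A (toℕ t)
        w S : Carrierᴹ
        w = cyclicVector u
        S = sum (λ i → companion A (inject₁ i) t *ₗ u (inject₁ i))

    -- Column `i + 1` of the companion matrix reads `u_i = a_{i+1} w + φ(u_{i+1})`. Started from `w`
    -- at the last index, this is Horner's scheme for `A`, whose intermediate polynomials are the
    -- truncations of `A`.
    cyclic : ∀ {n} → MonicOfDegree n A → (u : Vector Carrierᴹ n) → CompanionBasis u →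
      ∀ t → u t ≈ᴹ act (List.drop (suc (toℕ t)) A) (cyclicVector u)
    cyclic {suc n} (lead , below) u cb = >-weakInduction _ base step
      where
      open ≈M
      w : Carrierᴹ
      w = cyclicVector u
      base : w ≈ᴹ act (List.drop (suc (toℕ (fromℕ n))) A) w
      base rewrite Fin.toℕ-fromℕ n = ≈ᴹ-sym (≈ᴹ-trans
        (act-cong {List.drop (suc n) A} {1# ∷ []} w (coefficientwise λ where
          zero    → trans (coeff-drop (suc n) A 0) (trans (reflexive (≡.cong (coeff A) (ℕ.+-identityʳ (suc n)))) lead)
          (suc i) → trans (coeff-drop (suc n) A (suc i)) (below _ (ℕ.m<m+n (suc n) (s≤s z≤n)))))
        (act-1 w))
      step : ∀ i → u (suc i) ≈ᴹ act (List.drop (suc (suc (toℕ i))) A) w →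
             u (inject₁ i) ≈ᴹ act (List.drop (suc (toℕ (inject₁ i))) A) w
      step i e rewrite Fin.toℕ-inject₁ i = begin
        u (inject₁ i)                    ≈⟨ *ₗ-identityˡ _ ⟨
        1# *ₗ u (inject₁ i)              ≈⟨ *ₗ-congʳ (reflexive (companion-init-suc i)) ⟨
        companion A (inject₁ i) (suc i) *ₗ u (inject₁ i)
          ≈⟨ sum-single +ᴹ-commutativeMonoid _ i (λ j j≢i → ≈ᴹ-trans
               (*ₗ-congʳ (reflexive (companion-init-≢ j (suc i) (λ e → j≢i (Fin.suc-injective (≡.sym e))))))
               (*ₗ-zeroˡ _)) ⟨
        sum (λ j → companion A (inject₁ j) (suc i) *ₗ u (inject₁ j)) ≈⟨ φ-split u cb (suc i) ⟨
        coeff A (suc (toℕ i)) *ₗ w +ᴹ φ (u (suc i)) ≈⟨ +ᴹ-congˡ (φ-cong e) ⟩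
        act (coeff A (suc (toℕ i)) ∷ List.drop (suc (suc (toℕ i))) A) w
          ≈⟨ act-cong w (drop-∷ (suc (toℕ i)) A) ⟩
        act (List.drop (suc (toℕ i)) A) w ∎

    -- Column `0` has no superdiagonal `1`, so Horner's scheme ends with `a_0 w + φ(u_0) = 0`, and
    -- the left side is `A(φ) w`.
    annihilates-cyclic : ∀ {n} → MonicOfDegree n A → (u : Vector Carrierᴹ n) → CompanionBasis u →
      act A (cyclicVector u) ≈ᴹ 0ᴹ
    -- An exponent `e i j = 0` gives an empty block, whose generator is `0ᴹ`.
    annihilates-cyclic {zero}  mA u cb = act-0ᴹ A
    annihilates-cyclic {suc n} mA u cb = begin
      act A w                            ≈⟨ act-cong w (drop-∷ 0 A) ⟨
      coeff A 0 *ₗ w +ᴹ φ (act (List.drop 1 A) w) ≈⟨ +ᴹ-congˡ (φ-cong (cyclic mA u cb zero)) ⟨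
      coeff A 0 *ₗ w +ᴹ φ (u zero)       ≈⟨ φ-split u cb zero ⟩
      sum (λ j → companion A (inject₁ j) zero *ₗ u (inject₁ j))
        ≈⟨ sum-zero +ᴹ-commutativeMonoid _ (λ j → ≈ᴹ-trans
             (*ₗ-congʳ (reflexive (companion-init-≢ j zero λ ()))) (*ₗ-zeroˡ (u (inject₁ j)))) ⟩
      0ᴹ                                 ∎
      where
      open ≈M
      w : Carrierᴹ
      w = cyclicVector u

  module _ (isField : IsDiscreteField R) where
    open FieldPolynomials isField
    private
      module PSum = MonoidSum PR.+-commutativeMonoid

    -- The truncations of A have degrees n - 1, …, 0, so they are a unitriangular
    -- basis of the polynomials of degree < n.
    module Truncations {n} (A : Poly) (mA : MonicOfDegree n A) where
      truncation : Vector Poly n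
      truncation t = List.drop (suc (toℕ t)) A

      expand : Vector Carrier n → Poly
      expand x = PSum.sum (λ t → x t · truncation t)

      expand-zero : ∀ x → (∀ t → x t ≈ 0#) → expand x ≋ []
      expand-zero x e = sum-zero PR.+-commutativeMonoid _ λ t → ·-zeroˡ (truncation t) (e t)

      private
        monic-truncation : ∀ m (t : Fin n) → toℕ t ℕ.+ suc m ≡ n → MonicOfDegree m (truncation t)
        monic-truncation m t e =
          trans (coeff-drop (suc (toℕ t)) A m)
            (trans (reflexive (≡.cong (coeff A) t+m≡n)) (proj₁ mA)) ,
          λ i m<i → trans (coeff-drop (suc (toℕ t)) A i) (proj₂ mA _
            (≡.subst (_< suc (toℕ t) ℕ.+ i) t+m≡n (ℕ.+-monoʳ-< (suc (toℕ t)) m<i)))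
          where
          t+m≡n : suc (toℕ t) ℕ.+ m ≡ n
          t+m≡n = ≡.trans (≡.sym (ℕ.+-suc (toℕ t) m)) e

        δ : Carrier → Fin n → Vector Carrier n
        δ x t s with s Fin.≟ t
        ... | yes _ = x
        ... | no  _ = 0#

        expand-δ : ∀ x t → expand (δ x t) ≋ x · truncation t
        expand-δ x t = ≋-trans
          (sum-single PR.+-commutativeMonoid _ t λ s s≢t → ·-zeroˡ (truncation s) (δ-≢ s s≢t))
          (·-cong δ-≡ ≋-refl)
          where
          δ-≢ : ∀ s → s ≢ t → δ x t s ≈ 0#
          δ-≢ s s≢t with s Fin.≟ t
          ... | yes s≡t = contradiction s≡t s≢t
          ... | no  _   = refl
          δ-≡ : δ x t t ≈ x
          δ-≡ with t Fin.≟ t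
          ... | yes _   = refl
          ... | no  t≢t = contradiction ≡.refl t≢t

        expand-+ : ∀ x y → expand (λ t → x t + y t) ≋ expand x +ᴾ expand y
        expand-+ x y = ≋-trans
          (PSum.sum-cong-≋ λ t → ·-distribʳ (truncation t) (x t) (y t))
          (PSum.∑-distrib-+ (λ t → x t · truncation t) (λ t → y t · truncation t))

        expand-below : ∀ m → m ≤ n → ∀ h → Below m h → ∃[ x ] h ≋ expand x
        expand-below zero    _   h b =
          (λ _ → 0#) , ≋-trans (below-0 h b) (≋-sym (expand-zero _ λ _ → refl))
        expand-below (suc m) m<n h b =
          let (x , e) = expand-below m (ℕ.<⇒≤ m<n) h' (below-pred h'
                          (below-+ h (negate (y · g)) b (below-negate (y · g) (below-· y g (proj₂ mg))))
                          (trans (coeff-+ h (negate (y · g)) m)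
                          (trans (+-congˡ (trans (coeff-negate (y · g) m) (-‿cong
                            (trans (coeff-· y g m) (trans (*-congˡ (proj₁ mg)) (*-identityʳ y))))))
                          (-‿inverseʳ y))))
          in (λ s → x s + δ y t s) , (begin
            h                                       ≈⟨ PR.+-identityʳ h ⟨
            h +ᴾ []                                 ≈⟨ PR.+-congˡ (PR.-‿inverseˡ (y · g)) ⟨
            h +ᴾ (negate (y · g) +ᴾ y · g)          ≈⟨ +ᴾ-assoc h (negate (y · g)) (y · g) ⟨
            h' +ᴾ y · g                             ≈⟨ +ᴾ-cong e (≋-sym (expand-δ y t)) ⟩
            expand x +ᴾ expand (δ y t)              ≈⟨ expand-+ x (δ y t) ⟨
            expand (λ s → x s + δ y t s)            ∎)
          where
          open SetoidReasoning PR.setoid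
          -- The index `n - 1 - m`, at which the truncation has degree `m`.
          t : Fin n
          t = Fin.fromℕ< (ℕ.∸-monoʳ-< {o = 0} (s≤s z≤n) m<n)
          y : Carrier
          y = coeff h m
          g h' : Poly
          g  = truncation t
          h' = h +ᴾ negate (y · g)
          mg : MonicOfDegree m g
          mg = monic-truncation m t (≡.trans
            (≡.cong (ℕ._+ suc m) (Fin.toℕ-fromℕ< _)) (ℕ.m∸n+n≡m m<n))

      expand-surjective : ∀ h → Below n h → ∃[ x ] h ≋ expand x
      expand-surjective = expand-below n ℕ.≤-refl

    module CyclicBlock {n} (A : Poly) (mA : MonicOfDegree n A)
      (u : Vector Carrierᴹ n) (cb : Companion.CompanionBasis A u) where
      open Truncations A mA

      private
        w : Carrierᴹ
        w = cyclicVector u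

        act-PSum : ∀ {m} (f : Vector Poly m) D → act (PSum.sum f) D ≈ᴹ sum (λ i → act (f i) D)
        act-PSum {zero}  f D = ≈ᴹ-refl
        act-PSum {suc m} f D = ≈ᴹ-trans (act-+ (f zero) _ D) (+ᴹ-congˡ (act-PSum (f ∘ suc) D))

      combination≈act : ∀ x → combination x u ≈ᴹ act (expand x) w
      combination≈act x = ≈ᴹ-trans
        (sum-cong-≋ λ t → ≈ᴹ-trans (*ₗ-congˡ (Companion.cyclic A mA u cb t))
                                   (≈ᴹ-sym (act-· (x t) (truncation t) w)))
        (≈ᴹ-sym (act-PSum (λ t → x t · truncation t) w))

      -- `A` kills `w`, so `h` may be replaced by its remainder modulo `A`, which is expanded in the
      -- truncations. The last clause is what turns linear independence of the basis into
      -- divisibility by `A`.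
      coordinates : ∀ h → ∃[ x ] act h w ≈ᴹ combination x u × ((∀ t → x t ≈ 0#) → A ∣ᴾ h)
      coordinates h =
        let (q , r , e , b) = divMod h A mA
            (x , r≋)        = expand-surjective r b
        in x ,
           (begin
             act h w                   ≈⟨ act-cong w e ⟩
             act (q *ᴾ A +ᴾ r) w       ≈⟨ act-+ (q *ᴾ A) r w ⟩
             act (q *ᴾ A) w +ᴹ act r w
               ≈⟨ +ᴹ-congʳ (annihilates-multiple A (Companion.annihilates-cyclic A mA u cb)
                    (divisor {A} q ≋-refl)) ⟩
             0ᴹ +ᴹ act r w             ≈⟨ +ᴹ-identityˡ _ ⟩
             act r w                   ≈⟨ act-cong w r≋ ⟩
             act (expand x) w          ≈⟨ combination≈act x ⟨
             combination x u           ∎) ,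
           (λ x≈0 → divisor q (≋-sym (≋-trans e (≋-trans
             (PR.+-congˡ (≋-trans r≋ (expand-zero x x≈0))) (+ᴾ-identityʳ _)))))
        where open ≈M

-- Enumerations: bijections, omission of one code, tuples.

module _ {a ℓ} {S : Setoid a ℓ} {n : ℕ} where
  open Setoid S

  enumeration⇒Inverse : (f : Fin n → Carrier) → (∀ {i j} → f i ≈ f j → i ≡ j) →
    (∀ x → ∃[ i ] f i ≈ x) → Inverse (≡.setoid (Fin n)) S
  enumeration⇒Inverse f f-inj f-surj = record
    { to        = f
    ; from      = λ x → proj₁ (f-surj x)
    ; to-cong   = λ { ≡.refl → refl }
    ; from-cong = λ {x} {y} x≈y → f-inj (trans (proj₂ (f-surj x)) (trans x≈y (sym (proj₂ (f-surj y)))))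
    ; inverse   = (λ { {x} ≡.refl → proj₂ (f-surj x) })
                , (λ {i} {x} x≈fi → f-inj (trans (proj₂ (f-surj x)) x≈fi)) }

-- `punchIn` for a size of the form `n ∸ 1`, the form in which `l ^ d ∸ 1` enters the count.
skip : ∀ {n} → Fin n → Fin (n ℕ.∸ 1) → Fin n
skip {suc n} z = punchIn z

skip-injective : ∀ {n} (z : Fin n) {i j} → skip z i ≡ skip z j → i ≡ j
skip-injective {suc n} z {i} {j} = Fin.punchIn-injective z i j

skip-≢ : ∀ {n} (z : Fin n) i → skip z i ≢ z
skip-≢ {suc n} z i = Fin.punchInᵢ≢i z i

skip-surjective : ∀ {n} (z j : Fin n) → j ≢ z → ∃[ i ] skip z i ≡ j
skip-surjective {suc n} z j j≢z =
  punchOut (j≢z ∘ ≡.sym) , Fin.punchIn-punchOut (j≢z ∘ ≡.sym)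

-- Mixed radix digits, the radices being the counts of the single blocks.
tuple : ∀ {r} (f : Fin r → ℕ) → Fin (product +-*-rawSemiring f) → ∀ s → Fin (f s)
tuple {suc r} f i zero    = proj₁ (remQuot (product +-*-rawSemiring (f ∘ suc)) i)
tuple {suc r} f i (suc s) = tuple (f ∘ suc) (proj₂ (remQuot {f zero} (product +-*-rawSemiring (f ∘ suc)) i)) s

tuple-injective : ∀ {r} (f : Fin r → ℕ) {i j} → (∀ s → tuple f i s ≡ tuple f j s) → i ≡ j
tuple-injective {zero}  f {zero} {zero} e = ≡.refl
tuple-injective {suc r} f {i} {j} e = begin
  i                                              ≡⟨ Fin.combine-remQuot {f zero} (product +-*-rawSemiring (f ∘ suc)) i ⟨
  uncurry combine (remQuot {f zero} (product +-*-rawSemiring (f ∘ suc)) i)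
    ≡⟨ ≡.cong₂ combine (e zero) (tuple-injective (f ∘ suc) (e ∘ suc)) ⟩
  uncurry combine (remQuot {f zero} (product +-*-rawSemiring (f ∘ suc)) j)
    ≡⟨ Fin.combine-remQuot {f zero} (product +-*-rawSemiring (f ∘ suc)) j ⟩
  j                                              ∎
  where open ≡.≡-Reasoning

tuple-surjective : ∀ {r} (f : Fin r → ℕ) (t : ∀ s → Fin (f s)) → ∃[ i ] (∀ s → tuple f i s ≡ t s)
tuple-surjective {zero}  f t = zero , λ ()
tuple-surjective {suc r} f t =
  let (i , e) = tuple-surjective (f ∘ suc) (t ∘ suc)
      rq      = Fin.remQuot-combine (t zero) i
  in combine (t zero) i , λ where
    zero    → ≡.cong proj₁ rq
    (suc s) → ≡.trans (≡.cong (λ x → tuple (f ∘ suc) (proj₂ x) s) rq) (e s)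

-- Minimal polynomials, and the elements of a given level in a cyclic module.

module FiniteFieldLinearMap {c ℓ a b} {R : CommutativeRing c ℓ} {l : ℕ}
  (isFiniteField : IsFiniteField R l) (V : Module R a b)
  (φ : Module.Carrierᴹ V → Module.Carrierᴹ V)
  (φ-linear : IsLinear V φ) where
  open CommutativeRing R hiding (zero)
  open IsFiniteField isFiniteField
  open Polynomial R
  open PolynomialRing R
  open FieldPolynomials isDiscreteField
  open FiniteFieldPolynomials isFiniteField
  open Module V
  open LinearAlgebra V φ
  open LinearMap V φ φ-linear
  private
    module ≈M = SetoidReasoning ≈ᴹ-setoid
    module PP = RingProperties PR.ring
    module VG = GroupProperties +ᴹ-group

  -- Minimality is stated through degrees of monic annihilators only. The remainder of `h` modulo
  -- `g` also annihilates `D`; were it nonzero, making it monic would contradict the least degree.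
  minimal-∣ : ∀ {D g} → IsMinimalPolynomial D g → ∀ h → act h D ≈ᴹ 0ᴹ → g ∣ᴾ h
  minimal-∣ {D} {g} min h e with divMod h g (IsMinimalPolynomial.monic min)
  ... | (q , r , h≋ , below) = divides (normalise r)
    where
    open IsMinimalPolynomial min
    r-annihilates : act r D ≈ᴹ 0ᴹ
    r-annihilates = begin
      act r D                      ≈⟨ +ᴹ-identityˡ _ ⟨
      0ᴹ +ᴹ act r D                ≈⟨ +ᴹ-congʳ (annihilates-multiple g annihilates (divisor {g} q ≋-refl)) ⟨
      act (q *ᴾ g) D +ᴹ act r D    ≈⟨ act-+ (q *ᴾ g) r D ⟨
      act (q *ᴾ g +ᴾ r) D          ≈⟨ act-cong D h≋ ⟨
      act h D                      ≈⟨ e ⟩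
      0ᴹ                           ∎
      where open ≈M
    divides : r ≋ [] ⊎ (∃[ x ] x ≉ 0# × ∃[ m ] MonicOfDegree m (x · r)) → g ∣ᴾ h
    divides (inj₁ r≋[]) = divisor q (≋-sym (≋-trans h≋ (≋-trans (PR.+-congˡ r≋[]) (+ᴾ-identityʳ _))))
    divides (inj₂ (x , _ , m , mr)) = ⊥-elim (ℕ.<⇒≱ (monic-below⇒< x r mr below)
      (least m (x · r) mr (≈ᴹ-trans (act-· x r D)
        (≈ᴹ-trans (*ₗ-congˡ r-annihilates) (*ₗ-zeroʳ x)))))

  minimal-resp : ∀ {D E g} → D ≈ᴹ E → IsMinimalPolynomial D g → IsMinimalPolynomial E g
  minimal-resp {g = g} e min = record
    { degree = degree ; monic = monic
    ; annihilates = ≈ᴹ-trans (act-congʳ g (≈ᴹ-sym e)) annihilates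
    ; least = λ n h mh ann → least n h mh (≈ᴹ-trans (act-congʳ h e) ann) }
    where open IsMinimalPolynomial min

  minimal : ∀ {D g n} → MonicOfDegree n g → act g D ≈ᴹ 0ᴹ → (∀ h → act h D ≈ᴹ 0ᴹ → g ∣ᴾ h) →
    IsMinimalPolynomial D g
  minimal mg ann div = record
    { degree = _ ; monic = mg ; annihilates = ann
    ; least = λ n h mh e → degree-∣ᴾ mg mh (div h e) }

  act-difference : ∀ g h D → act g D ≈ᴹ act h D → act (g +ᴾ negate h) D ≈ᴹ 0ᴹ
  act-difference g h D e = ≈ᴹ-trans (act-+ g (negate h) D) (≈ᴹ-trans (+ᴹ-congʳ e) (act-negate h D))

  act-difference⁻¹ : ∀ g h D → act (g +ᴾ negate h) D ≈ᴹ 0ᴹ → act g D ≈ᴹ act h D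
  act-difference⁻¹ g h D e = VG.∙-cancelʳ (act (negate h) D) _ _
    (≈ᴹ-trans (≈ᴹ-sym (act-+ g (negate h) D)) (≈ᴹ-trans e (≈ᴹ-sym (act-negate h D))))

  -- In the cyclic module R[x]/(pᵉ) the elements with minimal polynomial pᵏ are
  -- the classes of pᵉ⁻ᵏ u with u prime to p, and u matters only modulo pᵏ.
  -- Such a u is p u₁ + u₀ with u₀ ≠ 0 of degree < d and u₁ of degree < d (k - 1).
  module PrimePowerLevel {d : ℕ} {p : Poly} (mp : MonicOfDegree d p) (irr : Irreducible p) (e : ℕ)
    (w : Carrierᴹ) (annihilates-w : act (p ^ᴾ e) w ≈ᴹ 0ᴹ)
    (annihilator-w : ∀ h → act h w ≈ᴹ 0ᴹ → p ^ᴾ e ∣ᴾ h)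
    (k : ℕ) (1≤k : 1 ≤ k) (k≤e : k ≤ e) where

    count : ℕ
    count = l ℕ.^ (d ℕ.* (k ℕ.∸ 1)) ℕ.* (l ℕ.^ d ℕ.∸ 1)

    private
      pᵉ⁻ᵏ pᵏ⁻¹ : Poly
      pᵉ⁻ᵏ = p ^ᴾ (e ℕ.∸ k)
      pᵏ⁻¹ = p ^ᴾ (k ℕ.∸ 1)

      pᵉ≋ : p ^ᴾ e ≋ p ^ᴾ k *ᴾ pᵉ⁻ᵏ
      pᵉ≋ = ≋-trans (PR.reflexive (≡.cong (p ^ᴾ_) (≡.sym (ℕ.m+[n∸m]≡n k≤e)))) (^ᴾ-+ p k (e ℕ.∸ k))

      pᵏ≋ : p ^ᴾ k ≋ pᵏ⁻¹ *ᴾ p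
      pᵏ≋ = ≋-trans (PR.reflexive (≡.cong (p ^ᴾ_) (≡.sym (ℕ.m+[n∸m]≡n 1≤k)))) (*ᴾ-comm p pᵏ⁻¹)

      dk≡ : d ℕ.* k ≡ d ℕ.+ d ℕ.* (k ℕ.∸ 1)
      dk≡ = ≡.trans (≡.cong (d ℕ.*_) (≡.sym (ℕ.m+[n∸m]≡n 1≤k))) (ℕ.*-suc d (k ℕ.∸ 1))

      -- A monic polynomial of degree `0` is the unit `1`.
      d>0 : 0 < d
      d>0 = ℕ.n≢0⇒n>0 λ { ≡.refl → RawSemiringDefs.Irreducible.p∤1 irr
        (divisor (1# ∷ []) (≋-trans (*ᴾ-identityˡ p) (coefficientwise λ
          { zero → proj₁ mp ; (suc i) → proj₂ mp (suc i) (s≤s z≤n) }))) }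

    level>0 : 0 < d ℕ.* k
    level>0 = ℕ.*-mono-≤ d>0 1≤k

    private
      act-≈0 : ∀ u → p ^ᴾ k ∣ᴾ u → act (u *ᴾ pᵉ⁻ᵏ) w ≈ᴹ 0ᴹ
      act-≈0 u d = annihilates-multiple (p ^ᴾ e) annihilates-w
        (∣ᴾ-respˡ (≋-sym pᵉ≋) (∣ᴾ-* d (∣ᴾ-refl {pᵉ⁻ᵏ})))

      act-≈0⁻¹ : ∀ u → act (u *ᴾ pᵉ⁻ᵏ) w ≈ᴹ 0ᴹ → p ^ᴾ k ∣ᴾ u
      act-≈0⁻¹ u eq = ∣ᴾ-cancelʳ pᵉ⁻ᵏ (monic-^ p mp (e ℕ.∸ k)) (∣ᴾ-respˡ pᵉ≋ (annihilator-w _ eq))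

      difference-*ᴾ : ∀ u u' → (u +ᴾ negate u') *ᴾ pᵉ⁻ᵏ ≋ u *ᴾ pᵉ⁻ᵏ +ᴾ negate (u' *ᴾ pᵉ⁻ᵏ)
      difference-*ᴾ u u' = ≋-trans (*ᴾ-distribʳ pᵉ⁻ᵏ u (negate u'))
        (PR.+-congˡ (PR.sym (PP.-‿distribˡ-* u' pᵉ⁻ᵏ)))

      act-≈ : ∀ u u' → p ^ᴾ k ∣ᴾ u +ᴾ negate u' → act (u *ᴾ pᵉ⁻ᵏ) w ≈ᴹ act (u' *ᴾ pᵉ⁻ᵏ) w
      act-≈ u u' d = act-difference⁻¹ (u *ᴾ pᵉ⁻ᵏ) (u' *ᴾ pᵉ⁻ᵏ) w
        (≈ᴹ-trans (act-cong w (≋-sym (difference-*ᴾ u u'))) (act-≈0 (u +ᴾ negate u') d))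

      act-≈⁻¹ : ∀ u u' → act (u *ᴾ pᵉ⁻ᵏ) w ≈ᴹ act (u' *ᴾ pᵉ⁻ᵏ) w → p ^ᴾ k ∣ᴾ u +ᴾ negate u'
      act-≈⁻¹ u u' eq = act-≈0⁻¹ (u +ᴾ negate u') (≈ᴹ-trans (act-cong w (difference-*ᴾ u u'))
        (act-difference (u *ᴾ pᵉ⁻ᵏ) (u' *ᴾ pᵉ⁻ᵏ) w eq))

      difference-digits : ∀ u₁ u₀ u₁' u₀' → (u₁ *ᴾ p +ᴾ u₀) +ᴾ negate (u₁' *ᴾ p +ᴾ u₀') ≋
        (u₁ +ᴾ negate u₁') *ᴾ p +ᴾ (u₀ +ᴾ negate u₀')
      difference-digits u₁ u₀ u₁' u₀' = begin
        (u₁ *ᴾ p +ᴾ u₀) +ᴾ negate (u₁' *ᴾ p +ᴾ u₀')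
          ≈⟨ PR.+-congˡ {u₁ *ᴾ p +ᴾ u₀} (≋-trans (≋-sym (PP.-‿+-comm (u₁' *ᴾ p) u₀'))
               (PR.+-congʳ {negate u₀'} (PP.-‿distribˡ-* u₁' p))) ⟩
        (u₁ *ᴾ p +ᴾ u₀) +ᴾ (negate u₁' *ᴾ p +ᴾ negate u₀')
          ≈⟨ solve 5 (λ p u₁ u₀ v₁ v₀ → (u₁ :* p :+ u₀) :+ (v₁ :* p :+ v₀) := (u₁ :+ v₁) :* p :+ (u₀ :+ v₀))
               ≋-refl p u₁ u₀ (negate u₁') (negate u₀') ⟩
        (u₁ +ᴾ negate u₁') *ᴾ p +ᴾ (u₀ +ᴾ negate u₀') ∎
        where open SetoidReasoning PR.setoid

      -- The one code that `digit₀` skips, whence the factor `l ^ d ∸ 1` in `count`.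
      zeroCode : Fin (l ℕ.^ d)
      zeroCode = proj₁ (decode-surjective d [] λ _ _ → refl)

      digit₁ digit₀ : Fin count → Poly
      digit₁ c = decode (d ℕ.* (k ℕ.∸ 1)) (proj₁ (remQuot (l ℕ.^ d ℕ.∸ 1) c))
      digit₀ c = decode d (skip zeroCode (proj₂ (remQuot {l ℕ.^ (d ℕ.* (k ℕ.∸ 1))} (l ℕ.^ d ℕ.∸ 1) c)))

      below-digit₁ : ∀ c → Below (d ℕ.* (k ℕ.∸ 1)) (digit₁ c)
      below-digit₁ c = below-decode (d ℕ.* (k ℕ.∸ 1)) _

      below-digit₀ : ∀ c → Below d (digit₀ c)
      below-digit₀ c = below-decode d _

      digit₀≢[] : ∀ c → ¬ digit₀ c ≋ []
      digit₀≢[] c eq = skip-≢ zeroCode _ (decode-injective d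
        (≋-trans eq (≋-sym (proj₂ (decode-surjective d [] λ _ _ → refl)))))

      unit : Fin count → Poly
      unit c = digit₁ c *ᴾ p +ᴾ digit₀ c

      p∤unit : ∀ c → ¬ p ∣ᴾ unit c
      p∤unit c p∣ = digit₀≢[] c (∣ᴾ-remainder (digit₁ c) (digit₀ c) mp (below-digit₀ c) p∣)

    element : Fin count → Poly
    element c = unit c *ᴾ pᵉ⁻ᵏ

    -- If `h` kills the class of `u p^(e-k)`, then `p^k` divides `h u`, and hence `h`, because `p`
    -- does not divide `u`.
    element-level : ∀ c → IsMinimalPolynomial (act (element c) w) (p ^ᴾ k)
    element-level c = minimal (monic-^ p mp k)
      (≈ᴹ-trans (≈ᴹ-sym (act-* (p ^ᴾ k) (element c) w))
        (≈ᴹ-trans (act-cong w (≋-sym (*ᴾ-assoc (p ^ᴾ k) (unit c) pᵉ⁻ᵏ)))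
          (act-≈0 (p ^ᴾ k *ᴾ unit c) (∣ᴾ-*ʳ (unit c) ∣ᴾ-refl))))
      (λ h eq → prime-power-∣ mp irr (p∤unit c) k h (act-≈0⁻¹ (h *ᴾ unit c)
        (≈ᴹ-trans (act-cong w (*ᴾ-assoc h (unit c) pᵉ⁻ᵏ)) (≈ᴹ-trans (act-* h (element c) w) eq))))

    -- Equal classes make the difference of the two units divisible by `p^k`. Modulo `p` this
    -- identifies the digits of degree less than `d`; after cancelling `p`, the difference of the
    -- other digits is divisible by `p^(k-1)` and has smaller degree.
    element-injective : ∀ {c c'} → act (element c) w ≈ᴹ act (element c') w → c ≡ c'
    element-injective {c} {c'} eq = begin
      c                                          ≡⟨ Fin.combine-remQuot {m} n c ⟨
      uncurry combine (remQuot {m} n c)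
        ≡⟨ ≡.cong₂ combine (decode-injective (d ℕ.* (k ℕ.∸ 1)) digit₁≋)
             (skip-injective zeroCode (decode-injective d digit₀≋)) ⟩
      uncurry combine (remQuot {m} n c')         ≡⟨ Fin.combine-remQuot {m} n c' ⟩
      c'                                         ∎
      where
      open ≡.≡-Reasoning
      m n : ℕ
      m = l ℕ.^ (d ℕ.* (k ℕ.∸ 1))
      n = l ℕ.^ d ℕ.∸ 1
      Δ₁ Δ₀ : Poly
      Δ₁ = digit₁ c +ᴾ negate (digit₁ c')
      Δ₀ = digit₀ c +ᴾ negate (digit₀ c')
      below-Δ : ∀ {n} g g' → Below n g → Below n g' → Below n (g +ᴾ negate g')
      below-Δ g g' b b' = below-+ g (negate g') b (below-negate g' b')
      divides : pᵏ⁻¹ *ᴾ p ∣ᴾ Δ₁ *ᴾ p +ᴾ Δ₀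
      divides = ∣ᴾ-respˡ pᵏ≋ (∣ᴾ-respʳ (difference-digits (digit₁ c) (digit₀ c) (digit₁ c') (digit₀ c'))
        (act-≈⁻¹ (unit c) (unit c') eq))
      Δ₀≋[] : Δ₀ ≋ []
      Δ₀≋[] = ∣ᴾ-remainder Δ₁ Δ₀ mp (below-Δ (digit₀ c) (digit₀ c') (below-digit₀ c) (below-digit₀ c'))
        (∣ᴾ-trans (divisor pᵏ⁻¹ ≋-refl) divides)
      digit₀≋ : digit₀ c ≋ digit₀ c'
      digit₀≋ = PP.x∙y⁻¹≈ε⇒x≈y (digit₀ c) (digit₀ c') Δ₀≋[]
      digit₁≋ : digit₁ c ≋ digit₁ c'
      digit₁≋ = PP.x∙y⁻¹≈ε⇒x≈y (digit₁ c) (digit₁ c')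
        (∣ᴾ-remainder {g = pᵏ⁻¹} [] Δ₁ (monic-^ p mp (k ℕ.∸ 1))
          (below-Δ (digit₁ c) (digit₁ c') (below-digit₁ c) (below-digit₁ c'))
          (∣ᴾ-cancelʳ p mp (∣ᴾ-respʳ (≋-trans (PR.+-congˡ {Δ₁ *ᴾ p} Δ₀≋[]) (+ᴾ-identityʳ _)) divides)))

    -- As `p^k` kills the class of `g`, `p^e` divides `p^k g` and so `g = t p^(e-k)`. The digits
    -- come from dividing `t` by `p` and the quotient by `p^(k-1)`. The lower digit is nonzero,
    -- since otherwise `p^(k-1)` would already kill the class.
    element-surjective : ∀ g → IsMinimalPolynomial (act g w) (p ^ᴾ k) →
      ∃[ c ] act (element c) w ≈ᴹ act g w
    element-surjective g min =
      let (t , tpᵉ⁻ᵏ≋g)      = quotient pᵉ⁻ᵏ∣g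
          (q , u₀ , t≋ , b₀) = divMod t p mp
          (s , u₁ , q≋ , b₁) = divMod q pᵏ⁻¹ (monic-^ p mp (k ℕ.∸ 1))
          (i , i≋u₁)         = decode-surjective (d ℕ.* (k ℕ.∸ 1)) u₁ b₁
          (j , j≋u₀)         = decode-surjective d u₀ b₀
          (j' , j'≡j)        = skip-surjective zeroCode j λ j≡0 → u₀≢[] t q u₀ tpᵉ⁻ᵏ≋g t≋
                                 (≋-trans (≋-sym j≋u₀) (≋-trans
                                   (PR.reflexive (≡.cong (decode d) j≡0))
                                   (proj₂ (decode-surjective d [] λ _ _ → refl))))
          rq                 = Fin.remQuot-combine i j'
          c                  = combine i j'
          digit₁≋            = ≋-trans (PR.reflexive (≡.cong (decode (d ℕ.* (k ℕ.∸ 1)) ∘ proj₁) rq)) i≋u₁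
          digit₀≋            = ≋-trans (PR.reflexive (≡.trans
                                 (≡.cong (decode d ∘ skip zeroCode ∘ proj₂) rq) (≡.cong (decode d) j'≡j))) j≋u₀
      in c , ≈ᴹ-trans (act-≈ (unit c) t (reduction (unit c) t q u₀ s u₁
               (+ᴾ-cong (*ᴾ-congʳ p digit₁≋) digit₀≋) t≋ q≋))
             (act-cong w tpᵉ⁻ᵏ≋g)
      where
      pᵉ⁻ᵏ∣g : pᵉ⁻ᵏ ∣ᴾ g
      pᵉ⁻ᵏ∣g = ∣ᴾ-cancelʳ (p ^ᴾ k) (monic-^ p mp k)
        (∣ᴾ-respˡ (≋-trans pᵉ≋ (*ᴾ-comm (p ^ᴾ k) pᵉ⁻ᵏ)) (∣ᴾ-respʳ (*ᴾ-comm (p ^ᴾ k) g)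
          (annihilator-w _ (≈ᴹ-trans (act-* (p ^ᴾ k) g w) (IsMinimalPolynomial.annihilates min)))))

      multiple : ∀ t q u₀ → t ≋ q *ᴾ p +ᴾ u₀ → u₀ ≋ [] → q *ᴾ p ^ᴾ k ≋ pᵏ⁻¹ *ᴾ t
      multiple t q u₀ t≋ u₀≋[] = begin
        q *ᴾ p ^ᴾ k        ≈⟨ *ᴾ-congˡ q pᵏ≋ ⟩
        q *ᴾ (pᵏ⁻¹ *ᴾ p)   ≈⟨ solve 3 (λ q a p → q :* (a :* p) := a :* (q :* p)) ≋-refl q pᵏ⁻¹ p ⟩
        pᵏ⁻¹ *ᴾ (q *ᴾ p)   ≈⟨ *ᴾ-congˡ pᵏ⁻¹ (≋-trans t≋
                                (≋-trans (PR.+-congˡ {q *ᴾ p} u₀≋[]) (+ᴾ-identityʳ _))) ⟨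
        pᵏ⁻¹ *ᴾ t          ∎
        where open SetoidReasoning PR.setoid

      u₀≢[] : ∀ t q u₀ → t *ᴾ pᵉ⁻ᵏ ≋ g → t ≋ q *ᴾ p +ᴾ u₀ → ¬ u₀ ≋ []
      u₀≢[] t q u₀ t≋g t≋ u₀≋[] = ℕ.<-irrefl ≡.refl (begin-strict
        d ℕ.* (k ℕ.∸ 1)           <⟨ ℕ.m<n+m _ d>0 ⟩
        d ℕ.+ d ℕ.* (k ℕ.∸ 1)     ≡⟨ dk≡ ⟨
        -- The degree recorded in `min` and `d k` are both degrees of `p^k`; they are compared
        -- through `p^k ∣ p^k`.
        d ℕ.* k                   ≤⟨ degree-∣ᴾ {g = p ^ᴾ k} (monic-^ p mp k) (IsMinimalPolynomial.monic min) ∣ᴾ-refl ⟩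
        IsMinimalPolynomial.degree min
          ≤⟨ IsMinimalPolynomial.least min _ pᵏ⁻¹ (monic-^ p mp (k ℕ.∸ 1)) annihilated ⟩
        d ℕ.* (k ℕ.∸ 1)           ∎)
        where
        open ℕ.≤-Reasoning
        annihilated : act pᵏ⁻¹ (act g w) ≈ᴹ 0ᴹ
        annihilated = ≈ᴹ-trans (≈ᴹ-sym (act-* pᵏ⁻¹ g w)) (≈ᴹ-trans
          (act-cong w (≋-trans (*ᴾ-congˡ pᵏ⁻¹ (≋-sym t≋g)) (≋-sym (*ᴾ-assoc pᵏ⁻¹ t pᵉ⁻ᵏ))))
          (act-≈0 (pᵏ⁻¹ *ᴾ t) (divisor q (multiple t q u₀ t≋ u₀≋[]))))

      -- Substituting for `q` gives `t = s p^k + u`, so `u - t` is `- s` times `p^k`.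
      reduction : ∀ u t q u₀ s u₁ → u ≋ u₁ *ᴾ p +ᴾ u₀ → t ≋ q *ᴾ p +ᴾ u₀ → q ≋ s *ᴾ pᵏ⁻¹ +ᴾ u₁ →
        p ^ᴾ k ∣ᴾ u +ᴾ negate t
      reduction u t q u₀ s u₁ u≋ t≋ q≋ = divisor (negate s) (begin
        negate s *ᴾ p ^ᴾ k     ≈⟨ PP.-‿distribˡ-* s (p ^ᴾ k) ⟨
        negate (s *ᴾ p ^ᴾ k)   ≈⟨ PP.+-cancelʳ t _ _ (begin
          negate (s *ᴾ p ^ᴾ k) +ᴾ t
            ≈⟨ PR.+-congˡ {negate (s *ᴾ p ^ᴾ k)} (begin
              t                              ≈⟨ t≋ ⟩
              q *ᴾ p +ᴾ u₀                   ≈⟨ PR.+-congʳ {u₀} (*ᴾ-congʳ p q≋) ⟩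
              (s *ᴾ pᵏ⁻¹ +ᴾ u₁) *ᴾ p +ᴾ u₀
                ≈⟨ solve 5 (λ s a u₁ p u₀ → (s :* a :+ u₁) :* p :+ u₀ := s :* (a :* p) :+ (u₁ :* p :+ u₀))
                     ≋-refl s pᵏ⁻¹ u₁ p u₀ ⟩
              s *ᴾ (pᵏ⁻¹ *ᴾ p) +ᴾ (u₁ *ᴾ p +ᴾ u₀)
                ≈⟨ +ᴾ-cong (*ᴾ-congˡ s (≋-sym pᵏ≋)) (≋-sym u≋) ⟩
              s *ᴾ p ^ᴾ k +ᴾ u               ∎) ⟩
          negate (s *ᴾ p ^ᴾ k) +ᴾ (s *ᴾ p ^ᴾ k +ᴾ u) ≈⟨ +ᴾ-assoc (negate (s *ᴾ p ^ᴾ k)) _ u ⟨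
          (negate (s *ᴾ p ^ᴾ k) +ᴾ s *ᴾ p ^ᴾ k) +ᴾ u ≈⟨ PR.+-congʳ {u} (PR.-‿inverseˡ (s *ᴾ p ^ᴾ k)) ⟩
          u                                    ≈⟨ +ᴾ-identityʳ u ⟨
          u +ᴾ []                              ≈⟨ PR.+-congˡ {u} (PR.-‿inverseˡ t) ⟨
          u +ᴾ (negate t +ᴾ t)                 ≈⟨ +ᴾ-assoc u (negate t) t ⟨
          (u +ᴾ negate t) +ᴾ t                 ∎) ⟩
        u +ᴾ negate t          ∎)
        where open SetoidReasoning PR.setoid

-- The decomposition into blocks, and the elements at prescribed levels.

module BlockDecomposition {c ℓ a b} {R : CommutativeRing c ℓ} {l : ℕ}
  (isFiniteField : IsFiniteField R l) (V : Module R a b)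
  (φ : Module.Carrierᴹ V → Module.Carrierᴹ V)
  (φ-linear : IsLinear V φ)
  (B : CompanionBlocks R)
  (v : LinearAlgebra.Family V φ B (Module.Carrierᴹ V))
  (basis : LinearAlgebra.IsBasis V φ B v)
  (isMatrix : LinearAlgebra.IsMatrixOfφ V φ B v) where
  open CommutativeRing R hiding (zero)
  open IsFiniteField isFiniteField
  open Polynomial R
  open PolynomialRing R
  open FieldPolynomials isDiscreteField
  open FiniteFieldPolynomials isFiniteField
  open Module V
  open LinearAlgebra V φ
  open LinearMap V φ φ-linear
  open FiniteFieldLinearMap isFiniteField V φ φ-linear
  open CompanionBlocks B
  open IsBasis basis
  open MonoidSum +ᴹ-commutativeMonoid using (sum; sum-cong-≋; ∑-distrib-+)
  private
    module ≈M = SetoidReasoning ≈ᴹ-setoid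

  infix 4 _≟ᴮ_
  _≟ᴮ_ : DecidableEquality Block
  _≟ᴮ_ = ≡-dec Fin._≟_ Fin._≟_

  power : Block → Poly
  power (i , j) = P i ^ᴾ e i j

  monic-power : ∀ β → MonicOfDegree (size β) (power β)
  monic-power (i , j) = monic-^ (P i) (monic i) (e i j)

  sumᴮ : (Block → Carrierᴹ) → Carrierᴹ
  sumᴮ f = sum (λ i → sum (λ j → f (i , j)))

  sumᴮ-cong : ∀ {f g : Block → Carrierᴹ} → (∀ β → f β ≈ᴹ g β) → sumᴮ f ≈ᴹ sumᴮ g
  sumᴮ-cong e = sum-cong-≋ λ i → sum-cong-≋ λ j → e (i , j)

  sumᴮ-+ : ∀ f g → sumᴮ (λ β → f β +ᴹ g β) ≈ᴹ sumᴮ f +ᴹ sumᴮ g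
  sumᴮ-+ f g = ≈ᴹ-trans
    (sum-cong-≋ λ i → ∑-distrib-+ (λ j → f (i , j)) (λ j → g (i , j)))
    (∑-distrib-+ (λ i → sum (λ j → f (i , j))) (λ i → sum (λ j → g (i , j))))

  sumᴮ-zero : ∀ {f} → (∀ β → f β ≈ᴹ 0ᴹ) → sumᴮ f ≈ᴹ 0ᴹ
  sumᴮ-zero e = sum-zero +ᴹ-commutativeMonoid _ λ i → sum-zero +ᴹ-commutativeMonoid _ λ j → e (i , j)

  sumᴮ-single : ∀ f β → (∀ β' → β' ≢ β → f β' ≈ᴹ 0ᴹ) → sumᴮ f ≈ᴹ f β
  sumᴮ-single f (i , j) e = ≈ᴹ-trans
    (sum-single +ᴹ-commutativeMonoid _ i λ i' i'≢i →
      sum-zero +ᴹ-commutativeMonoid _ λ j' → e (i' , j') (i'≢i ∘ ≡.cong proj₁))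
    (sum-single +ᴹ-commutativeMonoid _ j λ j' j'≢j → e (i , j') λ { ≡.refl → j'≢j ≡.refl })

  sumᴮ-act : ∀ g f → act g (sumᴮ f) ≈ᴹ sumᴮ (act g ∘ f)
  sumᴮ-act g f = ≈ᴹ-trans (act-sum g (λ i → sum (λ j → f (i , j)))) (sum-cong-≋ λ i → act-sum g (λ j → f (i , j)))

  private
    M-diagonal : ∀ β s t → M (β , s) (β , t) ≡ companion (power β) s t
    M-diagonal β s t with ≡-dec Fin._≟_ Fin._≟_ β β
    ... | yes ≡.refl = ≡.refl
    ... | no  β≢β    = contradiction ≡.refl β≢β

    M-off-diagonal : ∀ {β' β} → β' ≢ β → ∀ s t → M (β' , s) (β , t) ≡ 0#
    M-off-diagonal {β'} {β} β'≢β s t with ≡-dec Fin._≟_ Fin._≟_ β' β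
    ... | yes β'≡β = contradiction β'≡β β'≢β
    ... | no  _    = ≡.refl

  companionBasis : ∀ β → Companion.CompanionBasis (power β) (v β)
  companionBasis β t = ≈ᴹ-trans (isMatrix β t) (≈ᴹ-trans
    (sumᴮ-single _ β λ β' β'≢β → combination-zero (v β') λ s →
      reflexive (M-off-diagonal β'≢β s t))
    (sum-cong-≋ λ s → *ₗ-congʳ (reflexive (M-diagonal β s t))))

  w : Block → Carrierᴹ
  w β = cyclicVector (v β)

  private
    module Cyclic β = CyclicBlock isDiscreteField (power β) (monic-power β) (v β) (companionBasis β)

  annihilates-w : ∀ β → act (power β) (w β) ≈ᴹ 0ᴹ
  annihilates-w β = Companion.annihilates-cyclic (power β) (monic-power β) (v β) (companionBasis β)

  -- The coordinates of each summand are those of the remainder of `h β` modulo `power β`, and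
  -- independence makes them vanish. This says at once that the sum of the blocks is direct and that
  -- the annihilator of each cyclic vector is no larger than the ideal of `power β`.
  independent-act : ∀ (h : Block → Poly) → sumᴮ (λ β → act (h β) (w β)) ≈ᴹ 0ᴹ → ∀ β → power β ∣ᴾ h β
  independent-act h e β = proj₂ (proj₂ (Cyclic.coordinates β (h β)))
    (independent (λ β → proj₁ (Cyclic.coordinates β (h β)))
      (≈ᴹ-trans (sumᴮ-cong λ β → ≈ᴹ-sym (proj₁ (proj₂ (Cyclic.coordinates β (h β))))) e) β)

  annihilator-w : ∀ β h → act h (w β) ≈ᴹ 0ᴹ → power β ∣ᴾ h
  annihilator-w β h e = ≡.subst (power β ∣ᴾ_) at-β (independent-act single (≈ᴹ-trans
    (sumᴮ-single _ β λ β' β'≢β → ≈ᴹ-reflexive (≡.cong (λ g → act g (w β')) (off-β β'≢β)))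
    (≈ᴹ-trans (≈ᴹ-reflexive (≡.cong (λ g → act g (w β)) at-β)) e)) β)
    where
    single : Block → Poly
    single β' with β' ≟ᴮ β
    ... | yes _ = h
    ... | no  _ = []
    at-β : single β ≡ h
    at-β with β ≟ᴮ β
    ... | yes _   = ≡.refl
    ... | no  β≢β = contradiction ≡.refl β≢β
    off-β : ∀ {β'} → β' ≢ β → single β' ≡ []
    off-β {β'} β'≢β with β' ≟ᴮ β
    ... | yes β'≡β = contradiction β'≡β β'≢β
    ... | no  _    = ≡.refl

  generatorCoordinate : Carrierᴹ → Block → Poly
  generatorCoordinate D β = Truncations.expand isDiscreteField (power β) (monic-power β) (proj₁ (spans D) β)

  component≈act : ∀ D β → component B basis D β ≈ᴹ act (generatorCoordinate D β) (w β)
  component≈act D β = Cyclic.combination≈act β (proj₁ (spans D) β)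

  -- Two expansions of `D` in the cyclic vectors differ by a relation, which `independent-act` makes
  -- trivial in each block. Hence the components do not depend on the coordinates chosen by `spans`.
  component-sumᴮ : ∀ {D} (h : Block → Poly) → D ≈ᴹ sumᴮ (λ β → act (h β) (w β)) →
    ∀ β → component B basis D β ≈ᴹ act (h β) (w β)
  component-sumᴮ {D} h e β = ≈ᴹ-trans (component≈act D β)
    (act-difference⁻¹ (g β) (h β) (w β) (annihilates-multiple (power β) (annihilates-w β)
      (independent-act (λ β → g β +ᴾ negate (h β)) difference β)))
    where
    open ≈M
    g : Block → Poly
    g = generatorCoordinate D
    difference : sumᴮ (λ β → act (g β +ᴾ negate (h β)) (w β)) ≈ᴹ 0ᴹ
    difference = begin
      sumᴮ (λ β → act (g β +ᴾ negate (h β)) (w β))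
        ≈⟨ sumᴮ-cong (λ β → act-+ (g β) (negate (h β)) (w β)) ⟩
      sumᴮ (λ β → act (g β) (w β) +ᴹ act (negate (h β)) (w β))
        ≈⟨ sumᴮ-+ (λ β → act (g β) (w β)) (λ β → act (negate (h β)) (w β)) ⟩
      sumᴮ (λ β → act (g β) (w β)) +ᴹ sumᴮ (λ β → act (negate (h β)) (w β))
        ≈⟨ +ᴹ-congʳ (≈ᴹ-trans (sumᴮ-cong λ β → ≈ᴹ-sym (component≈act D β))
             (≈ᴹ-trans (≈ᴹ-sym (proj₂ (spans D))) e)) ⟩
      sumᴮ (λ β → act (h β) (w β)) +ᴹ sumᴮ (λ β → act (negate (h β)) (w β))
        ≈⟨ sumᴮ-+ (λ β → act (h β) (w β)) (λ β → act (negate (h β)) (w β)) ⟨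
      sumᴮ (λ β → act (h β) (w β) +ᴹ act (negate (h β)) (w β))
        ≈⟨ sumᴮ-zero (λ β → act-negate (h β) (w β)) ⟩
      0ᴹ ∎

  component-cong : ∀ {D E} → D ≈ᴹ E → ∀ β → component B basis D β ≈ᴹ component B basis E β
  component-cong {D} {E} e β = ≈ᴹ-trans
    (component-sumᴮ (generatorCoordinate E)
      (≈ᴹ-trans e (≈ᴹ-trans (proj₂ (spans E)) (sumᴮ-cong (component≈act E)))) β)
    (≈ᴹ-sym (component≈act E β))

  -- Each component is a polynomial in `φ` applied to its cyclic vector, so `act g D ≈ᴹ 0ᴹ` is a
  -- relation between the cyclic vectors and splits by `independent-act`.
  act-component : ∀ g {D} → act g D ≈ᴹ 0ᴹ → ∀ β → act g (component B basis D β) ≈ᴹ 0ᴹ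
  act-component g {D} e β = begin
    act g (component B basis D β)     ≈⟨ act-congʳ g (component≈act D β) ⟩
    act g (act (generatorCoordinate D β) (w β)) ≈⟨ act-* g (generatorCoordinate D β) (w β) ⟨
    act (g *ᴾ generatorCoordinate D β) (w β)
      ≈⟨ annihilates-multiple (power β) (annihilates-w β)
           (independent-act (λ β → g *ᴾ generatorCoordinate D β) sum≈0 β) ⟩
    0ᴹ ∎
    where
    open ≈M
    sum≈0 : sumᴮ (λ β → act (g *ᴾ generatorCoordinate D β) (w β)) ≈ᴹ 0ᴹ
    sum≈0 = begin
      sumᴮ (λ β → act (g *ᴾ generatorCoordinate D β) (w β))
        ≈⟨ sumᴮ-cong (λ β → ≈ᴹ-trans (act-* g (generatorCoordinate D β) (w β))
             (act-congʳ g (≈ᴹ-sym (component≈act D β)))) ⟩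
      sumᴮ (λ β → act g (component B basis D β)) ≈⟨ sumᴮ-act g (component B basis D) ⟨
      act g (sumᴮ (component B basis D))         ≈⟨ act-congʳ g (proj₂ (spans D)) ⟨
      act g D                                    ≈⟨ e ⟩
      0ᴹ                                         ∎

  act-component⁻¹ : ∀ g {D} → (∀ β → act g (component B basis D β) ≈ᴹ 0ᴹ) → act g D ≈ᴹ 0ᴹ
  act-component⁻¹ g {D} e = ≈ᴹ-trans (act-congʳ g (proj₂ (spans D)))
    (≈ᴹ-trans (sumᴮ-act g (component B basis D)) (sumᴮ-zero e))

  module Levels {r : ℕ} (chosen : Fin r → Block) (chosen-injective : ∀ s t → chosen s ≡ chosen t → s ≡ t)
    (k : Fin r → ℕ)
    (k-bounds : ∀ s → 1 ≤ k s × k s ≤ e (proj₁ (chosen s)) (proj₂ (chosen s))) where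

    chosenPower : Fin r → Poly
    chosenPower s = P (proj₁ (chosen s)) ^ᴾ k s

    minimalPolynomial : ∀ {L} → IsLcm chosenPower L → ∀ D → AtLevels B basis chosen k D →
      IsMinimalPolynomial D L
    minimalPolynomial {L} isLcm D atLevels = minimal (proj₂ lcm.monic)
      (act-component⁻¹ L λ β → annihilated β (Fin.any? λ s → chosen s ≟ᴮ β))
      (λ h eq → lcm.least h λ s → minimal-∣ (level s) h (act-component h eq (chosen s)))
      where
      module lcm = IsLcm isLcm
      open AtLevels atLevels
      annihilated : ∀ β → Dec (∃[ s ] chosen s ≡ β) → act L (component B basis D β) ≈ᴹ 0ᴹ
      annihilated β (yes (s , ≡.refl)) = annihilates-multiple (chosenPower s)
        (IsMinimalPolynomial.annihilates (level s)) (lcm.multiple s)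
      annihilated β (no ¬chosen) = ≈ᴹ-trans
        (act-congʳ L (elsewhere β λ s s≡β → ¬chosen (s , s≡β))) (act-0ᴹ L)

    -- The exponent is a common period of the cyclic vectors of the chosen blocks, so it is found
    -- before any element at the given levels is considered. Fixing `w` forces `p^e ∣ x^N - 1`, and
    -- `p^k` divides `p^e`.
    lcm-∣-X^n-1 : (∀ D → ∃[ N ] 1 ≤ N × φ^ N D ≈ᴹ D) → ∀ {L} → IsLcm chosenPower L →
      ∃[ N ] 1 ≤ N × L ∣ᴾ X^n-1 N
    lcm-∣-X^n-1 torsion isLcm =
      let (N , 1≤N , fixed) = torsion-family torsion (w ∘ chosen) in
      N , 1≤N , IsLcm.least isLcm (X^n-1 N) λ s → ∣ᴾ-trans
        (≡.subst (λ j → chosenPower s ∣ᴾ P (proj₁ (chosen s)) ^ᴾ j) (ℕ.m∸n+n≡m (proj₂ (k-bounds s)))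
          (∣ᴾ-respʳ (≋-sym (^ᴾ-+ (P (proj₁ (chosen s))) (eₛ s ℕ.∸ k s) (k s)))
            (∣ᴾ-*ˡ (P (proj₁ (chosen s)) ^ᴾ (eₛ s ℕ.∸ k s)) ∣ᴾ-refl)))
        (annihilator-w (chosen s) (X^n-1 N) (fixed⇒annihilated N (fixed s)))
      where
      eₛ : Fin r → ℕ
      eₛ s = e (proj₁ (chosen s)) (proj₂ (chosen s))

    private
      module Lv s = PrimePowerLevel (monic (proj₁ (chosen s))) (irreducible (proj₁ (chosen s)))
        (e (proj₁ (chosen s)) (proj₂ (chosen s))) (w (chosen s)) (annihilates-w (chosen s))
        (annihilator-w (chosen s)) (k s) (proj₁ (k-bounds s)) (proj₂ (k-bounds s))

      -- The decision is an argument so that `assemble-codes` can match on it directly.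
      coordinate : (∀ s → Fin (Lv.count s)) → ∀ β → Dec (∃[ s ] chosen s ≡ β) → Poly
      coordinate t β (yes (s , _)) = Lv.element s (t s)
      coordinate t β (no _)        = []

      coordinates : (∀ s → Fin (Lv.count s)) → Block → Poly
      coordinates t β = coordinate t β (Fin.any? λ s → chosen s ≟ᴮ β)

      coordinates-chosen : ∀ t s → coordinates t (chosen s) ≡ Lv.element s (t s)
      coordinates-chosen t s with Fin.any? (λ s' → chosen s' ≟ᴮ chosen s)
      ... | no ¬chosen = contradiction (s , ≡.refl) ¬chosen
      ... | yes (s' , eq) with chosen-injective s' s eq
      ...   | ≡.refl = ≡.refl

      coordinates-elsewhere : ∀ t β → (∀ s → chosen s ≢ β) → coordinates t β ≡ []
      coordinates-elsewhere t β ≢β with Fin.any? (λ s' → chosen s' ≟ᴮ β)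
      ... | no _         = ≡.refl
      ... | yes (s , eq) = contradiction eq (≢β s)

      assemble : (∀ s → Fin (Lv.count s)) → Carrierᴹ
      assemble t = sumᴮ (λ β → act (coordinates t β) (w β))

      component-assemble : ∀ t s →
        component B basis (assemble t) (chosen s) ≈ᴹ act (Lv.element s (t s)) (w (chosen s))
      component-assemble t s = ≈ᴹ-trans (component-sumᴮ (coordinates t) ≈ᴹ-refl (chosen s))
        (≈ᴹ-reflexive (≡.cong (λ g → act g (w (chosen s))) (coordinates-chosen t s)))

      atLevels-assemble : ∀ t → AtLevels B basis chosen k (assemble t)
      atLevels-assemble t = record
        -- If the component were zero, `1` would annihilate it, and `p^k`, of positive degree `d k`,
        -- would divide `1`.
        { nonzero   = λ s eq → ℕ.<-irrefl ≡.refl (ℕ.<-≤-trans (Lv.level>0 s)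
            (degree-∣ᴾ {g = chosenPower s} (monic-^ (P (proj₁ (chosen s))) (monic (proj₁ (chosen s))) (k s)) monic-1
              (minimal-∣ (level s) (1# ∷ []) (≈ᴹ-trans (act-1 _) eq))))
        ; level     = level
        ; elsewhere = λ β ≢β → ≈ᴹ-trans (component-sumᴮ (coordinates t) ≈ᴹ-refl β)
            (≈ᴹ-reflexive (≡.cong (λ g → act g (w β)) (coordinates-elsewhere t β ≢β))) }
        where
        level : ∀ s → IsMinimalPolynomial (component B basis (assemble t) (chosen s)) (chosenPower s)
        level s = minimal-resp (≈ᴹ-sym (component-assemble t s)) (Lv.element-level s (t s))

      assemble-injective : ∀ t t' → assemble t ≈ᴹ assemble t' → ∀ s → t s ≡ t' s
      assemble-injective t t' eq s = Lv.element-injective s (≈ᴹ-trans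
        (≈ᴹ-sym (component-assemble t s))
        (≈ᴹ-trans (component-cong eq (chosen s)) (component-assemble t' s)))

      codes : ∀ D → AtLevels B basis chosen k D → ∀ s → Fin (Lv.count s)
      codes D atLevels s = proj₁ (Lv.element-surjective s (generatorCoordinate D (chosen s))
        (minimal-resp (component≈act D (chosen s)) (AtLevels.level atLevels s)))

      -- The tuple `t` only agrees pointwise with the codes, which is what `tuple-surjective` gives.
      assemble-codes : ∀ D (atLevels : AtLevels B basis chosen k D) t →
        (∀ s → t s ≡ codes D atLevels s) → assemble t ≈ᴹ D
      assemble-codes D atLevels t t≡ = ≈ᴹ-trans
        (sumᴮ-cong λ β → agree β (Fin.any? λ s → chosen s ≟ᴮ β))
        (≈ᴹ-sym (proj₂ (spans D)))
        where
        agree : ∀ β (d : Dec (∃[ s ] chosen s ≡ β)) →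
          act (coordinate t β d) (w β) ≈ᴹ component B basis D β
        agree β (yes (s , ≡.refl)) = ≈ᴹ-trans
          (≈ᴹ-trans (≈ᴹ-reflexive (≡.cong (λ i → act (Lv.element s i) (w β)) (t≡ s))) (proj₂ (Lv.element-surjective s (generatorCoordinate D (chosen s))
            (minimal-resp (component≈act D (chosen s)) (AtLevels.level atLevels s)))))
          (≈ᴹ-sym (component≈act D (chosen s)))
        agree β (no ¬chosen) = ≈ᴹ-sym (AtLevels.elsewhere atLevels β λ s s≡β → ¬chosen (s , s≡β))

    counting : Inverse
      (≡.setoid (Fin (product +-*-rawSemiring
        (λ s → l ℕ.^ (d (proj₁ (chosen s)) ℕ.* (k s ℕ.∸ 1)) ℕ.* (l ℕ.^ d (proj₁ (chosen s)) ℕ.∸ 1)))))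
      (AtLevelsSetoid B basis chosen k)
    counting = enumeration⇒Inverse {S = AtLevelsSetoid B basis chosen k}
      (λ i → assemble (tuple Lv.count i) , atLevels-assemble (tuple Lv.count i))
      (λ {i} {j} eq → tuple-injective Lv.count
        (assemble-injective (tuple Lv.count i) (tuple Lv.count j) eq))
      (λ (D , atLevels) → let (i , t≡) = tuple-surjective Lv.count (codes D atLevels) in
        i , assemble-codes D atLevels (tuple Lv.count i) t≡)

-- An automorphism acts on finitely many periodic elements as one power of `Φ`.

_^[_] : ∀ {a} {A : Set a} → (A → A) → ℕ → A → A
(f ^[ zero ])  x = x
(f ^[ suc n ]) x = f ((f ^[ n ]) x)

^[]-+ : ∀ {a} {A : Set a} (f : A → A) m n x → (f ^[ m ℕ.+ n ]) x ≡ (f ^[ m ]) ((f ^[ n ]) x)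
^[]-+ f zero    n x = ≡.refl
^[]-+ f (suc m) n x = ≡.cong f (^[]-+ f m n x)

^[]-* : ∀ {a} {A : Set a} (f : A → A) k n x → (f ^[ k ℕ.* n ]) x ≡ ((f ^[ n ]) ^[ k ]) x
^[]-* f zero    n x = ≡.refl
^[]-* f (suc k) n x = ≡.trans (^[]-+ f n (k ℕ.* n) x) (≡.cong (f ^[ n ]) (^[]-* f k n x))

module GaloisOrbit {c ℓ} {K : CommutativeRing c ℓ} (isField : IsDiscreteField K)
  {Φ τ : CommutativeRing.Carrier K → CommutativeRing.Carrier K}
  (Φ-hom : IsRingHomomorphism (CommutativeRing.rawRing K) (CommutativeRing.rawRing K) Φ)
  (τ-hom : IsRingHomomorphism (CommutativeRing.rawRing K) (CommutativeRing.rawRing K) τ)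
  (τ-fixes : ∀ x → CommutativeRing._≈_ K (Φ x) x → CommutativeRing._≈_ K (τ x) x) where
  open CommutativeRing K using (Carrier; _≈_; trans; sym)
  open Polynomial K using (Poly; coeff; _+ᴾ_; _*ᴾ_)
  open PolynomialRing K
  open FieldPolynomials isField using (*ᴾ≋[]; module PR)
  private
    K[T] : CommutativeRing c ℓ
    K[T] = polynomialRing
    module Q = Polynomial K[T]
    module QR = PolynomialRing K[T]
    module QC = CommutativeRing QR.polynomialRing
    module PP = RingProperties PR.ring
    module QS = CommSemigroup QC.*-commutativeSemigroup

    Φ̂ τ̂ : Poly → Poly
    Φ̂ = List.map Φ
    τ̂ = List.map τ

    Φ̂-hom : IsRingHomomorphism PR.rawRing PR.rawRing Φ̂
    Φ̂-hom = map-isRingHomomorphism {R = K} {S = K} Φ-hom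
    τ̂-hom : IsRingHomomorphism PR.rawRing PR.rawRing τ̂
    τ̂-hom = map-isRingHomomorphism {R = K} {S = K} τ-hom

    module Φ̂ = IsRingHomomorphism Φ̂-hom
    module τ̂ = IsRingHomomorphism τ̂-hom

    τ̂-fixes : ∀ g → Φ̂ g ≋ g → τ̂ g ≋ g
    τ̂-fixes g (coefficientwise e) = coefficientwise λ i → trans (coeff-map {R = K} {S = K} τ-hom g i)
      (τ-fixes (coeff g i) (trans (sym (coeff-map {R = K} {S = K} Φ-hom g i)) (e i)))

    linear-cong : ∀ {g h} → g ≋ h → Q.X- g QR.≋ Q.X- h
    linear-cong e = QR.∷-cong (PR.-‿cong e) QR.≋-refl

    Φ̂-linear : ∀ g → List.map Φ̂ (Q.X- g) QR.≋ Q.X- (Φ̂ g)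
    Φ̂-linear g = QR.∷-cong (Φ̂.-‿homo g) (QR.∷-cong Φ̂.1#-homo QR.≋-refl)

    eval-linear : ∀ g h → Q.eval (Q.X- g) h ≋ h +ᴾ negate g
    eval-linear g h = begin
      negate g +ᴾ h *ᴾ (PR.1# +ᴾ h *ᴾ [])
        ≈⟨ PR.+-congˡ {negate g} (*ᴾ-congˡ h (PR.trans (PR.+-congˡ {PR.1#} (PR.zeroʳ h)) (+ᴾ-identityʳ PR.1#))) ⟩
      negate g +ᴾ h *ᴾ PR.1#    ≈⟨ PR.+-congˡ {negate g} (PR.*-identityʳ h) ⟩
      negate g +ᴾ h             ≈⟨ +ᴾ-comm (negate g) h ⟩
      h +ᴾ negate g             ∎
      where open SetoidReasoning PR.setoid

  module _ (zs : List Carrier) (N : ℕ)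
    (periodic : List.map (Φ ^[ suc N ]) zs ≋ zs) where
    private
      F : ℕ → Poly
      F i = List.map (Φ ^[ i ]) zs

      F-suc : ∀ i → Φ̂ (F i) ≋ F (suc i)
      F-suc i = PR.reflexive (≡.sym (List.map-∘ zs))

      F-0 : F 0 ≋ zs
      F-0 = PR.reflexive (List.map-id zs)

      -- The product of `Y - F i` over `k ≤ i < k + n`, a polynomial in `Y` over `K[T]`.
      G : ℕ → ℕ → Q.Poly
      G k zero    = PR.1# ∷ []
      G k (suc n) = (Q.X- F (k ℕ.+ n)) Q.*ᴾ G k n

      Φ̂-G : ∀ k n → List.map Φ̂ (G k n) QR.≋ G (suc k) n
      Φ̂-G k zero    = QR.∷-cong Φ̂.1#-homo QR.≋-refl
      Φ̂-G k (suc n) = QR.≋-trans (map-* {R = K[T]} {S = K[T]} Φ̂-hom (Q.X- F (k ℕ.+ n)) (G k n))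
        (QC.*-cong (QR.≋-trans (Φ̂-linear (F (k ℕ.+ n))) (linear-cong (F-suc (k ℕ.+ n)))) (Φ̂-G k n))

      G-shift : ∀ n → (Q.X- F 0) Q.*ᴾ G 1 n QR.≋ G 0 (suc n)
      G-shift zero    = QR.≋-refl
      G-shift (suc n) = QC.trans (QS.x∙yz≈y∙xz (Q.X- F 0) (Q.X- F (suc n)) (G 1 n))
        (QC.*-congˡ {Q.X- F (suc n)} (G-shift n))

      -- `Φ` moves the range of factors up by one. By periodicity the factor gained, at `suc N`,
      -- equals the factor lost, at `0`.
      Φ̂-fixes-G : List.map Φ̂ (G 0 (suc N)) QR.≋ G 0 (suc N)
      Φ̂-fixes-G = QC.trans (Φ̂-G 0 (suc N)) (QC.trans
        (QC.*-congʳ {G 1 N} (linear-cong (PR.trans periodic (PR.sym F-0)))) (G-shift N))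

      τ̂-fixes-G : List.map τ̂ (G 0 (suc N)) QR.≋ G 0 (suc N)
      τ̂-fixes-G = QR.coefficientwise λ i → PR.trans (coeff-map {R = K[T]} {S = K[T]} τ̂-hom (G 0 (suc N)) i)
        (τ̂-fixes _ (PR.trans (PR.sym (coeff-map {R = K[T]} {S = K[T]} Φ̂-hom (G 0 (suc N)) i))
          (QR.at Φ̂-fixes-G i)))

      eval-G-F : Q.eval (G 0 (suc N)) zs ≋ []
      eval-G-F = begin
        Q.eval (G 0 (suc N)) zs                       ≈⟨ QR.eval-cong zs (G-shift N) ⟨
        Q.eval ((Q.X- F 0) Q.*ᴾ G 1 N) zs             ≈⟨ QR.eval-* (Q.X- F 0) (G 1 N) zs ⟩
        Q.eval (Q.X- F 0) zs *ᴾ Q.eval (G 1 N) zs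
          ≈⟨ PR.*-congʳ {Q.eval (G 1 N) zs} (PR.trans (eval-linear (F 0) zs)
               (PR.trans (PR.+-congʳ {negate (F 0)} (PR.sym F-0)) (+ᴾ-inverseʳ (F 0)))) ⟩
        []                                            ∎
        where open SetoidReasoning PR.setoid

      eval-G-τF : Q.eval (G 0 (suc N)) (τ̂ zs) ≋ []
      eval-G-τF = begin
        Q.eval (G 0 (suc N)) (τ̂ zs)                  ≈⟨ QR.eval-cong (τ̂ zs) τ̂-fixes-G ⟨
        Q.eval (List.map τ̂ (G 0 (suc N))) (τ̂ zs)
          ≈⟨ eval-map {R = K[T]} {S = K[T]} τ̂-hom (G 0 (suc N)) zs ⟩
        τ̂ (Q.eval (G 0 (suc N)) zs)                  ≈⟨ τ̂.⟦⟧-cong eval-G-F ⟩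
        []                                            ∎
        where open SetoidReasoning PR.setoid

      root-G : ∀ n g → Q.eval (G 0 n) g ≋ [] → ∃[ i ] g ≋ F i
      root-G zero    g e = ⊥-elim (IsDiscreteField.1≉0 isField
        (at (PR.trans (PR.sym (PR.trans (PR.+-congˡ {PR.1#} (PR.zeroʳ g)) (+ᴾ-identityʳ PR.1#))) e) 0))
      root-G (suc n) g e with *ᴾ≋[] _ _ (PR.trans (PR.sym (QR.eval-* (Q.X- F n) (G 0 n) g)) e)
      ... | inj₁ e₁ = n , PP.x∙y⁻¹≈ε⇒x≈y g (F n) (PR.trans (PR.sym (eval-linear (F n) g)) e₁)
      ... | inj₂ e₂ = root-G n g e₂

    -- τ fixes the coefficients of ∏ᵢ (Y - Φⁱ F), where F ∈ K[T] has the given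
    -- elements as coefficients; so τ F is one of its roots in the domain K[T].
    conjugate : ∃[ i ] List.map τ zs ≋ List.map (Φ ^[ i ]) zs
    conjugate = root-G (suc N) (τ̂ zs) eval-G-τF

-- The integers modulo a prime `l` as a finite field with `l` elements.

module _ {l : ℕ} (l-prime : Prime l) where
  private
    instance
      l≢0 : ℕ.NonZero l
      l≢0 = ℕPrime.prime⇒nonZero l-prime

    open CommutativeRing (ℤ/ l) using (_≈_; _≉_; sym; trans; *-congʳ; reflexive)

    ~remainder : ∀ x → + (x ℤDivMod.%ℕ l) ≈ x
    ~remainder x = sym (congruent (ℤDiv.divides (x ℤDivMod./ℕ l) (begin
      x ℤ.- + r                    ≡⟨ ≡.cong (ℤ._- + r) (ℤDivMod.a≡a%ℕn+[a/ℕn]*n x l) ⟩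
      + r ℤ.+ q ℤ.* + l ℤ.- + r    ≡⟨ solve 2 (λ r t → r :+ t :- r := t) ≡.refl (+ r) (q ℤ.* + l) ⟩
      q ℤ.* + l                    ∎)))
      where
      open ≡.≡-Reasoning
      open +-*-Solver
      r : ℕ
      r = x ℤDivMod.%ℕ l
      q : ℤ
      q = x ℤDivMod./ℕ l

    residue-injective : ∀ {m n} → m < l → n < l → + m ≈ + n → m ≡ n
    residue-injective {m} {n} m<l n<l (congruent d) = ℤ.+-injective (ℤ.i-j≡0⇒i≡j (+ m) (+ n)
      (ℤ.∣i∣≡0⇒i≡0 (zero-if-∣ (ℤDiv.∣⇒∣ᵤ d) small)))
      where
      small : ℤ.∣ + m ℤ.- + n ∣ < l
      small = ℕ.≤-<-trans (≡.subst (ℕ._≤ m ℕ.⊔ n) (≡.cong ℤ.∣_∣ (≡.sym (ℤ.m-n≡m⊖n m n)))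
        (ℤ.∣m⊝n∣≤m⊔n m n)) (ℕ.⊔-lub m<l n<l)
      zero-if-∣ : ∀ {k} → l ℕDiv.∣ k → k < l → k ≡ 0
      zero-if-∣ {zero}  _ _   = ≡.refl
      zero-if-∣ {suc k} d k<l = contradiction d (ℕDiv.>⇒∤ k<l)

    inverse-residue : ∀ n → .{{ℕ.NonZero n}} → n < l → ∃[ y ] + n ℤ.* y ≈ 1ℤ
    inverse-residue n n<l with ℕCoprime.coprime-Bézout (ℕCoprime.prime⇒coprime l-prime n<l)
    ... | ℕGCD.Bézout.-+ x y 1+xl≡yn = + y , congruent (ℤDiv.divides (+ x) (begin
      + n ℤ.* + y ℤ.- 1ℤ           ≡⟨ ≡.cong (ℤ._- 1ℤ) (≡.trans (≡.sym (ℤ.pos-* n y)) (≡.cong +_ (ℕ.*-comm n y))) ⟩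
      + (y ℕ.* n) ℤ.- 1ℤ           ≡⟨ ≡.cong (λ t → + t ℤ.- 1ℤ) 1+xl≡yn ⟨
      1ℤ ℤ.+ + (x ℕ.* l) ℤ.- 1ℤ    ≡⟨ solve 1 (λ t → con 1ℤ :+ t :- con 1ℤ := t) ≡.refl (+ (x ℕ.* l)) ⟩
      + (x ℕ.* l)                  ≡⟨ ℤ.pos-* x l ⟩
      + x ℤ.* + l                  ∎))
      where
      open ≡.≡-Reasoning
      open +-*-Solver
    ... | ℕGCD.Bézout.+- x y 1+yn≡xl = ℤ.- + y , congruent (ℤDiv.divides (ℤ.- + x) (begin
      + n ℤ.* (ℤ.- + y) ℤ.- 1ℤ
        ≡⟨ solve 2 (λ n y → n :* (:- y) :- con 1ℤ := :- (con 1ℤ :+ y :* n)) ≡.refl (+ n) (+ y) ⟩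
      ℤ.- (1ℤ ℤ.+ + y ℤ.* + n)     ≡⟨ ≡.cong (λ t → ℤ.- (1ℤ ℤ.+ t)) (≡.sym (ℤ.pos-* y n)) ⟩
      ℤ.- + (1 ℕ.+ y ℕ.* n)        ≡⟨ ≡.cong (λ t → ℤ.- + t) 1+yn≡xl ⟩
      ℤ.- + (x ℕ.* l)              ≡⟨ ≡.cong ℤ.-_ (ℤ.pos-* x l) ⟩
      ℤ.- (+ x ℤ.* + l)            ≡⟨ ℤ.neg-distribˡ-* (+ x) (+ l) ⟩
      ℤ.- + x ℤ.* + l              ∎))
      where
      open ≡.≡-Reasoning
      open +-*-Solver

    inverse : ∀ x → x ≉ 0ℤ → ∃[ y ] x ℤ.* y ≈ 1ℤ
    inverse x x≉0 with x ℤDivMod.%ℕ l | ~remainder x | ℤDivMod.n%ℕd<d x l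
    ... | zero  | e | _   = contradiction (sym e) x≉0
    ... | suc n | e | n<l = let (y , e') = inverse-residue (suc n) n<l in
      y , trans (*-congʳ {y} (sym e)) e'

  ℤ/-isFiniteField : IsFiniteField (ℤ/ l) l
  ℤ/-isFiniteField = record
    { isDiscreteField = record
      { _≟_     = λ x y → map′ congruent Congruent.divisible (+ l ℤDiv.∣? (x ℤ.- y))
      ; 1≉0     = λ (congruent d) → ℕPrime.¬prime[1]
          (≡.subst Prime (ℕDiv.∣1⇒≡1 (ℤDiv.∣⇒∣ᵤ d)) l-prime)
      ; inverse = inverse }
    ; enum           = λ i → + toℕ i
    ; index          = λ x → fromℕ< (ℤDivMod.n%ℕd<d x l)
    ; enum-index     = λ x → trans (reflexive (≡.cong +_ (Fin.toℕ-fromℕ< (ℤDivMod.n%ℕd<d x l)))) (~remainder x)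
    ; enum-injective = λ {i} {j} e → Fin.toℕ-injective (residue-injective (Fin.toℕ<n i) (Fin.toℕ<n j) e) }

open import Data.Nat.Base using (_*_; _∸_; _^_)
open import Data.Nat.Divisibility using (_∣_)
open import Relation.Binary.PropositionalEquality using (setoid)

-- Frobenius and Galois action on points, divisors and `l`-torsion.

module FrobeniusAction {c ℓ} (p m : ℕ) (p-prime : Prime p)
  (K : CommutativeRing c ℓ) (isClosure : IsAlgebraicClosureOf𝔽 p K)
  (C : HyperellipticCurve K (p ^ m)) where
  open Jacobian p m p-prime K isClosure C
  open CommutativeRing K using (Carrier; _≈_; _+_; 0#; 1#; refl; sym; trans; reflexive; rawRing; semiring; *-identityʳ)
  open IsAlgebraicClosureOf𝔽 isClosure using (isDiscreteField; algebraic; _≟_)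
  open Polynomial K using (Poly; coeff; eval)
  open PolynomialRing K using (_≋_; at; ∷-injective)
  open FieldPolynomials isDiscreteField using (roots⇒zero; module PR)
  open RawSemiringDefs (Semiring.rawSemiring semiring) using () renaming (_×_ to _×#_; _^_ to _^#_)
  private module E = Exp semiring

  fr : Carrier → Carrier
  fr z = z ^# q

  fr-isIsomorphism : IsRingIsomorphism rawRing rawRing fr
  fr-isIsomorphism = Gal.isRingIsomorphism frobenius

  fr^-isIsomorphism : ∀ j → IsRingIsomorphism rawRing rawRing (fr ^[ j ])
  fr^-isIsomorphism zero    = Identity.isRingIsomorphism rawRing refl
  fr^-isIsomorphism (suc j) =
    Composition.isRingIsomorphism trans (fr^-isIsomorphism j) fr-isIsomorphism

  fr^-power : ∀ j z → (fr ^[ j ]) z ≈ z ^# (q ^ j)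
  fr^-power zero    z = sym (*-identityʳ z)
  fr^-power (suc j) z = trans (E.^-congˡ q (fr^-power j z)) (trans (E.^-assocʳ z (q ^ j) q)
    (reflexive (≡.cong (z ^#_) (ℕ.*-comm (q ^ j) q))))

  frobenius^ : ∀ j → Gal K (q ^ j)
  frobenius^ j = record
    { σ = fr ^[ j ]
    ; isRingIsomorphism = fr^-isIsomorphism j
    ; fixes = λ x e → trans (fr^-power j x) e }

  module Fr^ j = IsRingIsomorphism (fr^-isIsomorphism j)

  fr^-fixed-* : ∀ k {n z} → (fr ^[ n ]) z ≈ z → (fr ^[ k * n ]) z ≈ z
  fr^-fixed-* zero            e = refl
  fr^-fixed-* (suc k) {n} {z} e = trans (reflexive (^[]-+ fr n (k * n) z))
    (trans (Fr^.⟦⟧-cong n (fr^-fixed-* k e)) e)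

  private
    -- `a ×# 1#` is a sum of ones and `fr` is additive. So `fr` fixes the coefficients of an
    -- equation over the prime field and maps roots of it to roots.
    fr-prime-field : ∀ a → fr (a ×# 1#) ≈ a ×# 1#
    fr-prime-field zero    = 0^ q 0<q
    fr-prime-field (suc a) = trans (^pʲ-+ m 1# (a ×# 1#))
      (CommutativeRing.+-cong K (1^ q) (fr-prime-field a))

    -- The conjugates of z are roots of a nonzero polynomial, so two of them agree.
    repetition : ∀ z → ∃₂ λ i j → i < j × (fr ^[ i ]) z ≈ (fr ^[ j ]) z
    repetition z = found (Fin.any? λ i → Fin.any? λ j → ¬? (i Fin.≟ j) ×-dec (conjugate i ≟ conjugate j))
      where
      G : Poly
      G = List.map (_×# 1#) (proj₁ (algebraic z))
      -- As many conjugates as `G` has coefficients, which exceeds the degree of `G`.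
      conjugate : Fin (List.length G) → Carrier
      conjugate i = (fr ^[ toℕ i ]) z
      G-fixed : ∀ i → fr (coeff G i) ≈ coeff G i
      G-fixed i = coeff-fixed (proj₁ (algebraic z)) i
        where
        coeff-fixed : ∀ g i → fr (coeff (List.map (_×# 1#) g) i) ≈ coeff (List.map (_×# 1#) g) i
        coeff-fixed []      i       = 0^ q 0<q
        coeff-fixed (a ∷ g) zero    = fr-prime-field a
        coeff-fixed (a ∷ g) (suc i) = coeff-fixed g i
      conjugate-root : ∀ i → eval G ((fr ^[ i ]) z) ≈ 0#
      conjugate-root zero    = proj₂ (proj₂ (algebraic z))
      conjugate-root (suc i) = trans (sym (Action.σ-eval 1 frobenius G ((fr ^[ i ]) z) G-fixed))
        (trans (E.^-congˡ q (conjugate-root i)) (0^ q 0<q))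
      found : Dec (∃[ i ] ∃[ j ] i ≢ j × conjugate i ≈ conjugate j) →
        ∃₂ λ i j → i < j × (fr ^[ i ]) z ≈ (fr ^[ j ]) z
      found (yes (i , j , i≢j , e)) with ℕ.<-cmp (toℕ i) (toℕ j)
      ... | tri< i<j _ _ = toℕ i , toℕ j , i<j , e
      ... | tri≈ _ i≡j _ = contradiction (Fin.toℕ-injective i≡j) i≢j
      ... | tri> _ _ j<i = toℕ j , toℕ i , j<i , sym e
      found (no distinct) = ⊥-elim (proj₁ (proj₂ (algebraic z)) (at (roots⇒zero conjugate
        (λ i j e → decidable-stable (i Fin.≟ j) λ i≢j → distinct (i , j , i≢j , e))
        G ℕ.≤-refl (conjugate-root ∘ toℕ))))

  -- Injectivity of `fr ^[ i ]` turns a repetition of the values at `i` and `j` into the period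
  -- `j - i`.
  periodic : ∀ z → ∃[ N ] 1 ≤ N × (fr ^[ N ]) z ≈ z
  periodic z = let (i , j , i<j , e) = repetition z in
    j ∸ i , ℕ.m<n⇒0<n∸m i<j , sym (Fr^.injective i (trans e (reflexive
      (≡.trans (≡.cong (λ n → (fr ^[ n ]) z) (≡.sym (ℕ.m+[n∸m]≡n (ℕ.<⇒≤ i<j)))) (^[]-+ fr i (j ∸ i) z)))))

  periodic-list : ∀ zs → ∃[ N ] List.map (fr ^[ suc N ]) zs ≋ zs
  periodic-list []       = 0 , PR.refl
  periodic-list (z ∷ zs) with periodic z | periodic-list zs
  -- The successor of this number is `suc M * suc N`, the product of the two periods.
  ... | (suc M , _ , e) | (N , e') = N ℕ.+ M * suc N , PolynomialRing.∷-cong K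
    (≡.subst (λ n → (fr ^[ n ]) z ≈ z) (ℕ.*-comm (suc N) (suc M)) (fr^-fixed-* (suc N) {suc M} e))
    (multiple (suc M))
    where
    multiple : ∀ k → List.map (fr ^[ k * suc N ]) zs ≋ zs
    multiple zero    = PR.reflexive (List.map-id zs)
    multiple (suc k) = PR.trans (PR.reflexive (≡.trans
        (List.map-cong (^[]-+ fr (suc N) (k * suc N)) zs) (List.map-∘ zs)))
      (PR.trans (map-cong {R = K} {S = K} (Fr^.isRingHomomorphism (suc N)) (multiple k)) e')

  coordinates : Divisor → List Carrier
  coordinates []            = []
  coordinates ((_ , P) ∷ D) = x P ∷ y P ∷ coordinates D

  -- A relation on coordinates alone. It lets the images of a divisor under two maps of `K` be
  -- compared as soon as the maps agree on its coordinates, with no regard to their values elsewhere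
  -- or to the proofs that points lie on the curve.
  Image : (Carrier → Carrier) → Divisor → Divisor → Set (c ⊔ ℓ)
  Image f = Pointwise λ (n , P) (n' , P') → n ≡ n' × f (x P) ≈ x P' × f (y P) ≈ y P'

  image-∼ : ∀ {f D E E'} → Image f D E → Image f D E' → E ∼ E'
  image-∼ i i' = ∼-from-≡ (multiplicities i i')
    where
    multiplicities : ∀ {f D E E'} → Image f D E → Image f D E' →
      ∀ P → multiplicity E P ≡ multiplicity E' P
    multiplicities []                       []                       P = ≡.refl
    multiplicities {E = (_ , Q) ∷ _} {(_ , Q') ∷ _} ((≡.refl , ex , ey) ∷ i) ((≡.refl , ex' , ey') ∷ i') P =
      ≡.cong₂ ℤ._+_
        (ifDec-cong (Q ≟ₚ P) (Q' ≟ₚ P)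
          (λ (gx , gy) → trans (trans (sym ex') ex) gx , trans (trans (sym ey') ey) gy)
          (λ (gx , gy) → trans (trans (sym ex) ex') gx , trans (trans (sym ey) ey') gy))
        (multiplicities i i' P)

  image-id : ∀ {f} D → List.map f (coordinates D) ≋ coordinates D → Image f D D
  image-id []            e = []
  image-id ((_ , P) ∷ D) e = let (ex , e₁) = ∷-injective e ; (ey , e₂) = ∷-injective e₁ in
    (≡.refl , ex , ey) ∷ image-id D e₂

  image-cong : ∀ {f g D E} → List.map g (coordinates D) ≋ List.map f (coordinates D) →
    Image f D E → Image g D E
  image-cong e []                    = []
  image-cong e ((≡.refl , fx , fy) ∷ i) = let (ex , e₁) = ∷-injective e ; (ey , e₂) = ∷-injective e₁ in
    (≡.refl , trans ex fx , trans ey fy) ∷ image-cong e₂ i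

  onDivisor-image : ∀ k (τ : Gal K (q ^ k)) D → Image (Gal.σ τ) D (Action.onDivisor k τ D)
  onDivisor-image k τ []            = []
  onDivisor-image k τ ((_ , P) ∷ D) = (≡.refl , refl , refl) ∷ onDivisor-image k τ D

  module Torsion {l : ℕ} (l-prime : Prime l) where
    V : Module (ℤ/ l) (c ⊔ ℓ) (c ⊔ ℓ)
    V = J[ l ]-module
    open Module V using (_≈ᴹ_)

    π-linear : IsLinear V π[ l ]
    π-linear = record
      { +ᴹ-isMonoidHomomorphism = record
        { isMagmaHomomorphism = record
          { isRelHomomorphism = record { cong = Action.onDivisor-cong 1 frobenius }
          ; homo = λ (D , _) (E , _) → ≡.subst (Action.onDivisor 1 frobenius (D List.++ E) ∼_)
              (List.map-++ _ D E) ∼-refl }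
        ; ε-homo = ∼-refl }
      ; *ₗ-homo = λ n (D , _) → ≡.subst (Action.onDivisor 1 frobenius (n · D) ∼_)
          (≡.sym (Action.onDivisor-· 1 frobenius n D)) ∼-refl }

    module π = LinearMap V π[ l ] π-linear

    π^-image : ∀ n D → Image (fr ^[ n ]) (proj₁ D) (proj₁ (π.φ^ n D))
    π^-image zero    (D , _) = image-id D (PR.reflexive (List.map-id (coordinates D)))
    π^-image (suc n) D       = step (π^-image n D)
      where
      step : ∀ {D E} → Image (fr ^[ n ]) D E → Image (fr ^[ suc n ]) D (Action.onDivisor 1 frobenius E)
      step []                       = []
      step ((≡.refl , ex , ey) ∷ i) = (≡.refl , E.^-congˡ q ex , E.^-congˡ q ey) ∷ step i

    π-torsion : ∀ D → ∃[ N ] 1 ≤ N × π.φ^ N D ≈ᴹ D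
    π-torsion D = let (N , e) = periodic-list (coordinates (proj₁ D)) in
      suc N , s≤s z≤n , image-∼ (π^-image (suc N) D) (image-id (proj₁ D) e)

    -- `frobenius^ j` is itself one of the automorphisms over the field with `q^j` elements, and it
    -- acts on `D` as `π^j`.
    definedOver⇒fixed : ∀ j D → DefinedOver j (proj₁ D) → π.φ^ j D ≈ᴹ D
    definedOver⇒fixed j D defined = ∼-trans
      (image-∼ (π^-image j D) (onDivisor-image j (frobenius^ j) (proj₁ D))) (defined (frobenius^ j))

    -- `π^j` may move the points of `D` within its class, so the periodicity asked for by
    -- `conjugate` is that of the coordinates, from `periodic-list`. Then `τ D` is `π^(i j) D` entry
    -- by entry, and that is equivalent to `D`.
    fixed⇒definedOver : ∀ j D → π.φ^ j D ≈ᴹ D → DefinedOver j (proj₁ D)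
    fixed⇒definedOver j D fixed τ =
      let zs      = coordinates (proj₁ D)
          (N , e) = periodic-list zs
          (i , conj) = GaloisOrbit.conjugate isDiscreteField
            (Fr^.isRingHomomorphism j) (IsRingIsomorphism.isRingHomomorphism (Gal.isRingIsomorphism τ))
            (λ x frx≈x → Gal.fixes τ x (trans (sym (fr^-power j x)) frx≈x))
            -- A period `suc N` of `fr` on the coordinates is also one of `fr ^[ j ]`.
            zs N (PR.trans (PR.reflexive (List.map-cong (λ z → ≡.sym (^[]-* fr (suc N) j z)) zs))
              (iterate zs N j e))
      in ∼-trans (image-∼
           (image-cong (PR.sym (PR.trans conj (PR.reflexive (List.map-cong (λ z → ≡.sym (^[]-* fr i j z)) zs))))
             (onDivisor-image j τ (proj₁ D)))
           (π^-image (i * j) D))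
         (π.φ^-fixed-* i {j} {D} fixed)
      where
      iterate : ∀ zs N j → List.map (fr ^[ suc N ]) zs ≋ zs → List.map (fr ^[ suc N * j ]) zs ≋ zs
      iterate []       N j e = PR.refl
      iterate (z ∷ zs) N j e = let (e₀ , e') = ∷-injective e in PolynomialRing.∷-cong K
        (≡.subst (λ n → (fr ^[ n ]) z ≈ z) (ℕ.*-comm j (suc N)) (fr^-fixed-* j {suc N} e₀)) (iterate zs N j e')

-- Minimal polynomial, degree of definition and count for the Jacobian.

proposition3p10 : ∀ {c ℓ} (p m : ℕ) (p-prime : Prime p) → p ≢ 2 → 1 ≤ m →
    (K : CommutativeRing c ℓ) (isClosure : IsAlgebraicClosureOf𝔽 p K)
    (C : HyperellipticCurve K (p ^ m)) →
    let open Jacobian p m p-prime K isClosure C in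
    (l : ℕ) → Prime l → ¬ (l ∣ q) →
    let open Polynomial (ℤ/ l)
        open LinearAlgebra J[ l ]-module π[ l ] in
    (B : CompanionBlocks (ℤ/ l)) →
    let open CompanionBlocks B in
    (v : Family B J[ l ]) (basis : IsBasis B v) → IsMatrixOfφ B v →
    (r : ℕ) → 1 ≤ r →
    (chosen : Fin r → Block) → (∀ s t → chosen s ≡ chosen t → s ≡ t) →
    (k : Fin r → ℕ) →
    (∀ s → 1 ≤ k s × k s ≤ e (proj₁ (chosen s)) (proj₂ (chosen s))) →
    ∃[ L ] IsLcm (λ s → P (proj₁ (chosen s)) ^ᴾ k s) L ×
      (∀ D → AtLevels B basis chosen k D → IsMinimalPolynomial D L) ×
      (∃[ o ] IsOrder L o ×
        (∀ D → AtLevels B basis chosen k D → IsDegreeOfDefinition (proj₁ D) o)) ×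
      Inverse
        (setoid (Fin (product +-*-rawSemiring
          (λ s → l ^ (d (proj₁ (chosen s)) * (k s ∸ 1)) * (l ^ d (proj₁ (chosen s)) ∸ 1)))))
        (AtLevelsSetoid B basis chosen k)
proposition3p10 p m p-prime _ _ K isClosure C l l-prime _ B v basis isMatrix r _
  chosen chosen-injective k k-bounds =
  let (L , isLcm)     = lcm Levels.chosenPower (λ s → _ , monic-^ _ (monic (proj₁ (chosen s))) (k s))
      (N , 1≤N , L∣)  = Levels.lcm-∣-X^n-1 π-torsion isLcm
      (o , isOrder)   = order (IsLcm.monic isLcm) N 1≤N L∣
      isMinimal       = Levels.minimalPolynomial isLcm
  in L , isLcm , isMinimal ,
     (o , isOrder , λ D atLevels → record
       { positive = IsOrder.positive isOrder
       ; defined  = fixed⇒definedOver o D (π.annihilated⇒fixed o {D} (π.annihilates-multiple L {D}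
           (IsMinimalPolynomial.annihilates (isMinimal D atLevels)) (IsOrder.divides isOrder)))
       ; least    = λ j 1≤j definedOver → IsOrder.least isOrder j 1≤j
           (minimal-∣ (isMinimal D atLevels) (X^n-1 j)
             (π.fixed⇒annihilated j {D} (definedOver⇒fixed j D definedOver))) }) ,
     Levels.counting
  where
  open Jacobian p m p-prime K isClosure C
  open FrobeniusAction p m p-prime K isClosure C
  open Torsion l-prime
  open Polynomial (ℤ/ l)
  open LinearAlgebra J[ l ]-module π[ l ]
  open CompanionBlocks B
  isFiniteField : IsFiniteField (ℤ/ l) l
  isFiniteField = ℤ/-isFiniteField l-prime
  open FieldPolynomials (IsFiniteField.isDiscreteField isFiniteField) using (monic-^)
  open FiniteFieldPolynomials isFiniteField using (lcm; order)
  open FiniteFieldLinearMap isFiniteField V π[ l ] π-linear using (minimal-∣)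
  module Blocks = BlockDecomposition isFiniteField V π[ l ] π-linear B v basis isMatrix
  module Levels = Blocks.Levels chosen chosen-injective k k-bounds
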